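{- For every cut-free proof-structure $R$ of the fragment $(\neg\bot\otimes)\mathit{LL}$: $R\models\mathsf{ACC}_{\sharp\mathsf w}$ if and only if $R$ is sequentializable in $(\neg\bot\otimes)\mathit{LL}$.
   Context: Formulae of $\mathit{MLL}$ (with units): $A::=X\mid \mathbf 1\mid\bot\mid A\otimes A\mid A\wp A$, with $X$ ranging over a countably infinite set of atomic formulae, equipped with a fixed-point-free involution $(\cdot)^\bot$, extended by $\mathbf 1^\bot=\bot$, $\bot^\bot=\mathbf 1$, $(A\otimes B)^\bot=A^\bot\wp B^\bot$, $(A\wp B)^\bot=A^\bot\otimes B^\bot$. The fragment $(\neg\bot\otimes)\mathit{LL}$ is the set of formulae of kind $A$ or $E$ given by $$A::=X\mid\mathbf 1\mid A\otimes A\mid A\wp A\mid A\wp E\mid E\wp A,\qquad E::=\bot\mid E\wp E.$$ Sequent calculus in a fragment $\mathcal F$ (all sequents are finite sequences of formulae of $\mathcal F$): axiom $\vdash A,A^\bot$; cut (from $\vdash\Gamma,A$ and $\vdash A^\bot,\Delta$ infer $\vdash\Gamma,\Delta$); exchange; $\otimes$ (from $\vdash\Gamma,A$ and $\vdash B,\Delta$ infer $\vdash\Gamma,A\otimes B,\Delta$); $\vdash\mathbf 1$; $\wp$ (from $\vdash\Gamma,A,B$ infer $\vdash\Gamma,A\wp B$); $\bot$ (from $\vdash\Gamma$ infer $\vdash\Gamma,\bot$). Graphs are finite directed graphs (parallel arcs allowed, no loops); an arc is a conclusion of its tail and a premise of its head. A proof-structure (ps) is such a graph without directed cycles, with nodes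 labelled $\mathtt{ax}$ (2 conclusions, no premise), $\mathtt{cut}$ (2 premises, no conclusion), $\mathtt 1$ or $\bot$ (1 conclusion, no premise), $\otimes$ or $\wp$ (2 premises ordered as left and right, 1 conclusion), $\bullet$ (1 premise, no conclusion), together with a total order on its conclusions (the premises of $\bullet$ nodes). It is cut-free if it has no $\mathtt{cut}$ node. It is a ps of a fragment $\mathcal F$ if its arcs are labelled by formulae of $\mathcal F$ (types) such that: the two conclusions of an $\mathtt{ax}$ node (resp. premises of a $\mathtt{cut}$ node) have dual types; the conclusion of a $\mathtt 1$ (resp. $\bot$) node has type $\mathbf 1$ (resp. $\bot$); the conclusion of a $\otimes$ (resp. $\wp$) node with left premise of type $B$ and right premise of type $C$ has type $B\otimes C$ (resp. $B\wp C$). A switching $\varphi$ of $R$ maps each $\wp$ node to one of its premises. The switching graph $R^\varphi$ is obtained by redirecting, for each $\wp$ node $n$, the head of the premise other than $\varphi(n)$ to a fresh $\bullet$ node. $R\models\mathsf{ACC}_{\sharp\mathsf w}$ means: for every switching $\varphi$, $R^\varphi$ has no undirected cycle and its number of connected components equals (number of $\bot$ nodes of $R$) $+1$. Desequentialization: each sequent calculus proof $\pi$ in $\mathcal F$ with conclusion $A_1,\dots,A_k$ yields a ps $\pi^\circ$ of $\mathcal F$ with conclusions of types $A_1,\dots,A_k$ in this order, by induction: an axiom (resp. $\mathbf 1$) rule gives one $\mathtt{ax}$ (resp. $\mathtt 1$) node whose conclusions point to $\bullet$ nodes; exchange changes the order of the conclusions; a $\bot$ rule adds, disjointly, a $\bot$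 node whose conclusion points to a $\bullet$ node; a $\wp$ rule removes the $\bullet$ nodes of the two active conclusions and makes them the left and right premises of a new $\wp$ node whose conclusion points to a new $\bullet$ node; a $\otimes$ (resp. cut) rule takes the disjoint union of the two ps, removes the $\bullet$ nodes of the two active conclusions and makes them the premises of a new $\otimes$ node whose conclusion points to a new $\bullet$ node (resp. of a new $\mathtt{cut}$ node). $R$ is sequentializable in $\mathcal F$ if $R=\pi^\circ$ (up to isomorphism) for some proof $\pi$ in $\mathcal F$. -}

module Defs where

open import Level using (0ℓ)
open import Data.Fin.Base using (Fin)
open import Data.List.Base using (List; []; _∷_; _++_)
open import Data.List.Membership.Propositional using (_∈_)
open import Data.List.Membership.Propositional.Properties using (∈-++⁺ˡ; ∈-++⁺ʳ; ∈-++⁻)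
open import Data.List.Relation.Binary.Permutation.Propositional using (_↭_)
open import Data.List.Relation.Binary.Permutation.Propositional.Properties using (∈-resp-↭)
open import Data.List.Relation.Unary.Any using (here; there)
open import Data.List.Relation.Unary.Unique.Propositional using (Unique)
open import Data.Nat.Base using (ℕ; suc)
open import Data.Product.Base using (Σ; ∃; _×_; _,_)
open import Data.Sum.Base using (_⊎_; inj₁; inj₂)
open import Data.Unit.Base using (⊤; tt)
open import Function.Bundles using (_↔_; Inverse)
open import Relation.Binary.Bundles using (Setoid)
open import Relation.Binary.Construct.Closure.Equivalence as Eq using (EqClosure)
open import Relation.Binary.Construct.Closure.ReflexiveTransitive using (ε; _◅_)
open import Relation.Binary.Construct.Closure.Symmetric using (SymClosure; fwd; bwd)
open import Relation.Binary.Construct.Closure.Transitive using (TransClosure)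
open import Relation.Binary.PropositionalEquality using (_≡_; _≢_; refl; setoid)
open import Relation.Nullary using (¬_)
open import Relation.Unary using (Pred; _∪_)

record Graph : Set₁ where
  field
    Node Arc  : Set
    tail head : Arc → Node

  Arrow : Node → Node → Set
  Arrow u v = ∃ λ a → tail a ≡ u × head a ≡ v

  DirectedAcyclic : Set
  DirectedAcyclic = ∀ v → ¬ TransClosure Arrow v v

  -- Undirected walks are the elements of EqClosure Arrow.

  arcOf : ∀ {u v} → SymClosure Arrow u v → Arc
  arcOf (fwd (a , _)) = a
  arcOf (bwd (a , _)) = a

  arcs : ∀ {u v} → EqClosure Arrow u v → List Arc
  arcs ε       = []
  arcs (s ◅ w) = arcOf s ∷ arcs w

  -- The last node of the walk is left out, so that a simple cycle visits
  -- pairwise distinct sources.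
  sources : ∀ {u v} → EqClosure Arrow u v → List Node
  sources     ε       = []
  sources {u} (_ ◅ w) = u ∷ sources w

  -- Distinctness of the arcs matters for cycles of length 2: going back and
  -- forth along one arc is not a cycle, two parallel arcs do form one.
  record UndirectedCycle : Set where
    field
      {start next}    : Node
      step            : SymClosure Arrow start next
      walk            : EqClosure Arrow next start
      distinctArcs    : Unique (arcs (step ◅ walk))
      distinctSources : Unique (sources (step ◅ walk))

  UndirectedAcyclic : Set
  UndirectedAcyclic = ¬ UndirectedCycle

  -- Nodes up to undirected connectedness.
  Components : Setoid 0ℓ 0ℓ
  Components = Eq.setoid Arrow

HasCardinality : Setoid 0ℓ 0ℓ → ℕ → Set
HasCardinality S n = Inverse S (setoid (Fin n))

Finite : Set → Set
Finite A = ∃ λ n → HasCardinality (setoid A) n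

-- The nodes labelled • are not listed here: see Target below.
data Label : Set where
  ax cut one bot tensor par : Label

#conclusions : Label → ℕ
#conclusions ax     = 2
#conclusions cut    = 0
#conclusions one    = 1
#conclusions bot    = 1
#conclusions tensor = 1
#conclusions par    = 1

data Side : Set where
  left right : Side

-- The places where a premise of a node can be plugged. The premises of ⊗ and ⅋
-- are ordered; the two premises of a cut are not, and share a single slot.
data Slot : Label → Set where
  cut-in : Slot cut
  ⊗-in   : Side → Slot tensor
  ⅋-in   : Side → Slot par

record AtomicFormulae : Set₁ where
  field
    Atom            : Set
    countable       : Atom ↔ ℕ
    dual            : Atom → Atom
    involutive      : ∀ X → dual (dual X) ≡ X
    fixedPointFree  : ∀ X → dual X ≢ X

module MLL (atoms : AtomicFormulae) where

  open AtomicFormulae atoms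

  infixr 7 _⊗_ _⅋_
  infix  8 _^⊥

  data Formula : Set where
    atom    : Atom → Formula
    𝟏 ⊥     : Formula
    _⊗_ _⅋_ : Formula → Formula → Formula

  _^⊥ : Formula → Formula
  atom X  ^⊥ = atom (dual X)
  𝟏       ^⊥ = ⊥
  ⊥       ^⊥ = 𝟏
  (A ⊗ B) ^⊥ = A ^⊥ ⅋ B ^⊥
  (A ⅋ B) ^⊥ = A ^⊥ ⊗ B ^⊥

  Fragment : Set₁
  Fragment = Pred Formula 0ℓ

  data KindE : Formula → Set where
    ⊥   : KindE ⊥
    _⅋_ : ∀ {E F} → KindE E → KindE F → KindE (E ⅋ F)

  data KindA : Formula → Set where
    atom : ∀ X → KindA (atom X)
    𝟏    : KindA 𝟏
    _⊗_  : ∀ {A B} → KindA A → KindA B → KindA (A ⊗ B)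
    _⅋_  : ∀ {A B} → KindA A → KindA B → KindA (A ⅋ B)
    _⅋ᴱ_ : ∀ {A E} → KindA A → KindE E → KindA (A ⅋ E)
    _ᴱ⅋_ : ∀ {E A} → KindE E → KindA A → KindA (E ⅋ A)

  [¬⊥⊗]LL : Fragment
  [¬⊥⊗]LL = KindA ∪ KindE

  Sequent : Set
  Sequent = List Formula

  -- The side conditions force every sequent of a proof to lie in the fragment.
  data Proof (𝓕 : Fragment) : Sequent → Set where
    ax-rule  : ∀ A → 𝓕 A → 𝓕 (A ^⊥) → Proof 𝓕 (A ∷ A ^⊥ ∷ [])
    cut-rule : ∀ Γ A {Δ} → Proof 𝓕 (Γ ++ A ∷ []) → Proof 𝓕 (A ^⊥ ∷ Δ) →
               Proof 𝓕 (Γ ++ Δ)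
    exchange : ∀ {Γ Δ} → Γ ↭ Δ → Proof 𝓕 Γ → Proof 𝓕 Δ
    ⊗-rule   : ∀ Γ A B {Δ} → 𝓕 (A ⊗ B) →
               Proof 𝓕 (Γ ++ A ∷ []) → Proof 𝓕 (B ∷ Δ) →
               Proof 𝓕 (Γ ++ A ⊗ B ∷ Δ)
    𝟏-rule   : 𝓕 𝟏 → Proof 𝓕 (𝟏 ∷ [])
    ⅋-rule   : ∀ Γ A B → 𝓕 (A ⅋ B) → Proof 𝓕 (Γ ++ A ∷ B ∷ []) →
               Proof 𝓕 (Γ ++ A ⅋ B ∷ [])
    ⊥-rule   : ∀ Γ → 𝓕 ⊥ → Proof 𝓕 Γ → Proof 𝓕 (Γ ++ ⊥ ∷ [])

  -- Nodes are given as a family Cell of sets indexed by the labels, except for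
  -- those labelled •. As each • node has exactly one premise, a total order on
  -- the conclusions amounts to a numbering of the • nodes: these are taken to be
  -- the positions of the sequent Γ listing the types of the conclusions.
  data Target (Cell : Label → Set) (Γ : Sequent) : Set where
    into : ∀ {l} → Cell l → Slot l → Target Cell Γ
    •    : ∀ {A} → A ∈ Γ → Target Cell Γ

  -- The number of arcs plugged at a given target in a proof-structure.
  #premises : ∀ {Cell Γ} → Target Cell Γ → ℕ
  #premises (into _ cut-in)   = 2
  #premises (into _ (⊗-in _)) = 1
  #premises (into _ (⅋-in _)) = 1
  #premises (• _)             = 1

  record Structure (Γ : Sequent) : Set₁ where
    field
      Cell : Label → Set
      Arc  : Set
      type : Arc → Formula
      tail : Arc → ∃ Cell
      head : Arc → Target Cell Γ

    data Node : Set where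
      cell : ∃ Cell → Node
      •    : ∀ {A} → A ∈ Γ → Node

    targetNode : Target Cell Γ → Node
    targetNode (into {l} c _) = cell (l , c)
    targetNode (• i)          = • i

    graph : Graph
    graph = record
      { Node = Node
      ; Arc  = Arc
      ; tail = λ a → cell (tail a)
      ; head = λ a → targetNode (head a)
      }

  module _ {Γ : Sequent} (R : Structure Γ) where
    open Structure R

    record IsProofStructure : Set where
      field
        finiteCells : Finite (∃ Cell)
        finiteArcs  : Finite Arc
        acyclic     : Graph.DirectedAcyclic graph
        conclusions : ∀ {l} (c : Cell l) →
                      (∃ λ a → tail a ≡ (l , c)) ↔ Fin (#conclusions l)
        premises    : ∀ t → (∃ λ a → head a ≡ t) ↔ Fin (#premises t)

    record HasTypesIn (𝓕 : Fragment) : Set where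
      field
        inFragment : ∀ a → 𝓕 (type a)
        ax-type    : ∀ {c : Cell ax} {a b} →
                     tail a ≡ (ax , c) → tail b ≡ (ax , c) → a ≢ b →
                     type b ≡ type a ^⊥
        cut-type   : ∀ {c : Cell cut} {a b} →
                     head a ≡ into c cut-in → head b ≡ into c cut-in → a ≢ b →
                     type b ≡ type a ^⊥
        one-type   : ∀ {c : Cell one} {a} → tail a ≡ (one , c) → type a ≡ 𝟏
        bot-type   : ∀ {c : Cell bot} {a} → tail a ≡ (bot , c) → type a ≡ ⊥
        ⊗-type     : ∀ {c : Cell tensor} {a b d} →
                     head a ≡ into c (⊗-in left) → head b ≡ into c (⊗-in right) →
                     tail d ≡ (tensor , c) → type d ≡ type a ⊗ type b
        ⅋-type     : ∀ {c : Cell par} {a b d} →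
                     head a ≡ into c (⅋-in left) → head b ≡ into c (⅋-in right) →
                     tail d ≡ (par , c) → type d ≡ type a ⅋ type b
        •-type     : ∀ {A} {i : A ∈ Γ} {a} → head a ≡ • i → type a ≡ A

    CutFree : Set
    CutFree = ¬ Cell cut

    -- A ⅋ node of a proof-structure has exactly one premise on each side, so
    -- choosing one of its premises amounts to choosing a side.
    Switching : Set
    Switching = Cell par → Side

    -- The fresh • node created at a ⅋ node c is inj₂ c.
    SwitchingNode : Set
    SwitchingNode = Node ⊎ Cell par

    redirect : Cell par → (chosen actual : Side) → SwitchingNode
    redirect c left  left  = inj₁ (cell (par , c))
    redirect c right right = inj₁ (cell (par , c))
    redirect c left  right = inj₂ c
    redirect c right left  = inj₂ c

    switchTarget : Switching → Target Cell Γ → SwitchingNode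
    switchTarget φ (into c (⅋-in s)) = redirect c (φ c) s
    switchTarget φ t                 = inj₁ (targetNode t)

    switchingGraph : Switching → Graph
    switchingGraph φ = record
      { Node = SwitchingNode
      ; Arc  = Arc
      ; tail = λ a → inj₁ (cell (tail a))
      ; head = λ a → switchTarget φ (head a)
      }

    ACC♯w : Set
    ACC♯w = ∃ λ w → HasCardinality (setoid (Cell bot)) w × (∀ φ →
              Graph.UndirectedAcyclic (switchingGraph φ) ×
              HasCardinality (Graph.Components (switchingGraph φ)) (suc w))

  record ProofStructure (𝓕 : Fragment) : Set₁ where
    field
      {conclusionTypes} : Sequent
      structure         : Structure conclusionTypes
      isProofStructure  : IsProofStructure structure
      hasTypes          : HasTypesIn structure 𝓕

  mapTarget : ∀ {C D Γ Δ} → (∀ {l} → C l → D l) →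
              (∀ {A} → A ∈ Γ → Target D Δ) → Target C Γ → Target D Δ
  mapTarget f g (into c s) = into (f c) s
  mapTarget f g (• i)      = g i

  infix 4 _≅_

  record _≅_ {Γ : Sequent} (R S : Structure Γ) : Set where
    private
      module R = Structure R
      module S = Structure S
    field
      cells : ∀ l → R.Cell l ↔ S.Cell l
      arcs  : R.Arc ↔ S.Arc

    onCell : ∀ {l} → R.Cell l → S.Cell l
    onCell {l} = Inverse.to (cells l)

    onArc : R.Arc → S.Arc
    onArc = Inverse.to arcs

    onTail : ∃ R.Cell → ∃ S.Cell
    onTail (l , c) = l , onCell c

    field
      type-preserved : ∀ a → S.type (onArc a) ≡ R.type a
      tail-preserved : ∀ a → S.tail (onArc a) ≡ onTail (R.tail a)
      head-preserved : ∀ a → S.head (onArc a) ≡ mapTarget onCell • (R.head a)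

  axˢ : ∀ A → Structure (A ∷ A ^⊥ ∷ [])
  axˢ A = record
    { Cell = λ l → l ≡ ax
    ; Arc  = Side
    ; type = λ { left → A ; right → A ^⊥ }
    ; tail = λ _ → ax , refl
    ; head = λ { left → • (here refl) ; right → • (there (here refl)) }
    }

  𝟏ˢ : Structure (𝟏 ∷ [])
  𝟏ˢ = record
    { Cell = λ l → l ≡ one
    ; Arc  = ⊤
    ; type = λ _ → 𝟏
    ; tail = λ _ → one , refl
    ; head = λ _ → • (here refl)
    }

  exchangeˢ : ∀ {Γ Δ} → Γ ↭ Δ → Structure Γ → Structure Δ
  exchangeˢ σ R = record
    { Cell = Cell
    ; Arc  = Arc
    ; type = type
    ; tail = tail
    ; head = λ a → mapTarget (λ c → c) (λ i → • (∈-resp-↭ σ i)) (head a)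
    }
    where open Structure R

  ⊥ˢ : ∀ Γ → Structure Γ → Structure (Γ ++ ⊥ ∷ [])
  ⊥ˢ Γ R = record
    { Cell = Cell′
    ; Arc  = R.Arc ⊎ ⊤
    ; type = λ { (inj₁ a) → R.type a ; (inj₂ tt) → ⊥ }
    ; tail = λ { (inj₁ a) → let (l , c) = R.tail a in l , inj₁ c
               ; (inj₂ tt) → bot , inj₂ refl }
    ; head = λ { (inj₁ a) → mapTarget inj₁ (λ i → • (∈-++⁺ˡ i)) (R.head a)
               ; (inj₂ tt) → • (∈-++⁺ʳ Γ (here refl)) }
    }
    where
    module R = Structure R

    Cell′ : Label → Set
    Cell′ l = R.Cell l ⊎ l ≡ bot

  ⅋ˢ : ∀ Γ A B → Structure (Γ ++ A ∷ B ∷ []) → Structure (Γ ++ A ⅋ B ∷ [])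
  ⅋ˢ Γ A B R = record
    { Cell = Cell′
    ; Arc  = R.Arc ⊎ ⊤
    ; type = λ { (inj₁ a) → R.type a ; (inj₂ tt) → A ⅋ B }
    ; tail = λ { (inj₁ a) → let (l , c) = R.tail a in l , inj₁ c
               ; (inj₂ tt) → par , inj₂ refl }
    ; head = λ { (inj₁ a) → mapTarget inj₁ (λ i → plug (∈-++⁻ Γ i)) (R.head a)
               ; (inj₂ tt) → • (∈-++⁺ʳ Γ (here refl)) }
    }
    where
    module R = Structure R

    Cell′ : Label → Set
    Cell′ l = R.Cell l ⊎ l ≡ par

    plug : ∀ {C} → C ∈ Γ ⊎ C ∈ A ∷ B ∷ [] → Target Cell′ (Γ ++ A ⅋ B ∷ [])
    plug (inj₁ i)                = • (∈-++⁺ˡ i)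
    plug (inj₂ (here _))         = into (inj₂ refl) (⅋-in left)
    plug (inj₂ (there (here _))) = into (inj₂ refl) (⅋-in right)

  ⊗ˢ : ∀ Γ A B {Δ} → Structure (Γ ++ A ∷ []) → Structure (B ∷ Δ) →
       Structure (Γ ++ A ⊗ B ∷ Δ)
  ⊗ˢ Γ A B {Δ} R S = record
    { Cell = Cell′
    ; Arc  = (R.Arc ⊎ S.Arc) ⊎ ⊤
    ; type = λ { (inj₁ (inj₁ a)) → R.type a
               ; (inj₁ (inj₂ a)) → S.type a
               ; (inj₂ tt)       → A ⊗ B }
    ; tail = λ { (inj₁ (inj₁ a)) → let (l , c) = R.tail a in l , inj₁ (inj₁ c)
               ; (inj₁ (inj₂ a)) → let (l , c) = S.tail a in l , inj₁ (inj₂ c)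
               ; (inj₂ tt)       → tensor , inj₂ refl }
    ; head = λ { (inj₁ (inj₁ a)) → mapTarget (λ c → inj₁ (inj₁ c))
                                             (λ i → plugˡ (∈-++⁻ Γ i)) (R.head a)
               ; (inj₁ (inj₂ a)) → mapTarget (λ c → inj₁ (inj₂ c)) plugʳ (S.head a)
               ; (inj₂ tt)       → • (∈-++⁺ʳ Γ (here refl)) }
    }
    where
    module R = Structure R
    module S = Structure S

    Cell′ : Label → Set
    Cell′ l = (R.Cell l ⊎ S.Cell l) ⊎ l ≡ tensor

    plugˡ : ∀ {C} → C ∈ Γ ⊎ C ∈ A ∷ [] → Target Cell′ (Γ ++ A ⊗ B ∷ Δ)
    plugˡ (inj₁ i)        = • (∈-++⁺ˡ i)
    plugˡ (inj₂ (here _)) = into (inj₂ refl) (⊗-in left)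

    plugʳ : ∀ {C} → C ∈ B ∷ Δ → Target Cell′ (Γ ++ A ⊗ B ∷ Δ)
    plugʳ (here _)  = into (inj₂ refl) (⊗-in right)
    plugʳ (there i) = • (∈-++⁺ʳ Γ (there i))

  cutˢ : ∀ Γ A {Δ} → Structure (Γ ++ A ∷ []) → Structure (A ^⊥ ∷ Δ) →
         Structure (Γ ++ Δ)
  cutˢ Γ A {Δ} R S = record
    { Cell = Cell′
    ; Arc  = R.Arc ⊎ S.Arc
    ; type = λ { (inj₁ a) → R.type a ; (inj₂ a) → S.type a }
    ; tail = λ { (inj₁ a) → let (l , c) = R.tail a in l , inj₁ (inj₁ c)
               ; (inj₂ a) → let (l , c) = S.tail a in l , inj₁ (inj₂ c) }
    ; head = λ { (inj₁ a) → mapTarget (λ c → inj₁ (inj₁ c))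
                                      (λ i → plugˡ (∈-++⁻ Γ i)) (R.head a)
               ; (inj₂ a) → mapTarget (λ c → inj₁ (inj₂ c)) plugʳ (S.head a) }
    }
    where
    module R = Structure R
    module S = Structure S

    Cell′ : Label → Set
    Cell′ l = (R.Cell l ⊎ S.Cell l) ⊎ l ≡ cut

    plugˡ : ∀ {C} → C ∈ Γ ⊎ C ∈ A ∷ [] → Target Cell′ (Γ ++ Δ)
    plugˡ (inj₁ i)        = • (∈-++⁺ˡ i)
    plugˡ (inj₂ (here _)) = into (inj₂ refl) cut-in

    plugʳ : ∀ {C} → C ∈ A ^⊥ ∷ Δ → Target Cell′ (Γ ++ Δ)
    plugʳ (here _)  = into (inj₂ refl) cut-in
    plugʳ (there i) = • (∈-++⁺ʳ Γ i)

  infix 9 _°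

  -- The conditions in IsProofStructure and HasTypesIn are not carried along: they
  -- hold of π ° for every π, and are invariant under isomorphism.
  _° : ∀ {𝓕 Γ} → Proof 𝓕 Γ → Structure Γ
  ax-rule A _ _      ° = axˢ A
  cut-rule Γ A π ρ   ° = cutˢ Γ A (π °) (ρ °)
  exchange σ π       ° = exchangeˢ σ (π °)
  ⊗-rule Γ A B _ π ρ ° = ⊗ˢ Γ A B (π °) (ρ °)
  𝟏-rule _           ° = 𝟏ˢ
  ⅋-rule Γ A B _ π   ° = ⅋ˢ Γ A B (π °)
  ⊥-rule Γ _ π       ° = ⊥ˢ Γ (π °)

  SequentializableIn : ∀ {Γ} → Fragment → Structure Γ → Set
  SequentializableIn {Γ} 𝓕 R = Σ (Proof 𝓕 Γ) λ π → R ≅ π °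

{-# OPTIONS --safe #-}
module Submission where

-- Soundness is an induction on proofs: at each rule, every switching graph of the
-- conclusion arises from those of the premises by gluing trees, and a ⊥ rule adds one
-- component.
--
-- For the converse, let W be the set of cells of the trees of ⅋ nodes grown from ⊥
-- nodes only. Their conclusions have types of kind E, so they are never premises of ⊗.
-- Restricting to switchings that avoid premises in W, each ⊥ node accounts for one
-- component, and ACC♯w says that the cells outside W form a tree. Since a ⅋ contributes
-- one node and one arc to a switching graph, a set S of cells closed under premises induces
-- #(ax, 𝟏) - #⊗ components, whatever the switching: this number is at least 1 if S meets
-- the complement of W, it is modular in S, and it is 1 for the whole net. Remove terminal
-- ⊥ and ⅋ nodes as long as possible. Then take a terminal ⊗ node t and a connected S,
-- closed under premises, containing a premise of t but not t, with S maximal among all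
-- choices of t and S. If a cell c ≠ t outside S had a premise in S, then the union of S
-- with a suitable empire (that of the other premise of c if c is a ⊗, that of a premise
-- of a terminal ⊗ below c if c is a ⅋) would give a larger choice. Hence t splits the
-- net, and both halves are again connected by modularity.

open import Defs
open import Algebra.Properties.CommutativeSemigroup using (interchange)
open import Axiom.UniquenessOfIdentityProofs.WithK using (uip)
open import Data.Bool using (Bool; true; false; _∧_; _∨_; not; if_then_else_; T?)
open import Data.Bool.Properties using (∧-zeroʳ; ∧-conicalˡ; ∧-conicalʳ; ¬-not; T-≡) renaming (_≟_ to _≟ᵇ_)
open import Data.Empty using (⊥-elim) renaming (⊥ to Empty)
open import Data.Fin.Base as Fin using (Fin; zero; suc; punchIn; punchOut)
open import Data.Fin.Induction using (spo-wellFounded; spo-noetherian)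
open import Data.Fin.Properties as Fin
  using (injective⇒≤; punchOut-punchIn; punchIn-punchOut; punchInᵢ≢i; +↔⊎)
open import Data.List.Base using (List; []; _∷_; _++_; length; filterᵇ; map; tabulate; lookup)
open import Data.List.Membership.Propositional using (_∈_; _∉_; find; lose)
open import Data.List.Membership.Propositional.Properties
  using (∈-++⁻; ∈-++⁺ˡ; ∈-++⁺ʳ; ∈-tabulate⁺; ∈-lookup; ∈-filter⁺; ∈-filter⁻)
open import Data.List.Membership.Setoid.Properties using (index-injective)
open import Data.List.Properties using (length-++)
open import Data.List.Relation.Binary.Permutation.Propositional as Perm
  using (_↭_; ↭-refl; ↭-sym; prep; swap)
open import Data.List.Relation.Binary.Permutation.Propositional.Properties
  using (∈-resp-↭; ∈-resp-[σ⁻¹∘σ]; ∈-resp-[σ∘σ⁻¹])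
open import Data.List.Relation.Unary.All using ([]; _∷_)
open import Data.List.Relation.Unary.All.Properties using (¬Any⇒All¬; All¬⇒¬Any)
open import Data.List.Relation.Unary.AllPairs using ([]; _∷_)
open import Data.List.Relation.Unary.Any using (here; there; any?; index)
open import Data.List.Relation.Unary.Any.Properties using (++⁻∘++⁺; ++⁺∘++⁻)
open import Data.List.Relation.Unary.Unique.Propositional using (Unique)
open import Data.List.Relation.Unary.Unique.Propositional.Properties using (tabulate⁺; filter⁺)
open import Data.Nat.Base using (ℕ; zero; suc; _+_; _≤_; _<_; z≤n; s≤s)
open import Data.Nat.Properties as ℕ hiding (_≟_)
open import Data.Product.Base using (Σ; ∃; _×_; _,_; proj₁; proj₂)
open import Data.Sum.Algebra using (⊎-comm)
open import Data.Sum.Base using (_⊎_; inj₁; inj₂; [_,_]′)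
open import Data.Sum.Function.Propositional using (_⊎-↔_)
open import Data.Sum.Properties using (inj₂-injective) renaming (≡-dec to ⊎-≡-dec)
open import Data.Unit.Base using (⊤; tt)
open import Function.Base using (_∘_; id; const; flip; case_of_)
open import Function.Bundles using (_↔_; _⇔_; Equivalence; Inverse; mk↔ₛ′; mk⇔)
open import Function.Properties.Inverse using (↔-refl; ↔-sym; ↔-trans)
open import Induction.WellFounded using (WellFounded; Acc; acc; module Subrelation)
open import Relation.Binary.Bundles using (Setoid)
open import Relation.Binary.Construct.Closure.Equivalence as Eq using (EqClosure)
open import Relation.Binary.Construct.Closure.ReflexiveTransitive using (ε; _◅_; _◅◅_)
open import Relation.Binary.Construct.Closure.Symmetric using (SymClosure; fwd; bwd)
open import Relation.Binary.Construct.Closure.Transitive as Plus using (TransClosure; [_]; _∷_)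
import Relation.Binary.Construct.On as On
open import Relation.Binary.Definitions using (DecidableEquality)
open import Relation.Binary.PropositionalEquality hiding ([_]; resp)
open import Relation.Binary.Structures using (IsStrictPartialOrder)
open import Relation.Nullary using (¬_; Dec; yes; no; does; contradiction)
open import Relation.Nullary.Decidable using (map′; dec-true; dec-false; ¬?; _×-dec_; _⊎-dec_)

-- Once W is erased, a ⅋ with exactly one premise in W would become a unary node. It is kept binary
-- by giving it its remaining premise on both sides, so that the splitting argument meets only
-- sources, ⊗ and ⅋. A splitting of the erased net is pulled back by putting each cell of W on the
-- side of the first cell outside W below it. Such a cell exists because terminal ⊥ and ⅋ nodes have
-- been removed beforehand, and it is unique because ⊥ and ⅋ nodes have a single conclusion.
--
-- That a part is connected is expressed by the inequality sources ≤ tensors + 1, which can be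
-- combined by arithmetic without naming a switching. Empires, in contrast, refer to all switchings
-- at once. That property is never decided: an empire is generated by decidable rules that preserve
-- it.
--
-- Acyclicity is used in the form "every edge is a bridge", so that walks may be concatenated
-- without being made simple.

true≢false : true ≢ false
true≢false ()

≢true⇒≡false : ∀ {b} → b ≢ true → b ≡ false
≢true⇒≡false = ¬-not

bool-cases : ∀ b → b ≡ true ⊎ b ≡ false
bool-cases true  = inj₁ refl
bool-cases false = inj₂ refl

∨-introʳ : ∀ x {y} → y ≡ true → x ∨ y ≡ true
∨-introʳ true  _ = refl
∨-introʳ false p = p

not-true : ∀ {b} → b ≡ false → not b ≡ true
not-true refl = refl

not-true⁻ : ∀ {b} → not b ≡ true → b ≡ false
not-true⁻ {false} _ = refl

dec-true⁻ : ∀ {P : Set} (d : Dec P) → does d ≡ true → P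
dec-true⁻ (yes p) _ = p

dec-false⁻ : ∀ {P : Set} (d : Dec P) → does d ≡ false → ¬ P
dec-false⁻ (no ¬p) _ = ¬p

other : Side → Side
other left  = right
other right = left

_≟ˢ_ : DecidableEquality Side
left  ≟ˢ left  = yes refl
left  ≟ˢ right = no λ ()
right ≟ˢ left  = no λ ()
right ≟ˢ right = yes refl

≢⇒other : ∀ {s t : Side} → s ≢ t → t ≡ other s
≢⇒other {left}  {left}  p = contradiction refl p
≢⇒other {left}  {right} _ = refl
≢⇒other {right} {left}  _ = refl
≢⇒other {right} {right} p = contradiction refl p

other≢ : ∀ s → other s ≢ s
other≢ left  ()
other≢ right ()

anySide? : ∀ {P : Side → Set} → (∀ s → Dec (P s)) → Dec (∃ P)
anySide? P? = map′ [ (λ p → left , p) , (λ p → right , p) ]′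
  (λ { (left , p) → inj₁ p ; (right , p) → inj₂ p }) (P? left ⊎-dec P? right)

allSides? : ∀ {P : Side → Set} → (∀ s → Dec (P s)) → Dec (∀ s → P s)
allSides? P? = map′ (λ { (p , q) left → p ; (p , q) right → q })
  (λ h → h left , h right) (P? left ×-dec P? right)

some? : ∀ {A : Set} {P : A → Set} xs → (∀ x → Dec (P x)) → Dec (∃ λ x → x ∈ xs × P x)
some? xs P? = map′ find (λ (_ , x∈ , p) → lose x∈ p) (any? P? xs)

-- Counting

toℕᵇ : Bool → ℕ
toℕᵇ true  = 1
toℕᵇ false = 0

count : ∀ {A : Set} → (A → Bool) → List A → ℕ
count p []       = 0
count p (x ∷ xs) = toℕᵇ (p x) + count p xs

module _ {A : Set} where

  count-cong : ∀ {p q : A → Bool} xs → (∀ x → x ∈ xs → p x ≡ q x) → count p xs ≡ count q xs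
  count-cong []       _ = refl
  count-cong (x ∷ xs) h =
    cong₂ _+_ (cong toℕᵇ (h x (here refl))) (count-cong xs λ y y∈ → h y (there y∈))

  -- Identities between counts reduce to pointwise identities of indicators; the form with two sets
  -- on each side is the one needed for the modularity of ∪ and ∩.
  count-+ : ∀ (p q r s : A → Bool) xs →
            (∀ x → x ∈ xs → toℕᵇ (p x) + toℕᵇ (q x) ≡ toℕᵇ (r x) + toℕᵇ (s x)) →
            count p xs + count q xs ≡ count r xs + count s xs
  count-+ p q r s []       _ = refl
  count-+ p q r s (x ∷ xs) h = begin
    (toℕᵇ (p x) + count p xs) + (toℕᵇ (q x) + count q xs)
      ≡⟨ interchange +-commutativeSemigroup (toℕᵇ (p x)) _ _ _ ⟩
    (toℕᵇ (p x) + toℕᵇ (q x)) + (count p xs + count q xs)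
      ≡⟨ cong₂ _+_ (h x (here refl)) (count-+ p q r s xs λ y y∈ → h y (there y∈)) ⟩
    (toℕᵇ (r x) + toℕᵇ (s x)) + (count r xs + count s xs)
      ≡⟨ interchange +-commutativeSemigroup (toℕᵇ (r x)) _ _ _ ⟩
    (toℕᵇ (r x) + count r xs) + (toℕᵇ (s x) + count s xs) ∎
    where open ≡-Reasoning

  count-false : ∀ xs → count {A} (const false) xs ≡ 0
  count-false []       = refl
  count-false (_ ∷ xs) = count-false xs

  count-all : ∀ xs → count {A} (const true) xs ≡ length xs
  count-all []       = refl
  count-all (_ ∷ xs) = cong suc (count-all xs)

  count-split : ∀ (p q r : A → Bool) xs →
                (∀ x → x ∈ xs → toℕᵇ (p x) ≡ toℕᵇ (q x) + toℕᵇ (r x)) →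
                count p xs ≡ count q xs + count r xs
  count-split p q r xs h = begin
    count p xs                           ≡⟨ sym (+-identityʳ _) ⟩
    count p xs + 0                       ≡⟨ cong (count p xs +_) (sym (count-false xs)) ⟩
    count p xs + count (const false) xs  ≡⟨ count-+ p (const false) q r xs
                                              (λ x x∈ → trans (+-identityʳ _) (h x x∈)) ⟩
    count q xs + count r xs              ∎
    where open ≡-Reasoning

  toℕᵇ-mono : ∀ {b c} → (b ≡ true → c ≡ true) → toℕᵇ b ≤ toℕᵇ c
  toℕᵇ-mono {true}  h rewrite h refl = ≤-refl
  toℕᵇ-mono {false} _ = z≤n

  count-mono : ∀ {p q : A → Bool} xs → (∀ x → x ∈ xs → p x ≡ true → q x ≡ true) →
               count p xs ≤ count q xs
  count-mono []       _ = z≤n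
  count-mono (x ∷ xs) h =
    +-mono-≤ (toℕᵇ-mono (h x (here refl))) (count-mono xs λ y y∈ → h y (there y∈))

  count-mono-< : ∀ {p q : A → Bool} {x} xs → (∀ x → x ∈ xs → p x ≡ true → q x ≡ true) →
                 x ∈ xs → p x ≡ false → q x ≡ true → count p xs < count q xs
  count-mono-< (x ∷ xs) h (here refl) px qx rewrite px | qx =
    s≤s (count-mono xs λ y y∈ → h y (there y∈))
  count-mono-< {p} {q} (x ∷ xs) h (there y∈) py qy =
    subst (_≤ count q (x ∷ xs)) (+-suc (toℕᵇ (p x)) (count p xs))
      (+-mono-≤ (toℕᵇ-mono (h x (here refl)))
                (count-mono-< xs (λ z z∈ → h z (there z∈)) y∈ py qy))

  count-pos : ∀ {p : A → Bool} {x} xs → x ∈ xs → p x ≡ true → 1 ≤ count p xs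
  count-pos {p} xs x∈ px =
    subst (_< count p xs) (count-false xs) (count-mono-< xs (λ _ _ ()) x∈ refl px)

  count-filter : ∀ (p q : A → Bool) xs → count p (filterᵇ q xs) ≡ count (λ x → q x ∧ p x) xs
  count-filter p q []       = refl
  count-filter p q (x ∷ xs) with q x
  ... | true  = cong (toℕᵇ (p x) +_) (count-filter p q xs)
  ... | false = count-filter p q xs

  ∈-filterᵇ⁺ : ∀ (q : A → Bool) {x xs} → x ∈ xs → q x ≡ true → x ∈ filterᵇ q xs
  ∈-filterᵇ⁺ q x∈ qx = ∈-filter⁺ (T? ∘ q) x∈ (Equivalence.from T-≡ qx)

  ∈-filterᵇ⁻ : ∀ (q : A → Bool) {x} xs → x ∈ filterᵇ q xs → x ∈ xs × q x ≡ true
  ∈-filterᵇ⁻ q xs x∈ = let (i , qx) = ∈-filter⁻ (T? ∘ q) {xs = xs} x∈ in i , Equivalence.to T-≡ qx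

  filterᵇ-unique : ∀ (q : A → Bool) {xs} → Unique xs → Unique (filterᵇ q xs)
  filterᵇ-unique q = filter⁺ (T? ∘ q)

  count-zero : ∀ (p : A → Bool) xs → (∀ x → x ∈ xs → p x ≡ false) → count p xs ≡ 0
  count-zero p xs h = trans (count-cong xs h) (count-false xs)

  count-singleton : DecidableEquality A → ∀ (p : A → Bool) {x} xs → Unique xs → x ∈ xs →
                    p x ≡ true → (∀ y → y ∈ xs → p y ≡ true → y ≡ x) → count p xs ≡ 1
  count-singleton _≟_ p (x ∷ xs) (x∉ ∷ _) (here refl) px h rewrite px =
    cong suc (count-zero p xs λ y y∈ → ≢true⇒≡false λ py →
      All¬⇒¬Any x∉ (subst (_∈ xs) (h y (there y∈) py) y∈))
  count-singleton _≟_ p (x ∷ xs) (x∉ ∷ u) (there y∈) py h with p x in px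
  ... | true  = contradiction (subst (_∈ xs) (sym (h x (here refl) px)) y∈) (All¬⇒¬Any x∉)
  ... | false = count-singleton _≟_ p xs u y∈ py λ z z∈ → h z (there z∈)

  -- The exact length is recorded because merging two components must lower the number of
  -- representatives by exactly one.
  remove : ∀ {x} (xs : List A) → Unique xs → x ∈ xs → ∃ λ ys → Unique ys ×
           (∀ {y} → y ∈ xs → y ≢ x → y ∈ ys) × (∀ {y} → y ∈ ys → y ∈ xs × y ≢ x) ×
           length xs ≡ suc (length ys)
  remove (x ∷ xs) (x∉ ∷ u) (here refl) = xs , u ,
    (λ { (here refl) y≢ → contradiction refl y≢ ; (there y∈) _ → y∈ }) ,
    (λ y∈ → there y∈ , λ { refl → All¬⇒¬Any x∉ y∈ }) , refl
  remove (z ∷ xs) (z∉ ∷ u) (there x∈) with remove xs u x∈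
  ... | ys , u′ , to , from , len = z ∷ ys ,
    ¬Any⇒All¬ _ (λ z∈ → All¬⇒¬Any z∉ (proj₁ (from z∈))) ∷ u′ ,
    (λ { (here refl) _ → here refl ; (there y∈) y≢ → there (to y∈ y≢) }) ,
    (λ { (here refl) → here refl , (λ { refl → All¬⇒¬Any z∉ x∈ })
       ; (there y∈) → there (proj₁ (from y∈)) , proj₂ (from y∈) }) ,
    cong suc len

-- Sets generated by decidable rules

module Closure {A : Set} (_≟_ : DecidableEquality A) (cells : List A)
  (Rule : (A → Bool) → A → Set) (rule? : ∀ σ c → Dec (Rule σ c))
  (Q : A → Set)
  (sound : ∀ σ → (∀ c → σ c ≡ true → Q c) → ∀ c → c ∈ cells → Rule σ c → Q c)
  where

  record Closed (x : A) : Set where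
    field
      set    : A → Bool
      base   : set x ≡ true
      inside : ∀ c → set c ≡ true → Q c
      closed : ∀ c → c ∈ cells → Rule set c → set c ≡ true

  private
    insert : A → (A → Bool) → A → Bool
    insert c σ d = does (d ≟ c) ∨ σ d

    go : ∀ n σ x → count (not ∘ σ) cells ≤ n → σ x ≡ true → (∀ c → σ c ≡ true → Q c) → Closed x
    go n σ x bound σx σ⊆Q with some? cells (λ c → rule? σ c ×-dec (σ c ≟ᵇ false))
    ... | no none = record
      { set = σ ; base = σx ; inside = σ⊆Q
      ; closed = λ c c∈ r → ¬-not {x = σ c} {y = false} λ e → none (c , c∈ , r , e) }
    ... | yes (c , c∈ , r , e) = step n bound
      where
      σ′ = insert c σ
      less : count (not ∘ σ′) cells < count (not ∘ σ) cells
      less = count-mono-< cells (λ d _ h → lem d h) c∈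
               (cong not (subst (λ b → b ∨ σ c ≡ true) (sym (dec-true (c ≟ c) refl)) refl))
               (not-true e)
        where
        lem : ∀ d → not (σ′ d) ≡ true → not (σ d) ≡ true
        lem d h with d ≟ c
        ... | no _ = h
      ⊆Q : ∀ d → σ′ d ≡ true → Q d
      ⊆Q d h with d ≟ c
      ... | yes refl = sound σ σ⊆Q c c∈ r
      ... | no _     = σ⊆Q d h
      step : ∀ n → count (not ∘ σ) cells ≤ n → Closed x
      step zero b = contradiction (<-≤-trans less b) λ ()
      step (suc m) b = go m σ′ x (≤-pred (<-≤-trans less b)) (∨-introʳ (does (x ≟ c)) σx) ⊆Q

  -- Starting from `x` alone, cells to which a rule applies are added one by one; `sound` keeps the
  -- set within `Q`. Only `Rule` is decided, so `Q` may quantify over all switchings. Each addition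
  -- lowers the number of listed cells outside the set, which bounds the process.
  closure : ∀ x → Q x → Closed x
  closure x qx = go _ (λ c → does (c ≟ x)) x ≤-refl (dec-true (x ≟ x) refl)
                   λ c e → subst Q (sym (dec-true⁻ (c ≟ x) e)) qx

-- Bridges of acyclic graphs

module Bridges (G : Graph) (_≟_ : DecidableEquality (Graph.Node G)) where
  open Graph G

  Avoiding : Arc → Node → Node → Set
  Avoiding a u v = ∃ λ b → b ≢ a × tail b ≡ u × head b ≡ v

  private
    nodes : ∀ {u v} → EqClosure Arrow u v → List Node
    nodes {v = v} w = sources w ++ v ∷ []

    first∈nodes : ∀ {u v} (w : EqClosure Arrow u v) → u ∈ nodes w
    first∈nodes ε       = here refl
    first∈nodes (_ ◅ _) = here refl

    record SimplePath (a : Arc) (u v : Node) : Set where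
      field
        path    : EqClosure Arrow u v
        simple  : Unique (nodes path)
        avoids  : a ∉ arcs path

    ends∈nodes : ∀ {u v b} (w : EqClosure Arrow u v) → b ∈ arcs w → tail b ∈ nodes w × head b ∈ nodes w
    ends∈nodes (fwd (b , refl , refl) ◅ w) (here refl) = here refl , there (first∈nodes w)
    ends∈nodes (bwd (b , refl , refl) ◅ w) (here refl) = there (first∈nodes w) , here refl
    ends∈nodes (s ◅ w) (there b∈) = let (t , h) = ends∈nodes w b∈ in there t , there h

    source-of : ∀ {u v} (s : SymClosure Arrow u v) → u ≡ tail (arcOf s) ⊎ u ≡ head (arcOf s)
    source-of (fwd (_ , refl , _)) = inj₁ refl
    source-of (bwd (_ , _ , refl)) = inj₂ refl

    unique-arcs : ∀ {u v} (w : EqClosure Arrow u v) → Unique (nodes w) → Unique (arcs w)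
    unique-arcs ε       _        = []
    unique-arcs (s ◅ w) (u∉ ∷ un) = ¬Any⇒All¬ _ (λ s∈ → All¬⇒¬Any u∉ (lem s∈)) ∷ unique-arcs w un
      where
      lem : arcOf s ∈ arcs w → _ ∈ nodes w
      lem s∈ with source-of s
      ... | inj₁ e = subst (_∈ nodes w) (sym e) (proj₁ (ends∈nodes w s∈))
      ... | inj₂ e = subst (_∈ nodes w) (sym e) (proj₂ (ends∈nodes w s∈))

    suffix : ∀ {a u v x} (w : EqClosure Arrow u v) → Unique (nodes w) → a ∉ arcs w →
             x ∈ nodes w → SimplePath a x v
    suffix ε       un a∉ (here refl) = record { path = ε ; simple = un ; avoids = a∉ }
    suffix (s ◅ w) un a∉ (here refl) = record { path = s ◅ w ; simple = un ; avoids = a∉ }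
    suffix (s ◅ w) (_ ∷ un) a∉ (there x∈) = suffix w un (a∉ ∘ there) x∈

    forget : ∀ {a u v} → SymClosure (Avoiding a) u v → Σ (SymClosure Arrow u v) λ s → arcOf s ≢ a
    forget (fwd (b , b≢ , p)) = fwd (b , p) , b≢
    forget (bwd (b , b≢ , p)) = bwd (b , p) , b≢

    simplify : ∀ {a u v} → EqClosure (Avoiding a) u v → SimplePath a u v
    simplify ε = record { path = ε ; simple = [] ∷ [] ; avoids = λ () }
    simplify {a} {u} (s ◅ w) with simplify w | forget s
    -- Loop erasure: if `u` is already on the simple path, the part before that visit is dropped.
    ... | p | s′ , s≢ with any? (u ≟_) (nodes (SimplePath.path p))
    ... | yes u∈ = suffix (SimplePath.path p) (SimplePath.simple p) (SimplePath.avoids p) u∈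
    ... | no u∉ = record
      { path   = s′ ◅ SimplePath.path p
      ; simple = ¬Any⇒All¬ _ u∉ ∷ SimplePath.simple p
      ; avoids = λ { (here e) → s≢ (sym e) ; (there a∈) → SimplePath.avoids p a∈ } }

    last∉sources : ∀ {u v} (w : EqClosure Arrow u v) → Unique (nodes w) →
                   v ∉ sources w × Unique (sources w)
    last∉sources ε       _         = (λ ()) , []
    last∉sources {u} {v} (s ◅ w) (u∉ ∷ un) with last∉sources w un
    ... | v∉ , un′ = (λ { (here refl) → All¬⇒¬Any u∉ (last∈ w) ; (there v∈) → v∉ v∈ }) ,
                     ¬Any⇒All¬ _ (λ u∈ → All¬⇒¬Any u∉ (∈-++⁺ˡ u∈)) ∷ un′
      where
      last∈ : ∀ {u v} (w : EqClosure Arrow u v) → v ∈ nodes w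
      last∈ w = ∈-++⁺ʳ (sources w) (here refl)

  -- The loop-erased walk, closed by `a` traversed backwards from its head, would be a cycle.
  bridge : UndirectedAcyclic → ∀ a → ¬ EqClosure (Avoiding a) (tail a) (head a)
  bridge acyclic a w = acyclic record
    { step            = bwd (a , refl , refl)
    ; walk            = path
    ; distinctArcs    = ¬Any⇒All¬ _ avoids ∷ unique-arcs path simple
    ; distinctSources = let (h∉ , un) = last∉sources path simple in ¬Any⇒All¬ _ h∉ ∷ un
    }
    where open SimplePath (simplify w)

-- Splitting ⊗ cells of connected nets

data Kind : Set where
  source tens par : Kind

_≟ᵏ_ : DecidableEquality Kind
source ≟ᵏ source = yes refl
source ≟ᵏ tens   = no λ ()
source ≟ᵏ par    = no λ ()
tens   ≟ᵏ source = no λ ()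
tens   ≟ᵏ tens   = yes refl
tens   ≟ᵏ par    = no λ ()
par    ≟ᵏ source = no λ ()
par    ≟ᵏ tens   = no λ ()
par    ≟ᵏ par    = yes refl

isSource isTens isPar : Kind → Bool
isSource source = true
isSource _      = false
isTens tens = true
isTens _    = false
isPar par = true
isPar _   = false

-- Cells are the only nodes: arcs ending at • nodes are pendant and change neither the cycles nor
-- the number of components. At cells of kind `source` the value of `pre` is a mere default.
module Edges {C : Set} (kind : C → Kind) (pre : C → Side → C) where

  -- The edge (c , s) joins the cell c to its premise on the side s.
  Edge : Set
  Edge = C × Side

  source-end : Edge → C
  source-end (c , s) = pre c s

  Link : (Edge → Set) → C → C → Set
  Link P u v = ∃ λ e → P e × source-end e ≡ u × proj₁ e ≡ v

  Conn : (Edge → Set) → C → C → Set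
  Conn P = EqClosure (Link P)

  data Active (φ : C → Side) : Edge → Set where
    tensA : ∀ {c s} → kind c ≡ tens → Active φ (c , s)
    parA  : ∀ {c} → kind c ≡ par → Active φ (c , φ c)

  -- Every active edge is a bridge. Edges are compared as pairs and not by their ends, because both
  -- premises of a cell may come from the same cell: two such edges into a ⊗ form a cycle, whereas
  -- those into a ⅋ are never active together.
  Acyclic : Set
  Acyclic = ∀ φ e → Active φ e → ¬ Conn (λ e′ → Active φ e′ × e′ ≢ e) (source-end e) (proj₁ e)

  conn-sym : ∀ {P u v} → Conn P u v → Conn P v u
  conn-sym {P} = Eq.symmetric (Link P)

  conn-mono : ∀ {P Q : Edge → Set} → (∀ {e} → P e → Q e) → ∀ {u v} → Conn P u v → Conn Q u v
  conn-mono h = Eq.map λ (e , p , q) → e , h p , q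

  down : ∀ {P c s} → P (c , s) → Conn P (pre c s) c
  down p = Eq.return (_ , p , refl , refl)

  up : ∀ {P c s} → P (c , s) → Conn P c (pre c s)
  up p = conn-sym (down p)

-- Counting the components of forests

module UnionFind {C : Set} (_≟_ : DecidableEquality C) (kind : C → Kind) (pre : C → Side → C) where
  open Edges kind pre

  -- Independence in the graphic matroid: each edge joins two different components of the graph
  -- formed by the edges after it.
  data Independent : List Edge → Set where
    []  : Independent []
    _∷_ : ∀ {e es} → ¬ Conn (_∈ es) (source-end e) (proj₁ e) → Independent es →
          Independent (e ∷ es)

  record Components (es : List Edge) (Y : List C) : Set where
    field
      find-rep  : C → C
      reps      : List C
      unique    : Unique reps
      rep∈      : ∀ {v} → v ∈ Y → find-rep v ∈ reps
      reps⊆     : ∀ {r} → r ∈ reps → r ∈ Y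
      fixed     : ∀ {r} → r ∈ reps → find-rep r ≡ r
      connected : ∀ v → Conn (_∈ es) v (find-rep v)
      respects  : ∀ {c s} → (c , s) ∈ es → find-rep (pre c s) ≡ find-rep c
      size      : length Y ≡ length es + length reps

  -- Every edge of an independent list merges two classes, so exactly one representative disappears
  -- per edge; `size` is the resulting Euler formula for forests.
  components : ∀ es Y → Independent es → Unique Y →
               (∀ {c s} → (c , s) ∈ es → pre c s ∈ Y × c ∈ Y) → Components es Y
  components [] Y [] un _ = record
    { find-rep = id ; reps = Y ; unique = un ; rep∈ = id ; reps⊆ = id ; fixed = λ _ → refl
    ; connected = λ _ → ε ; respects = λ () ; size = refl }
  components ((c , s) ∷ es) Y (¬conn ∷ ind) un ends = record
    { find-rep = merge
    ; reps = reps′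
    ; unique = unique′
    ; rep∈ = λ {v} v∈ → merge∈ v v∈
    ; reps⊆ = λ r∈ → reps⊆ (proj₁ (from r∈))
    ; fixed = λ {r} r∈ → trans (merge-other r (subst (_≢ q) (sym (fixed (proj₁ (from r∈)))) (proj₂ (from r∈))))
                               (fixed (proj₁ (from r∈)))
    ; connected = merge-connected
    ; respects = merge-respects
    ; size = begin
        length Y                        ≡⟨ size ⟩
        length es + length reps         ≡⟨ cong (length es +_) len ⟩
        length es + suc (length reps′)  ≡⟨ +-suc (length es) _ ⟩
        suc (length es + length reps′)  ∎
    }
    where
    open ≡-Reasoning
    open Components (components es Y ind un (ends ∘ there))
    p = find-rep (pre c s)
    q = find-rep c
    p≢q : p ≢ q
    p≢q e = ¬conn (connected (pre c s) ◅◅ subst (λ z → Conn (_∈ es) z c) (sym e) (conn-sym (connected c)))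
    removal = remove reps unique (rep∈ (proj₂ (ends (here refl))))
    reps′   = proj₁ removal
    unique′ = proj₁ (proj₂ removal)
    to : ∀ {y} → y ∈ reps → y ≢ q → y ∈ reps′
    to = proj₁ (proj₂ (proj₂ removal))
    from : ∀ {y} → y ∈ reps′ → y ∈ reps × y ≢ q
    from = proj₁ (proj₂ (proj₂ (proj₂ removal)))
    len = proj₂ (proj₂ (proj₂ (proj₂ removal)))
    merge : C → C
    merge v = if does (find-rep v ≟ q) then p else find-rep v
    merge-q : ∀ v → find-rep v ≡ q → merge v ≡ p
    merge-q v e = cong (λ b → if b then p else find-rep v) (dec-true (find-rep v ≟ q) e)
    merge-other : ∀ v → find-rep v ≢ q → merge v ≡ find-rep v
    merge-other v ne = cong (λ b → if b then p else find-rep v) (dec-false (find-rep v ≟ q) ne)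
    merge∈ : ∀ v → v ∈ Y → merge v ∈ reps′
    merge∈ v v∈ with find-rep v ≟ q
    ... | yes e = to (rep∈ (proj₁ (ends (here refl)))) p≢q
    ... | no ne = to (rep∈ v∈) ne
    weaken : ∀ {u v} → Conn (_∈ es) u v → Conn (_∈ (c , s) ∷ es) u v
    weaken = conn-mono there
    merge-connected : ∀ v → Conn (_∈ (c , s) ∷ es) v (merge v)
    merge-connected v with find-rep v ≟ q
    ... | no _  = weaken (connected v)
    ... | yes e = weaken (connected v) ◅◅
                  subst (λ z → Conn (_∈ (c , s) ∷ es) z p) (sym e)
                    (weaken (conn-sym (connected c)) ◅◅ up (here refl) ◅◅ weaken (connected (pre c s)))
    merge-respects : ∀ {d t} → (d , t) ∈ (c , s) ∷ es → merge (pre d t) ≡ merge d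
    merge-respects (here refl) = trans (merge-other (pre c s) p≢q) (sym (merge-q c refl))
    merge-respects {d} {t} (there e∈) =
      cong (λ z → if does (z ≟ q) then p else z) (respects e∈)

  edgesOf : (C → Side) → C → Kind → List Edge
  edgesOf φ c source = []
  edgesOf φ c tens   = (c , left) ∷ (c , right) ∷ []
  edgesOf φ c par    = (c , φ c) ∷ []

  edges : (C → Side) → List C → List Edge
  edges φ []       = []
  edges φ (c ∷ cs) = edgesOf φ c (kind c) ++ edges φ cs

  ∈edges⁻ : ∀ φ {c s} cs → (c , s) ∈ edges φ cs → c ∈ cs × Active φ (c , s)
  ∈edges⁻ φ (d ∷ cs) e∈ with kind d in k
  ... | source = let (i , a) = ∈edges⁻ φ cs e∈ in there i , a
  ∈edges⁻ φ (d ∷ cs) (here refl)         | tens = here refl , tensA k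
  ∈edges⁻ φ (d ∷ cs) (there (here refl)) | tens = here refl , tensA k
  ∈edges⁻ φ (d ∷ cs) (there (there e∈))  | tens = let (i , a) = ∈edges⁻ φ cs e∈ in there i , a
  ∈edges⁻ φ (d ∷ cs) (here refl)         | par  = here refl , parA k
  ∈edges⁻ φ (d ∷ cs) (there e∈)          | par  = let (i , a) = ∈edges⁻ φ cs e∈ in there i , a

  -- The listed edges are active for the same switching and pairwise distinct, so a walk through the
  -- later ones would contradict that the first one is a bridge.
  edges-independent : Acyclic → ∀ φ {cs} → Unique cs → Independent (edges φ cs)
  edges-independent acyclic φ [] = []
  edges-independent acyclic φ {c ∷ cs} (c∉ ∷ un) with kind c in k
  ... | source = edges-independent acyclic φ un
  ... | par = (λ w → acyclic φ _ (parA k) (conn-mono old w)) ∷ edges-independent acyclic φ un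
    where
    old : ∀ {e} → e ∈ edges φ cs → Active φ e × e ≢ (c , φ c)
    old e∈ = let (i , a) = ∈edges⁻ φ cs e∈ in a , λ { refl → All¬⇒¬Any c∉ i }
  ... | tens = (λ w → acyclic φ (c , left) (tensA k) (conn-mono old₂ w)) ∷
               (λ w → acyclic φ (c , right) (tensA k) (conn-mono old w)) ∷
               edges-independent acyclic φ un
    where
    old : ∀ {e s} → e ∈ edges φ cs → Active φ e × e ≢ (c , s)
    old e∈ = let (i , a) = ∈edges⁻ φ cs e∈ in a , λ { refl → All¬⇒¬Any c∉ i }
    old₂ : ∀ {e} → e ∈ (c , right) ∷ edges φ cs → Active φ e × e ≢ (c , left)
    old₂ (here refl) = tensA k , λ ()
    old₂ (there e∈)  = old e∈

  #source #tens #par : List C → ℕ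
  #source = count (isSource ∘ kind)
  #tens   = count (isTens ∘ kind)
  #par    = count (isPar ∘ kind)

  length-edges : ∀ φ cs → length (edges φ cs) ≡ #tens cs + (#tens cs + #par cs)
  length-edges φ [] = refl
  length-edges φ (c ∷ cs) with kind c
  ... | source = length-edges φ cs
  ... | tens   = cong suc (trans (cong suc (length-edges φ cs)) (sym (+-suc (#tens cs) _)))
  ... | par    = begin
    suc (length (edges φ cs))                 ≡⟨ cong suc (length-edges φ cs) ⟩
    suc (#tens cs + (#tens cs + #par cs))     ≡⟨ sym (+-suc (#tens cs) _) ⟩
    #tens cs + suc (#tens cs + #par cs)       ≡⟨ cong (#tens cs +_) (sym (+-suc (#tens cs) _)) ⟩
    #tens cs + (#tens cs + suc (#par cs))     ∎
    where open ≡-Reasoning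

  length-cells : ∀ cs → length cs ≡ #source cs + (#tens cs + #par cs)
  length-cells [] = refl
  length-cells (c ∷ cs) with kind c
  ... | source = cong suc (length-cells cs)
  ... | tens   = trans (cong suc (length-cells cs)) (sym (+-suc (#source cs) _))
  ... | par    = begin
    suc (length cs)                               ≡⟨ cong suc (length-cells cs) ⟩
    suc (#source cs + (#tens cs + #par cs))       ≡⟨ sym (+-suc (#source cs) _) ⟩
    #source cs + suc (#tens cs + #par cs)         ≡⟨ cong (#source cs +_) (sym (+-suc (#tens cs) _)) ⟩
    #source cs + (#tens cs + suc (#par cs))       ∎
    where open ≡-Reasoning

  module _ (acyclic : Acyclic) (φ : C → Side) {Z : List C} (uniqueZ : Unique Z) where

    -- The nodes ts are not in Z but may be premises of cells of Z.
    componentsOf : ∀ ts → Unique (ts ++ Z) →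
                   (∀ {c s} → c ∈ Z → Active φ (c , s) → pre c s ∈ ts ++ Z) →
                   Σ (Components (edges φ Z) (ts ++ Z)) λ K →
                   length ts + #source Z ≡ #tens Z + length (Components.reps K)
    -- Nodes minus edges: a source brings one node, a ⊗ one node and two edges, a ⅋ one node and one
    -- edge. The summand `#tens Z + #par Z` appears on both sides and is cancelled.
    componentsOf ts un ends = K , +-cancelʳ-≡ (#tens Z + #par Z) _ _ (begin
      (length ts + #source Z) + (#tens Z + #par Z)       ≡⟨ +-assoc (length ts) _ _ ⟩
      length ts + (#source Z + (#tens Z + #par Z))       ≡⟨ cong (length ts +_) (sym (length-cells Z)) ⟩
      length ts + length Z                               ≡⟨ sym (length-++ ts) ⟩
      length (ts ++ Z)                                   ≡⟨ size ⟩
      length (edges φ Z) + length reps                   ≡⟨ cong (_+ length reps) (length-edges φ Z) ⟩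
      (#tens Z + (#tens Z + #par Z)) + length reps       ≡⟨ +-assoc (#tens Z) _ _ ⟩
      #tens Z + ((#tens Z + #par Z) + length reps)       ≡⟨ cong (#tens Z +_) (+-comm (#tens Z + #par Z) _) ⟩
      #tens Z + (length reps + (#tens Z + #par Z))       ≡⟨ sym (+-assoc (#tens Z) _ _) ⟩
      (#tens Z + length reps) + (#tens Z + #par Z)       ∎)
      where
      open ≡-Reasoning
      K = components (edges φ Z) (ts ++ Z) (edges-independent acyclic φ uniqueZ) un
            (λ e∈ → let (c∈ , a) = ∈edges⁻ φ Z e∈ in ends c∈ a , ∈-++⁺ʳ ts c∈)
      open Components K

module Splitting {C : Set} (_≟_ : DecidableEquality C) (kind : C → Kind) (pre : C → Side → C)
  (acyclic : Edges.Acyclic kind pre)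
  (cells : List C) (unique : Unique cells)
  (pre∈ : ∀ {c} → c ∈ cells → kind c ≢ source → ∀ s → pre c s ∈ cells)
  where

  open Edges kind pre
  open UnionFind _≟_ kind pre

  UpClosed : (C → Bool) → Set
  UpClosed σ = ∀ {c} → c ∈ cells → kind c ≢ source → σ c ≡ true → ∀ s → σ (pre c s) ≡ true

  sources tensors : (C → Bool) → ℕ
  sources σ = count (λ c → σ c ∧ isSource (kind c)) cells
  tensors σ = count (λ c → σ c ∧ isTens (kind c)) cells

  private
    tens≢source : ∀ {c} → kind c ≡ tens → kind c ≢ source
    tens≢source e e′ with () ← trans (sym e) e′

    par≢source : ∀ {c} → kind c ≡ par → kind c ≢ source
    par≢source e e′ with () ← trans (sym e) e′

    par≢tens : ∀ {c} → kind c ≡ par → kind c ≢ tens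
    par≢tens e e′ with () ← trans (sym e) e′

    active≢source : ∀ {φ c s} → Active φ (c , s) → kind c ≢ source
    active≢source (tensA k) = tens≢source k
    active≢source (parA k)  = par≢source k

    nonempty : ∀ {x : C} {xs} → x ∈ xs → 1 ≤ length xs
    nonempty (here _)  = s≤s z≤n
    nonempty (there _) = s≤s z≤n

    module Restrict (σ : C → Bool) where
      Z = filterᵇ σ cells
      uniqueZ : Unique Z
      uniqueZ = filterᵇ-unique σ unique
      #sourceZ : #source Z ≡ sources σ
      #sourceZ = count-filter (isSource ∘ kind) σ cells
      #tensZ : #tens Z ≡ tensors σ
      #tensZ = count-filter (isTens ∘ kind) σ cells

  -- A nonempty forest has at least one component.
  tensors<sources : ∀ {σ x} → UpClosed σ → x ∈ cells → σ x ≡ true → suc (tensors σ) ≤ sources σ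
  tensors<sources {σ} {x} closed x∈ σx = begin
    suc (tensors σ)                ≡⟨ +-comm 1 _ ⟩
    tensors σ + 1                  ≤⟨ +-monoʳ-≤ (tensors σ) (nonempty (rep∈ (∈-filterᵇ⁺ σ x∈ σx))) ⟩
    tensors σ + length reps        ≡⟨ cong (_+ length reps) (sym #tensZ) ⟩
    #tens Z + length reps          ≡⟨ sym (proj₂ result) ⟩
    #source Z                      ≡⟨ #sourceZ ⟩
    sources σ                      ∎
    where
    open ≤-Reasoning
    open Restrict σ
    result = componentsOf acyclic (const left) uniqueZ [] uniqueZ λ {c} c∈ a →
      let (c∈′ , σc) = ∈-filterᵇ⁻ σ cells c∈ ; k = active≢source a in
      ∈-filterᵇ⁺ σ (pre∈ c∈′ k _) (closed c∈′ k σc _)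
    open Components (proj₁ result)

  _∪_ _∩_ : (C → Bool) → (C → Bool) → C → Bool
  (σ ∪ τ) c = σ c ∨ τ c
  (σ ∩ τ) c = σ c ∧ τ c

  infixl 6 _∪_ _∩_

  upClosed-∪ : ∀ {σ τ} → UpClosed σ → UpClosed τ → UpClosed (σ ∪ τ)
  upClosed-∪ {σ} {τ} f g {c} c∈ k e s with σ c in σc
  ... | true  rewrite f c∈ k σc s = refl
  ... | false = ∨-introʳ (σ (pre c s)) (g c∈ k e s)

  upClosed-∩ : ∀ {σ τ} → UpClosed σ → UpClosed τ → UpClosed (σ ∩ τ)
  upClosed-∩ f g c∈ k e s rewrite f c∈ k (∧-conicalˡ _ _ e) s = g c∈ k (∧-conicalʳ _ _ e) s

  modular : ∀ (p : C → Bool) σ τ →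
            count (λ c → (σ ∪ τ) c ∧ p c) cells + count (λ c → (σ ∩ τ) c ∧ p c) cells ≡
            count (λ c → σ c ∧ p c) cells + count (λ c → τ c ∧ p c) cells
  modular p σ τ = count-+ (λ c → (σ ∪ τ) c ∧ p c) _ (λ c → σ c ∧ p c) _ cells
                    λ c _ → lem (σ c) (τ c) (p c)
    where
    lem : ∀ x y z → toℕᵇ ((x ∨ y) ∧ z) + toℕᵇ ((x ∧ y) ∧ z) ≡ toℕᵇ (x ∧ z) + toℕᵇ (y ∧ z)
    lem true  true  _ = refl
    lem true  false _ = refl
    lem false y     z = +-identityʳ _

  ⟨_⟩ : C → C → Bool
  ⟨ c ⟩ d = does (d ≟ c)

  private
    count-⟨⟩ : ∀ (p : C → Bool) {c} → c ∈ cells → count (λ d → ⟨ c ⟩ d ∧ p d) cells ≡ toℕᵇ (p c)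
    count-⟨⟩ p {c} c∈ with p c in pc
    ... | true  = count-singleton _≟_ _ cells unique c∈
                    (trans (cong (_∧ p c) (dec-true (c ≟ c) refl)) pc)
                    (λ d _ e → dec-true⁻ (d ≟ c) (∧-conicalˡ _ _ e))
    ... | false = count-zero _ cells λ d _ → lem d
      where
      lem : ∀ d → does (d ≟ c) ∧ p d ≡ false
      lem d with d ≟ c
      ... | yes refl = pc
      ... | no _     = refl

    count-insert : ∀ (p : C → Bool) σ {c} → c ∈ cells → σ c ≡ false →
                   count (λ d → (σ ∪ ⟨ c ⟩) d ∧ p d) cells ≡ count (λ d → σ d ∧ p d) cells + toℕᵇ (p c)
    count-insert p σ {c} c∈ σc =
      trans (count-split _ (λ d → σ d ∧ p d) (λ d → ⟨ c ⟩ d ∧ p d) cells λ d _ → lem d)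
            (cong (count (λ d → σ d ∧ p d) cells +_) (count-⟨⟩ p c∈))
      where
      lem : ∀ d → toℕᵇ ((σ d ∨ does (d ≟ c)) ∧ p d) ≡ toℕᵇ (σ d ∧ p d) + toℕᵇ (does (d ≟ c) ∧ p d)
      lem d with d ≟ c
      ... | yes refl rewrite σc = refl
      ... | no _ with σ d
      ...   | true  = sym (+-identityʳ _)
      ...   | false = refl

  upClosed-insert : ∀ {σ c} → UpClosed σ → (∀ s → σ (pre c s) ≡ true) → UpClosed (σ ∪ ⟨ c ⟩)
  upClosed-insert {σ} {c} f h {d} d∈ k e s with d ≟ c
  ... | yes refl rewrite h s = refl
  ... | no _ with σ d in σd
  ...   | true rewrite f d∈ k σd s = refl

  -- Adding the ⊗ would give more ⊗ cells than a forest allows.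
  no-tensor : ∀ {σ c} → UpClosed σ → sources σ ≤ suc (tensors σ) → c ∈ cells → kind c ≡ tens →
              σ c ≡ false → ¬ (∀ s → σ (pre c s) ≡ true)
  no-tensor {σ} {c} closed bound c∈ k σc h = <-irrefl refl (begin-strict
    sources σ                       ≤⟨ bound ⟩
    suc (tensors σ)                 ≡⟨ +-comm 1 _ ⟩
    tensors σ + 1                   ≡⟨ cong (λ z → tensors σ + toℕᵇ (isTens z)) (sym k) ⟩
    tensors σ + toℕᵇ (isTens (kind c)) ≡⟨ sym (count-insert (isTens ∘ kind) σ c∈ σc) ⟩
    tensors (σ ∪ ⟨ c ⟩)             <⟨ tensors<sources (upClosed-insert closed h) c∈
                                         (∨-introʳ (σ c) (dec-true (c ≟ c) refl)) ⟩
    sources (σ ∪ ⟨ c ⟩)             ≡⟨ count-insert (isSource ∘ kind) σ c∈ σc ⟩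
    sources σ + toℕᵇ (isSource (kind c)) ≡⟨ cong (λ z → sources σ + toℕᵇ (isSource z)) k ⟩
    sources σ + 0                   ≡⟨ +-identityʳ _ ⟩
    sources σ                       ∎)
    where open ≤-Reasoning

  -- For a set closed under premises, sources minus tensors is the number of components, so each
  -- bound says "connected". This number is modular, and the intersection contains `x`, hence has at
  -- least one component: the union has at most 1 + 1 - 1.
  union-bound : ∀ {σ τ x} → UpClosed σ → UpClosed τ → sources σ ≤ suc (tensors σ) →
                sources τ ≤ suc (tensors τ) → x ∈ cells → σ x ≡ true → τ x ≡ true →
                sources (σ ∪ τ) ≤ suc (tensors (σ ∪ τ))
  union-bound {σ} {τ} {x} f g bσ bτ x∈ σx τx = +-cancelʳ-≤ (suc (tensors (σ ∩ τ))) _ _ (begin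
    sources (σ ∪ τ) + suc (tensors (σ ∩ τ))
      ≤⟨ +-monoʳ-≤ (sources (σ ∪ τ)) (tensors<sources (upClosed-∩ f g) x∈ (cong₂ _∧_ σx τx)) ⟩
    sources (σ ∪ τ) + sources (σ ∩ τ)
      ≡⟨ modular (isSource ∘ kind) σ τ ⟩
    sources σ + sources τ
      ≤⟨ +-mono-≤ bσ bτ ⟩
    suc (tensors σ) + suc (tensors τ)
      ≡⟨ cong suc (+-suc (tensors σ) (tensors τ)) ⟩
    suc (suc (tensors σ + tensors τ))
      ≡⟨ cong (2 +_) (sym (modular (isTens ∘ kind) σ τ)) ⟩
    suc (suc (tensors (σ ∪ τ) + tensors (σ ∩ τ)))
      ≡⟨ cong suc (sym (+-suc (tensors (σ ∪ τ)) _)) ⟩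
    suc (tensors (σ ∪ τ)) + suc (tensors (σ ∩ τ)) ∎)
    where open ≤-Reasoning

  -- Two connected sets without a common cell make at most two components. A ⊗ with one premise in
  -- each joins them, which `insert-bound` accounts for by one more tensor.
  disjoint-bound : ∀ {σ τ} → sources σ ≤ suc (tensors σ) → sources τ ≤ suc (tensors τ) →
                   (∀ x → x ∈ cells → (σ ∩ τ) x ≡ false) →
                   sources (σ ∪ τ) ≤ suc (suc (tensors (σ ∪ τ)))
  disjoint-bound {σ} {τ} bσ bτ disjoint = begin
    sources (σ ∪ τ)                     ≤⟨ m≤m+n _ _ ⟩
    sources (σ ∪ τ) + sources (σ ∩ τ)   ≡⟨ modular (isSource ∘ kind) σ τ ⟩
    sources σ + sources τ               ≤⟨ +-mono-≤ bσ bτ ⟩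
    suc (tensors σ) + suc (tensors τ)   ≡⟨ cong suc (+-suc (tensors σ) (tensors τ)) ⟩
    suc (suc (tensors σ + tensors τ))   ≡⟨ cong (2 +_) (sym (modular (isTens ∘ kind) σ τ)) ⟩
    suc (suc (tensors (σ ∪ τ) + tensors (σ ∩ τ)))
      ≡⟨ cong (λ z → suc (suc (tensors (σ ∪ τ) + z)))
              (count-zero _ cells λ c c∈ → cong (_∧ isTens (kind c)) (disjoint c c∈)) ⟩
    suc (suc (tensors (σ ∪ τ) + 0))     ≡⟨ cong (2 +_) (+-identityʳ _) ⟩
    suc (suc (tensors (σ ∪ τ)))         ∎
    where open ≤-Reasoning

  insert-bound : ∀ {σ c} → sources σ ≤ suc (suc (tensors σ)) → c ∈ cells → kind c ≡ tens →
                 σ c ≡ false → sources (σ ∪ ⟨ c ⟩) ≤ suc (tensors (σ ∪ ⟨ c ⟩))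
  insert-bound {σ} {c} b c∈ k σc = begin
    sources (σ ∪ ⟨ c ⟩)             ≡⟨ count-insert (isSource ∘ kind) σ c∈ σc ⟩
    sources σ + toℕᵇ (isSource (kind c)) ≡⟨ cong (λ z → sources σ + toℕᵇ (isSource z)) k ⟩
    sources σ + 0                   ≡⟨ +-identityʳ _ ⟩
    sources σ                       ≤⟨ b ⟩
    suc (suc (tensors σ))           ≡⟨ cong suc (+-comm 1 _) ⟩
    suc (tensors σ + 1)             ≡⟨ cong (λ z → suc (tensors σ + toℕᵇ (isTens z))) (sym k) ⟩
    suc (tensors σ + toℕᵇ (isTens (kind c))) ≡⟨ cong suc (sym (count-insert (isTens ∘ kind) σ c∈ σc)) ⟩
    suc (tensors (σ ∪ ⟨ c ⟩))       ∎
    where open ≤-Reasoning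

  module _ (total : count (isSource ∘ kind) cells ≤ suc (count (isTens ∘ kind) cells)) where

    -- A forest with a single component is a tree.
    connected : ∀ φ {c d} → c ∈ cells → d ∈ cells → Conn (Active φ) c d
    connected φ {c} {d} c∈ d∈ =
      conn-mono (λ e∈ → proj₂ (∈edges⁻ φ cells e∈))
        (Components.connected K c ◅◅ subst (λ z → Conn (_∈ edges φ cells) z d) (sym same)
          (conn-sym (Components.connected K d)))
      where
      result = componentsOf acyclic φ unique [] unique λ c∈ a → pre∈ c∈ (active≢source a) _
      K = proj₁ result
      open Components K using (reps; rep∈)
      singleton : length reps ≤ 1
      singleton = +-cancelˡ-≤ (#tens cells) _ _
        (≤-trans (≤-reflexive (sym (proj₂ result))) (≤-trans total (≤-reflexive (+-comm 1 _))))
      ≤1⇒≡ : ∀ {x y : C} {xs} → length xs ≤ 1 → x ∈ xs → y ∈ xs → x ≡ y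
      ≤1⇒≡ _ (here refl) (here refl) = refl
      ≤1⇒≡ {xs = _ ∷ _ ∷ _} (s≤s ()) _ (there _)
      ≤1⇒≡ {xs = _ ∷ _ ∷ _} (s≤s ()) (there _) _
      same = ≤1⇒≡ singleton (rep∈ c∈) (rep∈ d∈)

    -- The empire of the premise x of the ⊗ cell u: the cells that stay connected to x,
    -- for every switching, when the edge from x to u is deleted.
    module Empire {u : C} (u∈ : u ∈ cells) (u⊗ : kind u ≡ tens) (s₀ : Side) where

      x : C
      x = pre u s₀

      Off : (C → Side) → C → C → Set
      Off φ = Conn (λ e → Active φ e × e ≢ (u , s₀))

      Q : C → Set
      Q c = ∀ φ → Off φ c x

      ¬Off : ∀ φ → ¬ Off φ u x
      ¬Off φ w = acyclic φ (u , s₀) (tensA u⊗) (conn-sym w)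

      -- A walk that uses the deleted edge reaches one of its ends before doing so: `x` if the edge
      -- is crossed downwards, `u` if upwards.
      cutAt : ∀ φ {c} → Conn (Active φ) c x → Off φ c x ⊎ Off φ c u
      cutAt φ ε = inj₁ ε
      cutAt φ (fwd (e , a , refl , refl) ◅ w) with proj₁ e ≟ u | proj₂ e ≟ˢ s₀
      ... | yes refl | yes refl = inj₁ ε
      ... | yes _    | no s≢    = [ inj₁ ∘ (step ◅_) , inj₂ ∘ (step ◅_) ]′ (cutAt φ w)
        where step = fwd (e , (a , λ { refl → s≢ refl }) , refl , refl)
      ... | no c≢    | _        = [ inj₁ ∘ (step ◅_) , inj₂ ∘ (step ◅_) ]′ (cutAt φ w)
        where step = fwd (e , (a , λ { refl → c≢ refl }) , refl , refl)
      cutAt φ (bwd (e , a , refl , refl) ◅ w) with proj₁ e ≟ u | proj₂ e ≟ˢ s₀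
      ... | yes refl | yes refl = inj₂ ε
      ... | yes _    | no s≢    = [ inj₁ ∘ (step ◅_) , inj₂ ∘ (step ◅_) ]′ (cutAt φ w)
        where step = bwd (e , (a , λ { refl → s≢ refl }) , refl , refl)
      ... | no c≢    | _        = [ inj₁ ∘ (step ◅_) , inj₂ ∘ (step ◅_) ]′ (cutAt φ w)
        where step = bwd (e , (a , λ { refl → c≢ refl }) , refl , refl)

      -- If φ selects the other premise of c, and the premise p is connected to u
      -- rather than to x, then switching c to p connects x to u.
      par-up : ∀ {c} → c ∈ cells → kind c ≡ par → Q c → ∀ s → Q (pre c s)
      par-up {c} c∈ k q s φ with φ c ≟ˢ s
      ... | yes refl = down (parA k , λ { refl → par≢tens k u⊗ }) ◅◅ q φ
      ... | no φc≢s with cutAt φ (connected φ (pre∈ c∈ (par≢source k) s) (pre∈ u∈ (tens≢source u⊗) s₀))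
      ...   | inj₁ w = w
      ...   | inj₂ w = [ _◅◅ q φ , (λ w′ → ⊥-elim (¬Off φ′ (conn-sym w′ ◅◅ c-step ◅◅ q φ′))) ]′ (visit w)
        where
        φ′ : C → Side
        φ′ d = if does (d ≟ c) then s else φ d
        φ′c : φ′ c ≡ s
        φ′c rewrite dec-true (c ≟ c) refl = refl
        φ′≢ : ∀ {d} → d ≢ c → φ′ d ≡ φ d
        φ′≢ {d} d≢ rewrite dec-false (d ≟ c) d≢ = refl
        c-step : Off φ′ (pre c s) c
        c-step = down (subst (λ t → Active φ′ (c , t)) φ′c (parA k) , λ { refl → par≢tens k u⊗ })
        activate : ∀ {e} → proj₁ e ≢ c → Active φ e → Active φ′ e
        activate _  (tensA k′) = tensA k′
        activate d≢ (parA k′)  = subst (λ t → Active φ′ (_ , t)) (φ′≢ d≢) (parA k′)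
        -- The two switchings differ only at `c`. As long as the walk uses no edge of `c` it is
        -- valid for both; as soon as it uses one it passes through `c`, which is connected to `x`.
        visit : ∀ {v} → Off φ v u → Off φ v c ⊎ Off φ′ v u
        visit ε = inj₂ ε
        visit (fwd (e , (a , ne) , refl , refl) ◅ w) with proj₁ e ≟ c
        ... | yes refl = inj₁ (down (a , ne))
        ... | no d≢ = [ inj₁ ∘ (fwd (e , (a , ne) , refl , refl) ◅_)
                      , inj₂ ∘ (fwd (e , (activate d≢ a , ne) , refl , refl) ◅_) ]′ (visit w)
        visit (bwd (e , (a , ne) , refl , refl) ◅ w) with proj₁ e ≟ c
        ... | yes refl = inj₁ ε
        ... | no d≢ = [ inj₁ ∘ (bwd (e , (a , ne) , refl , refl) ◅_)
                      , inj₂ ∘ (bwd (e , (activate d≢ a , ne) , refl , refl) ◅_) ]′ (visit w)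

      tens-up : ∀ {c} → kind c ≡ tens → Q c → ∀ s → Q (pre c s)
      tens-up {c} k q s φ with c ≟ u | s ≟ˢ s₀
      ... | yes refl | yes refl = ε
      ... | yes _    | no s≢    = down (tensA k , λ { refl → s≢ refl }) ◅◅ q φ
      ... | no c≢    | _        = down (tensA k , λ { refl → c≢ refl }) ◅◅ q φ

      -- The inductive description of empires: go up to all premises, go down through a ⊗ other than
      -- `u` as soon as one premise is in, and through a ⅋ once both are in. Being closed under the
      -- downward rules is what limits the edges that leave the empire.
      Rule : (C → Bool) → C → Set
      Rule σ c = (∃ λ d → d ∈ cells × kind d ≢ source × σ d ≡ true × ∃ λ s → pre d s ≡ c)
               ⊎ (kind c ≡ tens × c ≢ u × ∃ λ s → σ (pre c s) ≡ true)
               ⊎ (kind c ≡ par × ∀ s → σ (pre c s) ≡ true)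

      rule? : ∀ σ c → Dec (Rule σ c)
      rule? σ c =
        (some? cells λ d → ¬? (kind d ≟ᵏ source) ×-dec σ d ≟ᵇ true ×-dec anySide? λ s → pre d s ≟ c)
        ⊎-dec (kind c ≟ᵏ tens ×-dec ¬? (c ≟ u) ×-dec anySide? λ s → σ (pre c s) ≟ᵇ true)
        ⊎-dec (kind c ≟ᵏ par ×-dec allSides? λ s → σ (pre c s) ≟ᵇ true)

      sound : ∀ σ → (∀ c → σ c ≡ true → Q c) → ∀ c → c ∈ cells → Rule σ c → Q c
      sound σ h _ _ (inj₁ (d , d∈ , k≢ , σd , s , refl)) with kind d in k
      ... | source = contradiction refl k≢
      ... | tens   = tens-up k (h d σd) s
      ... | par    = par-up d∈ k (h d σd) s
      sound σ h c _ (inj₂ (inj₁ (k , c≢ , s , σp))) φ =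
        up (tensA k , λ { refl → c≢ refl }) ◅◅ h _ σp φ
      sound σ h c _ (inj₂ (inj₂ (k , σp))) φ =
        up (parA k , λ { refl → par≢tens k u⊗ }) ◅◅ h _ (σp (φ c)) φ

      open Closure.Closed (Closure.closure _≟_ cells Rule rule? Q sound x (λ _ → ε)) public
        renaming (set to empire; base to x∈empire)

      u∉empire : empire u ≡ false
      u∉empire = ≢true⇒≡false λ e → ¬Off (const left) (inside u e (const left))

      empire-upClosed : UpClosed empire
      empire-upClosed c∈ k σc s = closed _ (pre∈ c∈ k s) (inj₁ (_ , c∈ , k , σc , s , refl))

      co-premise∉ : empire (pre u (other s₀)) ≡ false
      co-premise∉ = ≢true⇒≡false λ e →
        ¬Off (const left) (up (tensA u⊗ , λ e′ → other≢ s₀ (cong proj₂ e′)) ◅◅ inside _ e (const left))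

      -- Obtained from the complement: for a suitable switching, the complement together with `x` as
      -- an extra node is a nonempty forest, so the complement has at least as many sources as
      -- tensors. Subtracting this from `total` leaves the bound for the empire.
      empire-bound : sources empire ≤ suc (tensors empire)
      empire-bound = +-cancelʳ-≤ (sources outside) _ _ (begin
        sources empire + sources outside       ≡⟨ sym (total-split (isSource ∘ kind)) ⟩
        count (isSource ∘ kind) cells          ≤⟨ total ⟩
        suc (count (isTens ∘ kind) cells)      ≡⟨ cong suc (total-split (isTens ∘ kind)) ⟩
        suc (tensors empire + tensors outside) ≤⟨ s≤s (+-monoʳ-≤ (tensors empire) outside-bound) ⟩
        suc (tensors empire) + sources outside ∎)
        where
        open ≤-Reasoning
        outside : C → Bool
        outside = not ∘ empire
        total-split : ∀ (p : C → Bool) → count p cells ≡ count (λ c → empire c ∧ p c) cells +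
                                            count (λ c → outside c ∧ p c) cells
        total-split p = count-split p _ _ cells λ c _ → lem (empire c) (p c)
          where
          lem : ∀ (a b : Bool) → toℕᵇ b ≡ toℕᵇ (a ∧ b) + toℕᵇ (not a ∧ b)
          lem true  b = sym (+-identityʳ _)
          lem false b = refl
        open Restrict outside
        -- Selecting premises outside the empire whenever possible, the edge from x
        -- to u is the only one that leaves the empire.
        φ : C → Side
        φ c = if empire (pre c left) then right else left
        x∉Z : x ∉ Z
        x∉Z x∈ = true≢false (trans (sym x∈empire) (not-true⁻ (proj₂ (∈-filterᵇ⁻ outside cells x∈))))
        ∈Z : ∀ {c s} → c ∈ cells → kind c ≢ source → empire (pre c s) ≡ false → pre c s ∈ x ∷ Z
        ∈Z c∈ k e = there (∈-filterᵇ⁺ outside (pre∈ c∈ k _) (not-true e))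
        ends : ∀ {c s} → c ∈ Z → Active φ (c , s) → pre c s ∈ x ∷ Z
        ends {c} {s} c∈ a with ∈-filterᵇ⁻ outside cells c∈
        ends {c} {s} c∈ (tensA k) | c∈′ , out with c ≟ u | s ≟ˢ s₀
        ... | yes refl | yes refl = here refl
        ... | yes refl | no s≢ = ∈Z c∈′ (tens≢source k)
                (subst (λ t → empire (pre u t) ≡ false) (sym (≢⇒other (s≢ ∘ sym))) co-premise∉)
        ... | no c≢ | _ = ∈Z c∈′ (tens≢source k) (≢true⇒≡false λ e →
                true≢false (trans (sym (closed c c∈′ (inj₂ (inj₁ (k , c≢ , s , e))))) (not-true⁻ out)))
        ends {c} c∈ (parA k) | c∈′ , out = ∈Z c∈′ (par≢source k) φ-outside
          where
          φ-outside : empire (pre c (φ c)) ≡ false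
          φ-outside with empire (pre c left) in l
          ... | false = l
          ... | true  = ≢true⇒≡false λ r →
            true≢false (trans (sym (closed c c∈′ (inj₂ (inj₂ (k , λ { left → l ; right → r }))))) (not-true⁻ out))
        -- The extra node `x` is the end of the edge coming from `u`. It adds one node and
        -- guarantees one component, and these two units cancel.
        result = componentsOf acyclic φ uniqueZ (x ∷ []) (¬Any⇒All¬ _ x∉Z ∷ uniqueZ) ends
        open Components (proj₁ result)
        outside-bound : tensors outside ≤ sources outside
        outside-bound = ≤-pred (begin
          suc (tensors outside)          ≡⟨ +-comm 1 _ ⟩
          tensors outside + 1            ≤⟨ +-monoʳ-≤ (tensors outside) (nonempty (rep∈ (here refl))) ⟩
          tensors outside + length reps  ≡⟨ cong (_+ length reps) (sym #tensZ) ⟩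
          #tens Z + length reps          ≡⟨ sym (proj₂ result) ⟩
          suc (#source Z)                ≡⟨ cong suc #sourceZ ⟩
          suc (sources outside)          ∎)

    _▷_ : C → C → Set
    d ▷ c = d ∈ cells × kind d ≢ source × ∃ λ s → pre d s ≡ c

    Terminal : C → Set
    Terminal c = ∀ d → ¬ d ▷ c

    below? : ∀ c → Dec (∃ λ d → d ▷ c)
    below? c = map′ (λ (d , h) → d , h) (λ (d , h) → d , h)
      (some? cells λ d → ¬? (kind d ≟ᵏ source) ×-dec anySide? λ s → pre d s ≟ c)

    module _ (noetherian : WellFounded _▷_)
             (no-terminal-par : ∀ {c} → c ∈ cells → kind c ≡ par → ¬ Terminal c) where

      -- `c` is `p` itself or lies above it. This is tested by sets closed under premises instead of
      -- paths, since it is only ever applied to such sets.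
      Below : C → C → Set
      Below c p = ∀ {σ} → UpClosed σ → σ p ≡ true → σ c ≡ true

      TerminalBelow : C → Set
      TerminalBelow c = ∃ λ t → t ∈ cells × kind t ≡ tens × Terminal t × ∃ λ s → Below c (pre t s)

      -- The descent ends at a terminal cell. Having a premise, it is not a source, and
      -- `no-terminal-par` excludes a ⅋.
      terminal-below : ∀ c → Acc _▷_ c → c ∈ cells → ¬ Terminal c → TerminalBelow c
      terminal-below c (acc rec) c∈ ¬term with below? c
      ... | no ¬d = contradiction (λ d h → ¬d (d , h)) ¬term
      ... | yes (d , d▷c@(d∈ , k≢ , s , refl)) with below? d
      ...   | yes (e , e▷d) =
        let (t , t∈ , k , term , s′ , f) = terminal-below d (rec d▷c) d∈ (λ term → term e e▷d)
        in t , t∈ , k , term , s′ , λ closed σp → closed d∈ k≢ (f closed σp) s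
      ...   | no ¬e = last (kind d) refl
        where
        d-term : Terminal d
        d-term e h = ¬e (e , h)
        last : ∀ κ → kind d ≡ κ → TerminalBelow c
        last source k = contradiction k k≢
        last par    k = contradiction d-term (no-terminal-par d∈ k)
        last tens   k = d , d∈ , k , d-term , s , λ _ σp → σp

      record Candidate : Set where
        field
          t       : C
          t∈      : t ∈ cells
          t⊗      : kind t ≡ tens
          t-term  : Terminal t
          s       : Side
          σ       : C → Bool
          closed  : UpClosed σ
          bound   : sources σ ≤ suc (tensors σ)
          pre∈σ   : σ (pre t s) ≡ true
          t∉σ     : σ t ≡ false

      record Split : Set where
        field
          t       : C
          t∈      : t ∈ cells
          t⊗      : kind t ≡ tens
          t-term  : Terminal t
          s       : Side
          σ       : C → Bool
          inside  : σ (pre t s) ≡ true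
          outside : σ (pre t (other s)) ≡ false
          uniform : ∀ {c} → c ∈ cells → kind c ≢ source → c ≢ t → ∀ s → σ (pre c s) ≡ σ c

      improve : (K : Candidate) → let open Candidate K in
                Split ⊎ Σ Candidate λ K′ → count (not ∘ Candidate.σ K′) cells < count (not ∘ σ) cells
      improve K with some? cells (λ c → let open Candidate K in
        ¬? (c ≟ t) ×-dec σ c ≟ᵇ false ×-dec ¬? (kind c ≟ᵏ source) ×-dec
        anySide? λ s → σ (pre c s) ≟ᵇ true)
      ... | no none = inj₁ record
        { t = t ; t∈ = t∈ ; t⊗ = t⊗ ; t-term = t-term ; s = s ; σ = σ ; inside = pre∈σ
        -- A connected set containing both premises of `t` would close a cycle through `t`.
        ; outside = ≢true⇒≡false λ e → no-tensor closed bound t∈ t⊗ t∉σ (both s pre∈σ e)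
        ; uniform = uniform }
        where
        open Candidate K
        both : ∀ s → σ (pre t s) ≡ true → σ (pre t (other s)) ≡ true → ∀ s → σ (pre t s) ≡ true
        both left  p q left  = p
        both left  p q right = q
        both right p q left  = q
        both right p q right = p
        uniform : ∀ {c} → c ∈ cells → kind c ≢ source → c ≢ t → ∀ s → σ (pre c s) ≡ σ c
        uniform {c} c∈ k c≢ s with σ c in σc
        ... | true  = closed c∈ k σc s
        ... | false = ≢true⇒≡false λ e → none (c , c∈ , c≢ , σc , k , s , e)
      ... | yes (c , c∈ , c≢t , σc , k , s′ , σp) = inj₂ (enlarge (kind c) refl)
        where
        open Candidate K
        Larger : Set
        Larger = Σ Candidate λ K′ → count (not ∘ Candidate.σ K′) cells < count (not ∘ σ) cells
        larger : (K′ : Candidate) → (∀ d → σ d ≡ true → Candidate.σ K′ d ≡ true) →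
                 Candidate.σ K′ c ≡ true → Larger
        larger K′ mono c∈K′ = K′ , count-mono-< cells
          (λ d _ h → not-true (≢true⇒≡false λ e →
             true≢false (trans (sym (mono d e)) (not-true⁻ h))))
          c∈ (cong not c∈K′) (not-true σc)
        enlarge : ∀ κ → kind c ≡ κ → Larger
        enlarge source e = contradiction e k
        -- The ⊗ may change here. The empire is taken at a terminal ⊗ below `c`, so that it contains
        -- `c` and meets `σ` in a premise of `c`. This ⊗ is not in `σ`, because `σ` would then
        -- contain `c`.
        enlarge par e = larger record
            { t = t′ ; t∈ = t′∈ ; t⊗ = t′⊗ ; t-term = t′-term ; s = s″ ; σ = σ ∪ E.empire
            ; closed = upClosed-∪ closed E.empire-upClosed
            ; bound = union-bound closed E.empire-upClosed bound E.empire-bound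
                        (pre∈ c∈ k s′) σp (E.empire-upClosed c∈ k c∈E s′)
            ; pre∈σ = ∨-introʳ (σ (pre t′ s″)) E.x∈empire
            ; t∉σ = cong₂ _∨_ (≢true⇒≡false λ σt′ → true≢false (trans (sym
                        (c-above closed (closed t′∈ (tens≢source t′⊗) σt′ s″))) σc)) E.u∉empire }
            (λ d h → cong (_∨ E.empire d) h) (∨-introʳ (σ c) c∈E)
          where
          tb = terminal-below c (noetherian c) c∈ (no-terminal-par c∈ e)
          t′ = proj₁ tb
          t′∈ = proj₁ (proj₂ tb)
          t′⊗ = proj₁ (proj₂ (proj₂ tb))
          t′-term = proj₁ (proj₂ (proj₂ (proj₂ tb)))
          s″ = proj₁ (proj₂ (proj₂ (proj₂ (proj₂ tb))))
          c-above : Below c (pre t′ s″)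
          c-above = proj₂ (proj₂ (proj₂ (proj₂ (proj₂ tb))))
          module E = Empire t′∈ t′⊗ s″
          c∈E = c-above E.empire-upClosed E.x∈empire
        -- The ⊗ cell `t` is kept. The empire of the other premise of `c` is disjoint from `σ`:
        -- otherwise their union would be connected and contain both premises of `c`. Adding `c`
        -- turns the two components into one.
        enlarge tens e = larger record
            { t = t ; t∈ = t∈ ; t⊗ = t⊗ ; t-term = t-term ; s = s ; σ = σ ∪ E.empire ∪ ⟨ c ⟩
            ; closed = upClosed-insert union-closed premises∈
            ; bound = insert-bound (disjoint-bound bound E.empire-bound disjoint) c∈ e c∉∪
            ; pre∈σ = cong (λ b → (b ∨ E.empire (pre t s)) ∨ ⟨ c ⟩ (pre t s)) pre∈σ
            ; t∉σ = cong₂ _∨_ (cong₂ _∨_ t∉σ (≢true⇒≡false t∉E)) (dec-false (t ≟ c) (c≢t ∘ sym)) }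
            (λ d h → cong (λ b → (b ∨ E.empire d) ∨ ⟨ c ⟩ d) h)
            (∨-introʳ (σ c ∨ E.empire c) (dec-true (c ≟ c) refl))
          where
          module E = Empire c∈ e (other s′)
          union-closed = upClosed-∪ closed E.empire-upClosed
          c∉∪ : (σ ∪ E.empire) c ≡ false
          c∉∪ = cong₂ _∨_ σc E.u∉empire
          premises∈ : ∀ s → (σ ∪ E.empire) (pre c s) ≡ true
          premises∈ s with s ≟ˢ s′
          ... | yes refl = cong (_∨ E.empire (pre c s)) σp
          ... | no s≢ = subst (λ z → (σ ∪ E.empire) (pre c z) ≡ true) (sym (≢⇒other (s≢ ∘ sym)))
                          (∨-introʳ (σ (pre c (other s′))) E.x∈empire)
          apart : ∀ {y} → y ∈ cells → σ y ≡ true → E.empire y ≢ true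
          apart y∈ σy Ey = no-tensor union-closed
            (union-bound closed E.empire-upClosed bound E.empire-bound y∈ σy Ey) c∈ e c∉∪ premises∈
          disjoint : ∀ y → y ∈ cells → (σ ∩ E.empire) y ≡ false
          disjoint y y∈ = ≢true⇒≡false λ h → apart y∈ (∧-conicalˡ _ _ h) (∧-conicalʳ _ _ h)
          t∉E : E.empire t ≢ true
          t∉E h = apart (pre∈ t∈ (tens≢source t⊗) s) pre∈σ (E.empire-upClosed t∈ (tens≢source t⊗) h s)

      iterate : ∀ n (K : Candidate) → count (not ∘ Candidate.σ K) cells < n → Split
      iterate (suc n) K b with improve K
      ... | inj₁ split    = split
      ... | inj₂ (K′ , l) = iterate n K′ (<-≤-trans l (≤-pred b))

      splitting : ∀ {t} → t ∈ cells → kind t ≡ tens → Terminal t → Split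
      splitting {t} t∈ t⊗ term = iterate _ record
        { t = t ; t∈ = t∈ ; t⊗ = t⊗ ; t-term = term ; s = left ; σ = empire
        ; closed = empire-upClosed ; bound = empire-bound ; pre∈σ = x∈empire ; t∉σ = u∉empire } ≤-refl
        where open Empire t∈ t⊗ left

-- Weakenings

-- `cut` falls under the default `source`; the nets considered have no such cell.
kindOf : Label → Kind
kindOf tensor = tens
kindOf par    = par
kindOf _      = source

-- The sources that survive the erasure of `W`, hence without `bot`.
isLeaf : Label → Bool
isLeaf ax  = true
isLeaf one = true
isLeaf _   = false

tens⁻ : ∀ {l} → kindOf l ≡ tens → l ≡ tensor
tens⁻ {tensor} _ = refl

par⁻ : ∀ {l} → kindOf l ≡ par → l ≡ par
par⁻ {par} _ = refl

module Weakening {C : Set} (_≟_ : DecidableEquality C)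
  (label : C → Label) (pre : C → Side → C)
  (acyclic : Edges.Acyclic (kindOf ∘ label) pre)
  (all : List C) (unique : Unique all) (complete : ∀ c → c ∈ all)
  (noCut : ∀ c → label c ≢ cut)
  where

  kind : C → Kind
  kind = kindOf ∘ label

  _⇓_ : C → C → Set
  p ⇓ c = kind c ≢ source × ∃ λ s → pre c s ≡ p

  data W : C → Set where
    w-bot : ∀ {c} → label c ≡ bot → W c
    w-par : ∀ {c} → label c ≡ par → (∀ s → W (pre c s)) → W c

  -- `tens-pre` is where the shape of the fragment enters; `W-head` reflects that ⊥ and ⅋ cells have
  -- a single conclusion. Well-foundedness is asked in both directions: towards the premises to
  -- decide `W`, and along the conclusions to leave `W` downwards.
  module Solid
    (up-wf   : WellFounded _⇓_)
    (down-wf : WellFounded (λ d c → c ⇓ d))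
    (tens-pre : ∀ {c} → label c ≡ tensor → ∀ s → ¬ W (pre c s))
    (W-head  : ∀ {p c d} → W p → p ⇓ c → p ⇓ d → c ≡ d)
    where

    W? : ∀ c → Dec (W c)
    W? c = go c (up-wf c)
      where
      go : ∀ c → Acc _⇓_ c → Dec (W c)
      go c (acc rec) = cases (label c) refl
        where
        neither : label c ≢ bot → label c ≢ par → ¬ W c
        neither ≢bot ≢par (w-bot e)   = ≢bot e
        neither ≢bot ≢par (w-par e _) = ≢par e
        cases : ∀ l → label c ≡ l → Dec (W c)
        cases bot e    = yes (w-bot e)
        cases ax e     = no (neither (λ e′ → case trans (sym e) e′ of λ ()) (λ e′ → case trans (sym e) e′ of λ ()))
        cases one e    = no (neither (λ e′ → case trans (sym e) e′ of λ ()) (λ e′ → case trans (sym e) e′ of λ ()))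
        cases tensor e = no (neither (λ e′ → case trans (sym e) e′ of λ ()) (λ e′ → case trans (sym e) e′ of λ ()))
        cases cut e    = contradiction e (noCut c)
        cases par e    = map′ (w-par e)
          (λ { (w-bot e′) → case trans (sym e) e′ of λ () ; (w-par _ h) → h })
          (allSides? λ s → go (pre c s) (rec ((λ k → case trans (sym (cong kindOf e)) k of λ ()) , s , refl)))

    W-pre : ∀ {c} → kind c ≢ source → W c → ∀ s → W (pre c s)
    W-pre k≢ (w-bot e)   s = contradiction (cong kindOf e) k≢
    W-pre k≢ (w-par _ h) s = h s

    actual : C → Side → Side
    actual c s = if does (W? (pre c s)) then other s else s

    actual-¬W : ∀ {c s} → ¬ W (pre c s) → actual c s ≡ s
    actual-¬W {c} {s} ¬w = cong (λ b → if b then other s else s) (dec-false (W? (pre c s)) ¬w)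

    -- A ⅋ cell with exactly one premise in W has its other premise on both sides.
    pre′ : C → Side → C
    pre′ c s = pre c (actual c s)

    pre′-¬W : ∀ {c} → kind c ≢ source → ¬ W c → ∀ s → ¬ W (pre′ c s)
    pre′-¬W {c} k≢ ¬w s with W? (pre c s)
    ... | no ¬p = ¬p
    ... | yes p = λ q → ¬w′ (kind c) refl q
      where
      both : ∀ s → W (pre c s) → W (pre c (other s)) → ∀ s → W (pre c s)
      both left  a b left  = a
      both left  a b right = b
      both right a b left  = b
      both right a b right = a
      ¬w′ : ∀ κ → kind c ≡ κ → ¬ W (pre c (other s))
      ¬w′ source k q = k≢ k
      ¬w′ tens   k q = tens-pre (tens⁻ k) s p
      ¬w′ par    k q = ¬w (w-par (par⁻ k) (both s p q))

    private
      module E  = Edges kind pre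
      module E′ = Edges kind pre′

    -- An edge of the erased net stands for the edge of its actual premise, under the switching that
    -- selects actual premises. Distinct active edges stand for distinct ones, so a walk around an
    -- edge can be lifted.
    acyclic′ : E′.Acyclic
    acyclic′ φ e a w = acyclic φ′ (lift e) (activate a) (Eq.map link w)
      where
      lift : E′.Edge → E.Edge
      lift (c , s) = c , actual c s
      φ′ : C → Side
      φ′ c = actual c (φ c)
      activate : ∀ {e} → E′.Active φ e → E.Active φ′ (lift e)
      activate (E′.tensA k) = E.tensA k
      activate (E′.parA k)  = E.parA k
      clash : ∀ {c d} → kind c ≡ tens → kind d ≡ par → c ≢ d
      clash k k′ refl with () ← trans (sym k) k′
      lift-injective : ∀ {e e′} → E′.Active φ e → E′.Active φ e′ → lift e ≡ lift e′ → e ≡ e′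
      lift-injective (E′.tensA k) (E′.tensA _) eq with refl ← cong proj₁ eq =
        cong (_ ,_) (trans (sym (actual-¬W (tens-pre (tens⁻ k) _)))
                      (trans (cong proj₂ eq) (actual-¬W (tens-pre (tens⁻ k) _))))
      lift-injective (E′.tensA k) (E′.parA k′)  eq = ⊥-elim (clash k k′ (cong proj₁ eq))
      lift-injective (E′.parA k)  (E′.tensA k′) eq = ⊥-elim (clash k′ k (sym (cong proj₁ eq)))
      -- Both sides of a ⅋ may lift to the same edge, but only the side selected by `φ` is active.
      lift-injective (E′.parA _)  (E′.parA _)   eq with refl ← cong proj₁ eq = refl
      link : ∀ {u v} → E′.Link (λ e′ → E′.Active φ e′ × e′ ≢ e) u v →
             E.Link (λ e′ → E.Active φ′ e′ × e′ ≢ lift e) u v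
      link (e′ , (a′ , ne) , p , q) =
        lift e′ , (activate a′ , λ eq → ne (lift-injective a′ a eq)) , p , q

    UpClosed : (C → Bool) → Set
    UpClosed X = ∀ {c} → kind c ≢ source → X c ≡ true → ∀ s → X (pre c s) ≡ true

    leaves tensors : (C → Bool) → ℕ
    leaves  X = count (λ c → X c ∧ isLeaf (label c)) all
    tensors X = count (λ c → X c ∧ isTens (kind c)) all

    -- For `X` closed under premises, this says without switchings that the cells of `X` outside `W`
    -- form a tree. It is the invariant of the recursion, being easy to update when cells are
    -- removed.
    Balanced : (C → Bool) → Set
    Balanced X = leaves X ≡ suc (tensors X)

    TerminalIn : (C → Bool) → C → Set
    TerminalIn X c = ∀ d → X d ≡ true → ¬ c ⇓ d

    head? : ∀ (X : C → Bool) c → Dec (∃ λ d → X d ≡ true × c ⇓ d)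
    head? X c = map′ (λ (d , _ , h) → d , h) (λ (d , h) → d , complete d , h)
      (some? all λ d → X d ≟ᵇ true ×-dec ¬? (kind d ≟ᵏ source) ×-dec anySide? λ s → pre d s ≟ c)

    module Reduced (X : C → Bool) (closed : UpClosed X) where

      solid : C → Bool
      solid c = X c ∧ not (does (W? c))

      cells : List C
      cells = filterᵇ solid all

      cells⁺ : ∀ {c} → X c ≡ true → ¬ W c → c ∈ cells
      cells⁺ {c} Xc ¬w = ∈-filterᵇ⁺ solid (complete c) (cong₂ _∧_ Xc (cong not (dec-false (W? c) ¬w)))

      cells⁻ : ∀ {c} → c ∈ cells → X c ≡ true × ¬ W c
      cells⁻ {c} c∈ = let e = proj₂ (∈-filterᵇ⁻ solid all c∈) in
        ∧-conicalˡ _ _ e , dec-false⁻ (W? c) (not-true⁻ (∧-conicalʳ (X c) _ e))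

      pre∈ : ∀ {c} → c ∈ cells → kind c ≢ source → ∀ s → pre′ c s ∈ cells
      pre∈ c∈ k≢ s = let (Xc , ¬w) = cells⁻ c∈ in cells⁺ (closed k≢ Xc _) (pre′-¬W k≢ ¬w s)

      unique-cells : Unique cells
      unique-cells = filterᵇ-unique solid unique

      -- Every ⊥ lies in `W` and no axiom or 𝟏 does, so the sources outside `W` are exactly the
      -- leaves.
      count-leaves : ∀ Y → (∀ c → Y c ≡ true → X c ≡ true) →
                     count (λ c → Y c ∧ isSource (kind c)) cells ≡ leaves Y
      count-leaves Y Y⊆X = trans (count-filter _ solid all) (count-cong all λ c _ → lem c)
        where
        lem : ∀ c → solid c ∧ (Y c ∧ isSource (kind c)) ≡ Y c ∧ isLeaf (label c)
        lem c with Y c in Yc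
        ... | false = ∧-zeroʳ (solid c)
        ... | true rewrite Y⊆X c Yc with label c in l | W? c
        ... | ax     | no _  = refl
        ... | ax     | yes (w-bot e) = contradiction (trans (sym l) e) λ ()
        ... | ax     | yes (w-par e _) = contradiction (trans (sym l) e) λ ()
        ... | one    | no _  = refl
        ... | one    | yes (w-bot e) = contradiction (trans (sym l) e) λ ()
        ... | one    | yes (w-par e _) = contradiction (trans (sym l) e) λ ()
        ... | bot    | no ¬w = contradiction (w-bot l) ¬w
        ... | bot    | yes _ = refl
        ... | cut    | _     = contradiction l (noCut c)
        ... | tensor | no _  = refl
        ... | tensor | yes _ = refl
        ... | par    | no _  = refl
        ... | par    | yes _ = refl

      count-tensors : ∀ Y → (∀ c → Y c ≡ true → X c ≡ true) →
                      count (λ c → Y c ∧ isTens (kind c)) cells ≡ tensors Y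
      count-tensors Y Y⊆X = trans (count-filter _ solid all) (count-cong all λ c _ → lem c)
        where
        lem : ∀ c → solid c ∧ (Y c ∧ isTens (kind c)) ≡ Y c ∧ isTens (kind c)
        lem c with Y c in Yc
        ... | false = ∧-zeroʳ (solid c)
        ... | true rewrite Y⊆X c Yc with label c in l | W? c
        ... | tensor | no _  = refl
        ... | tensor | yes (w-bot e) = contradiction (trans (sym l) e) λ ()
        ... | tensor | yes (w-par e _) = contradiction (trans (sym l) e) λ ()
        ... | ax  | w = ∧-zeroʳ (not (does w))
        ... | one | w = ∧-zeroʳ (not (does w))
        ... | bot | w = ∧-zeroʳ (not (does w))
        ... | cut | w = ∧-zeroʳ (not (does w))
        ... | par | w = ∧-zeroʳ (not (does w))

      -- The forest bound for the erased net. The cell outside `W` makes this net nonempty; a lone ⊥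
      -- has neither leaf nor tensor.
      tensors<leaves : ∀ {c} → X c ≡ true → ¬ W c → suc (tensors X) ≤ leaves X
      tensors<leaves Xc ¬w = subst₂ (λ a b → suc a ≤ b) (count-tensors X λ _ e → e) (count-leaves X λ _ e → e)
        (Splitting.tensors<sources _≟_ kind pre′ acyclic′ cells unique-cells pre∈
          (λ c∈ k≢ Xc s → closed k≢ Xc _) (cells⁺ Xc ¬w) Xc)

    record Split (X : C → Bool) : Set where
      field
        t        : C
        t∈       : X t ≡ true
        t⊗       : label t ≡ tensor
        terminal : TerminalIn X t
        τ        : C → Bool
        τ-left   : τ (pre t left) ≡ true
        τ-right  : τ (pre t right) ≡ false
        uniform  : ∀ {c} → X c ≡ true → kind c ≢ source → c ≢ t → ∀ s → τ (pre c s) ≡ τ c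

    module _ (X : C → Bool) (closed : UpClosed X) (balanced : Balanced X)
             (¬terminal : ∀ {c} → X c ≡ true → label c ≡ bot ⊎ label c ≡ par → ¬ TerminalIn X c)
             where

      private
        open Reduced X closed

        total : count (isSource ∘ kind) cells ≤ suc (count (isTens ∘ kind) cells)
        total = ≤-reflexive (trans (lem isSource) (trans (count-leaves X λ _ e → e)
                  (trans balanced (cong suc (sym (trans (lem isTens) (count-tensors X λ _ e → e)))))))
          where
          lem : ∀ p → count (p ∘ kind) cells ≡ count (λ c → X c ∧ p (kind c)) cells
          lem p = count-cong cells λ c c∈ → sym (cong (_∧ p (kind c)) (proj₁ (cells⁻ c∈)))

        _▷_ : C → C → Set
        d ▷ c = d ∈ cells × kind d ≢ source × ∃ λ s → pre′ d s ≡ c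

        ▷⇒⇓ : ∀ {d c} → d ▷ c → c ⇓ d
        ▷⇒⇓ (_ , k≢ , s , e) = k≢ , actual _ s , e

        ⇓⇒▷ : ∀ {d c} → X d ≡ true → ¬ W c → c ⇓ d → d ▷ c
        ⇓⇒▷ {d} Xd ¬w (k≢ , s , refl) =
          cells⁺ Xd (λ w → ¬w (W-pre k≢ w s)) , k≢ , s , cong (pre d) (actual-¬W ¬w)

        -- A cell of W is sent to the first cell outside W on its way down.
        data Root : C → C → Set where
          solidR : ∀ {c} → ¬ W c → Root c c
          -- Cells outside `X` are their own roots, so that `root` is total.
          outR   : ∀ {c} → X c ≡ false → Root c c
          downR  : ∀ {c d r} → W c → X d ≡ true → c ⇓ d → Root d r → Root c r

        root : ∀ c → ∃ (Root c)
        root c = go c (down-wf c)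
          where
          go : ∀ c → Acc (λ d c → c ⇓ d) c → ∃ (Root c)
          go c (acc rec) with W? c | X c in Xc
          ... | no ¬w | _     = c , solidR ¬w
          ... | yes w | false = c , outR Xc
          ... | yes w | true with head? X c
          ...   | yes (d , Xd , c⇓d) = let (r , ρ) = go d (rec c⇓d) in r , downR w Xd c⇓d ρ
          -- The descent cannot stop inside `W`: it would stop at a terminal ⊥ or ⅋.
          ...   | no none = contradiction (λ d Xd h → none (d , Xd , h)) (¬terminal Xc (label-W w))
            where
            label-W : ∀ {c} → W c → label c ≡ bot ⊎ label c ≡ par
            label-W (w-bot e)   = inj₁ e
            label-W (w-par e _) = inj₂ e

        -- By `W-head`, a cell of `W` has only one cell below it. Hence `spread` puts a cell of `W`
        -- on the same side as the cell of `X` below it.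
        root-unique : ∀ {c r r′} → Root c r → Root c r′ → r ≡ r′
        root-unique (solidR _)  (solidR _)  = refl
        root-unique (solidR _)  (outR _)    = refl
        root-unique (solidR ¬w) (downR w _ _ _) = contradiction w ¬w
        root-unique (outR _)    (solidR _)  = refl
        root-unique (outR _)    (outR _)    = refl
        root-unique (outR e)    (downR _ Xd (k≢ , s , refl) _) = contradiction (trans (sym (closed k≢ Xd s)) e) true≢false
        root-unique (downR w _ _ _) (solidR ¬w) = contradiction w ¬w
        root-unique (downR _ Xd (k≢ , s , refl) _) (outR e) = contradiction (trans (sym (closed k≢ Xd s)) e) true≢false
        root-unique (downR w _ h ρ) (downR _ _ h′ ρ′) with refl ← W-head w h h′ = root-unique ρ ρ′

        spread : (C → Bool) → C → Bool
        spread σ c = σ (proj₁ (root c))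

        spread-root : ∀ σ {c r} → Root c r → spread σ c ≡ σ r
        spread-root σ {c} ρ = cong σ (root-unique (proj₂ (root c)) ρ)

      private
        noetherian : WellFounded _▷_
        noetherian = Subrelation.wellFounded ▷⇒⇓ down-wf

        par-nonterminal : ∀ {c} → c ∈ cells → kind c ≡ par → ¬ (∀ d → ¬ d ▷ c)
        par-nonterminal c∈ k term = ¬terminal (proj₁ (cells⁻ c∈)) (inj₂ (par⁻ k))
          λ d Xd h → term d (⇓⇒▷ Xd (proj₂ (cells⁻ c∈)) h)

        fromReduced : Splitting.Split _≟_ kind pre′ acyclic′ cells unique-cells pre∈ total noetherian
                        par-nonterminal → Split X
        fromReduced K = orient s inside outside
          where
          open Splitting.Split K
          Xt = proj₁ (cells⁻ t∈)
          terminal : TerminalIn X t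
          terminal d Xd h = t-term d (⇓⇒▷ Xd (proj₂ (cells⁻ t∈)) h)
          pre-t : ∀ s → spread σ (pre t s) ≡ σ (pre′ t s)
          pre-t s = trans (spread-root σ (solidR ¬w)) (cong (σ ∘ pre t) (sym (actual-¬W ¬w)))
            where ¬w = tens-pre (tens⁻ t⊗) s
          constant : ∀ {c} → X c ≡ true → kind c ≢ source → c ≢ t → ∀ s →
                     Dec (W (pre c s)) → spread σ (pre c s) ≡ spread σ c
          constant {c} Xc k≢ c≢ s (yes w) = spread-root σ (downR w Xc (k≢ , s , refl) (proj₂ (root c)))
          constant {c} Xc k≢ c≢ s (no ¬w) = begin
            spread σ (pre c s) ≡⟨ spread-root σ (solidR ¬w) ⟩
            σ (pre c s)        ≡⟨ cong (σ ∘ pre c) (sym (actual-¬W ¬w)) ⟩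
            σ (pre′ c s)       ≡⟨ uniform (cells⁺ Xc ¬wc) k≢ c≢ s ⟩
            σ c                ≡⟨ sym (spread-root σ (solidR ¬wc)) ⟩
            spread σ c         ∎
            where
            open ≡-Reasoning
            ¬wc : ¬ W c
            ¬wc wc = ¬w (W-pre k≢ wc s)
          constant′ : ∀ {c} → X c ≡ true → kind c ≢ source → c ≢ t → ∀ s → spread σ (pre c s) ≡ spread σ c
          constant′ {c} Xc k≢ c≢ s = constant Xc k≢ c≢ s (W? (pre c s))
          -- The left premise must be on the side `true`; when the splitting has it the other way
          -- round, the sides are exchanged by negation.
          orient : ∀ s → σ (pre′ t s) ≡ true → σ (pre′ t (other s)) ≡ false → Split X
          orient left i o = record
            { t = t ; t∈ = Xt ; t⊗ = tens⁻ t⊗ ; terminal = terminal ; τ = spread σ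
            ; τ-left = trans (pre-t left) i ; τ-right = trans (pre-t right) o ; uniform = constant′ }
          orient right i o = record
            { t = t ; t∈ = Xt ; t⊗ = tens⁻ t⊗ ; terminal = terminal ; τ = not ∘ spread σ
            ; τ-left = cong not (trans (pre-t left) o) ; τ-right = cong not (trans (pre-t right) i)
            ; uniform = λ Xc k≢ c≢ s → cong not (constant′ Xc k≢ c≢ s) }

        ¬W-tens : ∀ {c} → label c ≡ tensor → ¬ W c
        ¬W-tens e (w-bot e′)   = contradiction (trans (sym e) e′) λ ()
        ¬W-tens e (w-par e′ _) = contradiction (trans (sym e) e′) λ ()

      splitting : ∀ {t} → X t ≡ true → label t ≡ tensor → TerminalIn X t → Split X
      splitting Xt t⊗ term = fromReduced
        (Splitting.splitting _≟_ kind pre′ acyclic′ cells unique-cells pre∈ total noetherian par-nonterminal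
        (cells⁺ Xt (¬W-tens t⊗)) (cong kindOf t⊗) λ d h → term d (proj₁ (cells⁻ (proj₁ h))) (▷⇒⇓ h))

    module Halves {X : C → Bool} (closed : UpClosed X) (balanced : Balanced X) (split : Split X) where
      open Split split

      half : Bool → C → Bool
      half b c = X c ∧ (not (does (c ≟ t)) ∧ does (τ c ≟ᵇ b))

      half⁺ : ∀ {b c} → X c ≡ true → c ≢ t → τ c ≡ b → half b c ≡ true
      half⁺ {b} {c} Xc c≢ e = cong₂ _∧_ Xc (cong₂ _∧_ (cong not (dec-false (c ≟ t) c≢)) (dec-true (τ c ≟ᵇ b) e))

      half⁻ : ∀ {b c} → half b c ≡ true → X c ≡ true × c ≢ t × τ c ≡ b
      half⁻ {b} {c} e = ∧-conicalˡ _ _ e , dec-false⁻ (c ≟ t) (not-true⁻ (∧-conicalˡ _ _ e′)) ,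
                        dec-true⁻ (τ c ≟ᵇ b) (∧-conicalʳ (not (does (c ≟ t))) _ e′)
        where e′ = ∧-conicalʳ (X c) _ e

      pre≢t : ∀ {c} → X c ≡ true → kind c ≢ source → ∀ s → pre c s ≢ t
      pre≢t {c} Xc k≢ s e = terminal c Xc (k≢ , s , e)

      half-upClosed : ∀ b → UpClosed (half b)
      half-upClosed b k≢ h s with half⁻ h
      ... | Xc , c≢ , e = half⁺ (closed k≢ Xc s) (pre≢t Xc k≢ s) (trans (uniform Xc k≢ c≢ s) e)

      t-nonsource : kind t ≢ source
      t-nonsource e = contradiction (trans (sym (cong kindOf t⊗)) e) λ ()

      premise∈ : ∀ {b} s → τ (pre t s) ≡ b → half b (pre t s) ≡ true
      premise∈ s = half⁺ (closed t-nonsource t∈ s) (pre≢t t∈ t-nonsource s)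

      private
        lower : ∀ b s → τ (pre t s) ≡ b → suc (tensors (half b)) ≤ leaves (half b)
        lower b s e = Reduced.tensors<leaves (half b) (half-upClosed b) (premise∈ s e) (tens-pre t⊗ s)

        split-count : ∀ (p : C → Bool) → count (λ c → X c ∧ p c) all ≡
                      count (λ c → half true c ∧ p c) all + count (λ c → half false c ∧ p c) all + toℕᵇ (p t)
        split-count p = begin
          count (λ c → X c ∧ p c) all
            ≡⟨ count-split _ (λ c → (X c ∧ not (does (c ≟ t))) ∧ p c) (λ c → does (c ≟ t) ∧ p c) all (λ c _ → lem₁ c) ⟩
          count (λ c → (X c ∧ not (does (c ≟ t))) ∧ p c) all + count (λ c → does (c ≟ t) ∧ p c) all
            ≡⟨ cong₂ _+_
                 (count-split _ (λ c → half true c ∧ p c) (λ c → half false c ∧ p c) all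
                   (λ c _ → lem₂ (X c) (not (does (c ≟ t))) (τ c) (p c)))
                 lem₃ ⟩
          count (λ c → half true c ∧ p c) all + count (λ c → half false c ∧ p c) all + toℕᵇ (p t) ∎
          where
          open ≡-Reasoning
          lem₁ : ∀ c → toℕᵇ (X c ∧ p c) ≡ toℕᵇ ((X c ∧ not (does (c ≟ t))) ∧ p c) + toℕᵇ (does (c ≟ t) ∧ p c)
          lem₁ c with c ≟ t
          ... | yes refl rewrite t∈ = refl
          ... | no _ with X c
          ...   | true  = sym (+-identityʳ _)
          ...   | false = refl
          lem₂ : ∀ x y z w → toℕᵇ ((x ∧ y) ∧ w) ≡
                 toℕᵇ ((x ∧ (y ∧ does (z ≟ᵇ true))) ∧ w) + toℕᵇ ((x ∧ (y ∧ does (z ≟ᵇ false))) ∧ w)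
          lem₂ false _     _     _ = refl
          lem₂ true  false _     _ = refl
          lem₂ true  true  true  _ = sym (+-identityʳ _)
          lem₂ true  true  false _ = refl
          lem₃ : count (λ c → does (c ≟ t) ∧ p c) all ≡ toℕᵇ (p t)
          lem₃ with p t in pt
          ... | true  = count-singleton _≟_ _ all unique (complete t)
                          (trans (cong (_∧ p t) (dec-true (t ≟ t) refl)) pt)
                          (λ c _ e → dec-true⁻ (c ≟ t) (∧-conicalˡ _ _ e))
          ... | false = count-zero _ all λ c _ → lem c
            where
            lem : ∀ c → does (c ≟ t) ∧ p c ≡ false
            lem c with c ≟ t
            ... | yes refl = pt
            ... | no _     = refl

        sum : leaves (half true) + leaves (half false) ≡
              suc (tensors (half true)) + suc (tensors (half false))
        sum = begin
          leaves (half true) + leaves (half false)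
            ≡⟨ sym (+-identityʳ _) ⟩
          leaves (half true) + leaves (half false) + 0
            ≡⟨ cong (λ l → leaves (half true) + leaves (half false) + toℕᵇ (isLeaf l)) (sym t⊗) ⟩
          leaves (half true) + leaves (half false) + toℕᵇ (isLeaf (label t))
            ≡⟨ sym (split-count (isLeaf ∘ label)) ⟩
          leaves X
            ≡⟨ balanced ⟩
          suc (tensors X)
            ≡⟨ cong suc (split-count (isTens ∘ kind)) ⟩
          suc (tensors (half true) + tensors (half false) + toℕᵇ (isTens (kind t)))
            ≡⟨ cong (λ l → suc (tensors (half true) + tensors (half false) + toℕᵇ (isTens (kindOf l)))) t⊗ ⟩
          suc (tensors (half true) + tensors (half false) + 1)
            ≡⟨ cong suc (+-assoc (tensors (half true)) _ 1) ⟩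
          suc (tensors (half true) + (tensors (half false) + 1))
            ≡⟨ cong (λ z → suc (tensors (half true) + z)) (+-comm _ 1) ⟩
          suc (tensors (half true)) + suc (tensors (half false)) ∎
          where open ≡-Reasoning

        squeeze : ∀ {a b c d} → a + b ≡ c + d → c ≤ a → d ≤ b → a ≡ c × b ≡ d
        squeeze {a} {b} {c} {d} e c≤a d≤b =
          ≤-antisym (+-cancelʳ-≤ d a c (≤-trans (+-monoʳ-≤ a d≤b) (≤-reflexive e))) c≤a ,
          ≤-antisym (+-cancelˡ-≤ c b d (≤-trans (+-monoˡ-≤ b c≤a) (≤-reflexive e))) d≤b

        both = squeeze sum (lower true left τ-left) (lower false right τ-right)

      -- By `lower`, leaves exceed tensors by at least one in each half. By `sum` they exceed them
      -- by two in all, as removing `t` takes away one tensor. So both inequalities are equalities.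
      half-balanced : ∀ b → Balanced (half b)
      half-balanced true  = proj₁ both
      half-balanced false = proj₂ both

-- Embedding the nets of proofs

module Positions {F : Set} where

  Pos : List F → Set
  Pos Γ = ∃ λ A → A ∈ Γ

  shift : ∀ {Γ B} → Pos Γ → Pos (B ∷ Γ)
  shift (A , i) = A , there i

  permute : ∀ {Γ Δ} → Γ ↭ Δ → Pos Γ → Pos Δ
  permute σ (A , i) = A , ∈-resp-↭ σ i

  shift-injective : ∀ {Γ B} {p q : Pos Γ} → shift {B = B} p ≡ shift q → p ≡ q
  shift-injective {p = A , i} {q = .A , .i} refl = refl

  -- The permutation comes with its action on the chosen occurrence, since equal formulae may occur
  -- several times.
  extract : ∀ {Γ} ((A , i) : Pos Γ) → ∃ λ Δ → Σ (A ∷ Δ ↭ Γ) λ σ → permute σ (A , here refl) ≡ (A , i)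
  extract {A ∷ Γ} (_ , here refl) = Γ , ↭-refl , refl
  extract {B ∷ Γ} (A , there i) with extract (A , i)
  ... | Δ , σ , e = B ∷ Δ , Perm.trans (swap A B ↭-refl) (prep B σ) , cong shift e

  permute-injective : ∀ {Γ Δ} (σ : Γ ↭ Δ) {p q : Pos Γ} → permute σ p ≡ permute σ q → p ≡ q
  permute-injective Perm.refl e = e
  permute-injective (prep x σ) {_ , here refl} {_ , here refl} e = refl
  permute-injective (prep x σ) {_ , there i}   {_ , there j}   e =
    cong shift (permute-injective σ (shift-injective e))
  permute-injective (prep x σ) {_ , here refl} {_ , there j}   e with () ← e
  permute-injective (prep x σ) {_ , there i}   {_ , here refl} e with () ← e
  permute-injective (swap x y σ) {_ , here refl} {_ , here refl} e = refl
  permute-injective (swap x y σ) {_ , here refl} {_ , there (here refl)} e with () ← e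
  permute-injective (swap x y σ) {_ , here refl} {_ , there (there j)} e with () ← e
  permute-injective (swap x y σ) {_ , there (here refl)} {_ , here refl} e with () ← e
  permute-injective (swap x y σ) {_ , there (here refl)} {_ , there (here refl)} e = refl
  permute-injective (swap x y σ) {_ , there (here refl)} {_ , there (there j)} e with () ← e
  permute-injective (swap x y σ) {_ , there (there i)} {_ , here refl} e with () ← e
  permute-injective (swap x y σ) {_ , there (there i)} {_ , there (here refl)} e with () ← e
  permute-injective (swap x y σ) {_ , there (there i)} {_ , there (there j)} e =
    cong (shift ∘ shift) (permute-injective σ (shift-injective (shift-injective e)))
  permute-injective (Perm.trans σ τ) e = permute-injective σ (permute-injective τ e)

  permute-surjective : ∀ {Γ Δ} (σ : Γ ↭ Δ) (q : Pos Δ) → ∃ λ p → permute σ p ≡ q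
  permute-surjective Perm.refl q = q , refl
  permute-surjective (prep x σ) (_ , here refl) = (_ , here refl) , refl
  permute-surjective (prep x σ) (_ , there j) =
    let (p , e) = permute-surjective σ (_ , j) in shift p , cong shift e
  permute-surjective (swap x y σ) (_ , here refl) = (_ , there (here refl)) , refl
  permute-surjective (swap x y σ) (_ , there (here refl)) = (_ , here refl) , refl
  permute-surjective (swap x y σ) (_ , there (there j)) =
    let (p , e) = permute-surjective σ (_ , j) in shift (shift p) , cong (shift ∘ shift) e
  permute-surjective (Perm.trans σ τ) q with permute-surjective τ q
  ... | p , refl with permute-surjective σ p
  ... | p′ , refl = p′ , refl

module Listings {F Arc : Set} (type : Arc → F) where
  open Positions {F}

  -- Arcs are indexed by positions rather than put in a list, because the • nodes of a structure are
  -- exactly the positions of its sequent.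
  record Listing (Γ : List F) (g : Pos Γ → Arc) (P : Arc → Set) : Set where
    field
      types     : ∀ p → type (g p) ≡ proj₁ p
      injective : ∀ {p q} → g p ≡ g q → p ≡ q
      sound     : ∀ p → P (g p)
      complete  : ∀ {a} → P a → ∃ λ p → g p ≡ a

  nil : Pos [] → Arc
  nil (_ , ())

  _◂_ : ∀ {A Γ} → Arc → (Pos Γ → Arc) → Pos (A ∷ Γ) → Arc
  (a ◂ g) (_ , here _)  = a
  (a ◂ g) (A , there i) = g (A , i)

  infixr 5 _◂_ _⊕_

  _⊕_ : ∀ {Γ Δ} → (Pos Γ → Arc) → (Pos Δ → Arc) → Pos (Γ ++ Δ) → Arc
  _⊕_ {Γ} g h (A , i) = [ (λ j → g (A , j)) , (λ j → h (A , j)) ]′ (∈-++⁻ Γ i)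

  ⊕-ˡ : ∀ {Γ Δ} (g : Pos Γ → Arc) (h : Pos Δ → Arc) {A} (i : A ∈ Γ) → (g ⊕ h) (A , ∈-++⁺ˡ i) ≡ g (A , i)
  ⊕-ˡ {Γ} {Δ} g h i = cong [ (λ j → g (_ , j)) , (λ j → h (_ , j)) ]′ (++⁻∘++⁺ Γ {Δ} (inj₁ i))

  ⊕-ʳ : ∀ {Γ Δ} (g : Pos Γ → Arc) (h : Pos Δ → Arc) {A} (i : A ∈ Δ) → (g ⊕ h) (A , ∈-++⁺ʳ Γ i) ≡ h (A , i)
  ⊕-ʳ {Γ} {Δ} g h i = cong [ (λ j → g (_ , j)) , (λ j → h (_ , j)) ]′ (++⁻∘++⁺ Γ {Δ} (inj₂ i))

  at : (as : List Arc) → Pos (map type as) → Arc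
  at []       = nil
  at (a ∷ as) = a ◂ at as

  listing-nil : Listing [] nil (const Empty)
  listing-nil = record
    { types = λ { (_ , ()) } ; injective = λ { {_ , ()} } ; sound = λ { (_ , ()) } ; complete = λ () }

  listing-cons : ∀ {a A Γ g P} → type a ≡ A → ¬ P a → Listing Γ g P →
                 Listing (A ∷ Γ) (a ◂ g) (λ b → b ≡ a ⊎ P b)
  listing-cons {a} {A} {Γ} {g} {P} ta ¬Pa L = record
    { types     = λ { (_ , here refl) → ta ; (_ , there i) → types (_ , i) }
    ; injective = inj
    ; sound     = λ { (_ , here _) → inj₁ refl ; (_ , there i) → inj₂ (sound (_ , i)) }
    ; complete  = λ { (inj₁ refl) → (_ , here refl) , refl
                    ; (inj₂ Pb) → let (p , e) = complete Pb in shift p , e } }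
    where
    open Listing L
    inj : ∀ {p q : Pos (A ∷ Γ)} → (a ◂ g) p ≡ (a ◂ g) q → p ≡ q
    inj {_ , here refl} {_ , here refl} _ = refl
    inj {_ , here refl} {_ , there j}   e = contradiction (subst P (sym e) (sound (_ , j))) ¬Pa
    inj {_ , there i}   {_ , here refl} e = contradiction (subst P e (sound (_ , i))) ¬Pa
    inj {_ , there i}   {_ , there j}   e = cong shift (injective e)

  listing-cong : ∀ {Γ g P Q} → (∀ {a} → P a → Q a) → (∀ {a} → Q a → P a) → Listing Γ g P → Listing Γ g Q
  listing-cong to from L = record
    { types = types ; injective = injective ; sound = to ∘ sound ; complete = complete ∘ from }
    where open Listing L

  listing-singleton : ∀ {a A} → type a ≡ A → Listing (A ∷ []) (a ◂ nil) (_≡ a)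
  listing-singleton ta = listing-cong (λ { (inj₁ e) → e ; (inj₂ ()) }) inj₁ (listing-cons ta (λ ()) listing-nil)

  listing-append : ∀ {Γ Δ g h P Q} → Listing Γ g P → Listing Δ h Q → (∀ {a} → P a → ¬ Q a) →
                   Listing (Γ ++ Δ) (g ⊕ h) (λ a → P a ⊎ Q a)
  listing-append {Γ} {Δ} {g} {h} {P} {Q} L M disjoint = record
    { types = tys
    ; injective = inj
    ; sound = snd
    ; complete = λ { (inj₁ Pa) → let (p , e) = L.complete Pa in
                       (_ , ∈-++⁺ˡ (proj₂ p)) , trans (⊕-ˡ g h (proj₂ p)) e
                   ; (inj₂ Qa) → let (p , e) = M.complete Qa in
                       (_ , ∈-++⁺ʳ Γ (proj₂ p)) , trans (⊕-ʳ g h (proj₂ p)) e } }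
    where
    module L = Listing L
    module M = Listing M
    tys : ∀ p → type ((g ⊕ h) p) ≡ proj₁ p
    tys (A , i) with ∈-++⁻ Γ i
    ... | inj₁ j = L.types (A , j)
    ... | inj₂ j = M.types (A , j)
    snd : ∀ p → P ((g ⊕ h) p) ⊎ Q ((g ⊕ h) p)
    snd (A , i) with ∈-++⁻ Γ i
    ... | inj₁ j = inj₁ (L.sound (A , j))
    ... | inj₂ j = inj₂ (M.sound (A , j))
    embed : ∀ {A} → A ∈ Γ ⊎ A ∈ Δ → Pos (Γ ++ Δ)
    embed x = _ , [ ∈-++⁺ˡ , ∈-++⁺ʳ Γ ]′ x
    inj′ : ∀ {A B} (x : A ∈ Γ ⊎ A ∈ Δ) (y : B ∈ Γ ⊎ B ∈ Δ) →
           [ (λ j → g (A , j)) , (λ j → h (A , j)) ]′ x ≡ [ (λ j → g (B , j)) , (λ j → h (B , j)) ]′ y →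
           embed x ≡ embed y
    inj′ (inj₁ i) (inj₁ j) e = cong (λ (A , i) → A , ∈-++⁺ˡ i) (L.injective e)
    inj′ (inj₁ i) (inj₂ j) e = contradiction (subst Q (sym e) (M.sound (_ , j))) (disjoint (L.sound (_ , i)))
    inj′ (inj₂ i) (inj₁ j) e = contradiction (subst Q e (M.sound (_ , i))) (disjoint (L.sound (_ , j)))
    inj′ (inj₂ i) (inj₂ j) e = cong (λ (A , i) → A , ∈-++⁺ʳ Γ i) (M.injective e)
    inj : ∀ {p q} → (g ⊕ h) p ≡ (g ⊕ h) q → p ≡ q
    inj {A , i} {B , j} e =
      trans (cong (A ,_) (sym (++⁺∘++⁻ Γ i)))
        (trans (inj′ (∈-++⁻ Γ i) (∈-++⁻ Γ j) e) (cong (B ,_) (++⁺∘++⁻ Γ j)))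

  listing-at : ∀ {as} → Unique as → Listing (map type as) (at as) (_∈ as)
  listing-at {[]}     []        = listing-cong (λ ()) (λ ()) listing-nil
  listing-at {a ∷ as} (a∉ ∷ un) = listing-cong
    (λ { (inj₁ e) → here e ; (inj₂ i) → there i }) (λ { (here e) → inj₁ e ; (there i) → inj₂ i })
    (listing-cons refl (All¬⇒¬Any a∉) (listing-at un))

  listing-filter : ∀ {as} → Unique as → (∀ a → a ∈ as) → (q : Arc → Bool) →
                   Listing (map type (filterᵇ q as)) (at (filterᵇ q as)) (λ a → q a ≡ true)
  listing-filter {as} un complete q = listing-cong
    (λ a∈ → proj₂ (∈-filterᵇ⁻ q as a∈)) (λ qa → ∈-filterᵇ⁺ q (complete _) qa)
    (listing-at (filterᵇ-unique q un))

  -- A permutation of the formulae alone would not do: repeated formulae must go to the right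
  -- occurrences. The arc listed first by `h` is located in `g` and brought to the front, and the
  -- remaining arcs are treated recursively.
  reorder : ∀ {Γ Δ g h P} → Listing Γ g P → Listing Δ h P →
            Σ (Δ ↭ Γ) λ σ → ∀ p → g (permute σ p) ≡ h p
  reorder {[]} {[]} L M = ↭-refl , λ { (_ , ()) }
  reorder {A ∷ Γ} {[]} L M with Listing.complete M (Listing.sound L (A , here refl))
  ... | (_ , ()) , _
  reorder {Γ} {A ∷ Δ} {g} {h} {P} L M with Listing.complete L (Listing.sound M (A , here refl))
  ... | (B , i) , e with trans (sym (Listing.types L (B , i)))
                          (trans (cong type e) (Listing.types M (A , here refl)))
  ...   | refl with extract (B , i)
  ...     | Γ′ , σ , σ-here = Perm.trans (prep A τ) σ , agree
    where
    module L = Listing L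
    module M = Listing M
    a = h (A , here refl)
    g-here : g (permute σ (A , here refl)) ≡ a
    g-here = trans (cong g σ-here) e
    rest-L : Listing Γ′ (g ∘ permute σ ∘ shift) (λ b → P b × b ≢ a)
    rest-L = record
      { types = λ p → L.types (permute σ (shift p))
      ; injective = λ e → shift-injective (permute-injective σ (L.injective e))
      ; sound = λ p → L.sound _ , λ e → case-shift (permute-injective σ (L.injective (trans e (sym g-here))))
      ; complete = comp }
      where
      case-shift : ∀ {p : Pos Γ′} → shift p ≢ (A , here refl)
      case-shift ()
      comp : ∀ {b} → P b × b ≢ a → ∃ λ p → g (permute σ (shift p)) ≡ b
      comp (Pb , b≢) with L.complete Pb
      ... | q , refl with permute-surjective σ q
      ...   | (_ , here refl) , refl = contradiction g-here b≢
      ...   | (_ , there j) , refl = (_ , j) , refl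
    rest-M : Listing Δ (h ∘ shift) (λ b → P b × b ≢ a)
    rest-M = record
      { types = λ p → M.types (shift p)
      ; injective = λ e → shift-injective (M.injective e)
      ; sound = λ p → M.sound _ , λ e → case-shift (M.injective e)
      ; complete = comp }
      where
      case-shift : ∀ {p : Pos Δ} → shift p ≢ (A , here refl)
      case-shift ()
      comp : ∀ {b} → P b × b ≢ a → ∃ λ p → h (shift p) ≡ b
      comp (Pb , b≢) with M.complete Pb
      ... | (_ , here refl) , refl = contradiction refl b≢
      ... | (_ , there j) , refl = (_ , j) , refl
    ih = reorder rest-L rest-M
    τ = proj₁ ih
    agree : ∀ p → g (permute (Perm.trans (prep A τ) σ) p) ≡ h p
    agree (_ , here refl) = g-here
    agree (_ , there j)   = proj₂ ih (_ , j)

module Embeddings (atoms : AtomicFormulae) where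
  open MLL atoms
  open Positions {Formula}

  module _ {Γ₀ : Sequent} (R : Structure Γ₀) where
    open Structure R
    open Listings type

    -- For an arc of the embedded structure ending at a • node, only its identity is prescribed: in
    -- `R` the corresponding arc may go on to a cell outside the part.
    Matches : ∀ {D Γ} → (∀ l → D l → Cell l) → (Pos Γ → Arc) → Target D Γ → Arc → Set
    Matches onC g (into c s) a = head a ≡ into (onC _ c) s
    Matches onC g (• {A} i)  a = a ≡ g (A , i)

    -- R restricted to X is isomorphic to P, the conclusions of P being the arcs
    -- listed by g.
    record Embeds {Γ} (P : Structure Γ) (X : ∃ Cell → Bool) (g : Pos Γ → Arc) : Set where
      private module P = Structure P
      field
        onC : ∀ l → P.Cell l → Cell l
        injectiveC : ∀ {l c d} → onC l c ≡ onC l d → c ≡ d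
        inX : ∀ {l} c → X (l , onC l c) ≡ true
        surjectiveC : ∀ {l} c → X (l , c) ≡ true → ∃ λ d → onC l d ≡ c
        onA : P.Arc → Arc
        injectiveA : ∀ {a b} → onA a ≡ onA b → a ≡ b
        surjectiveA : ∀ a → X (tail a) ≡ true → ∃ λ b → onA b ≡ a
        type-onA : ∀ a → type (onA a) ≡ P.type a
        tail-onA : ∀ a → tail (onA a) ≡ (proj₁ (P.tail a) , onC _ (proj₂ (P.tail a)))
        head-onA : ∀ a → Matches onC g (P.head a) (onA a)

      inX-tail : ∀ a → X (tail (onA a)) ≡ true
      inX-tail a = subst (λ c → X c ≡ true) (sym (tail-onA a)) (inX _)

    embeds-exchange : ∀ {Γ Δ P X} {g : Pos Γ → Arc} {h : Pos Δ → Arc} (σ : Γ ↭ Δ) →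
                      (∀ p → h (permute σ p) ≡ g p) → Embeds P X g → Embeds (exchangeˢ σ P) X h
    embeds-exchange {P = P} {h = h} σ e E = record
      { onC = onC ; injectiveC = injectiveC ; inX = inX ; surjectiveC = surjectiveC
      ; onA = onA ; injectiveA = injectiveA ; surjectiveA = surjectiveA
      ; type-onA = type-onA ; tail-onA = tail-onA ; head-onA = head-onA′ }
      where
      open Embeds E
      head-onA′ : ∀ a → Matches onC h (Structure.head (exchangeˢ σ P) a) (onA a)
      head-onA′ a with Structure.head P a | head-onA a
      ... | into c s | m = m
      ... | • i      | m = trans m (sym (e (_ , i)))

    embeds-ax : ∀ {X n a b} → X (ax , n) ≡ true → (∀ {c} → X c ≡ true → c ≡ (ax , n)) →
                tail a ≡ (ax , n) → tail b ≡ (ax , n) → a ≢ b →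
                (∀ {d} → tail d ≡ (ax , n) → d ≡ a ⊎ d ≡ b) → type b ≡ type a ^⊥ →
                Embeds (axˢ (type a)) X (a ◂ b ◂ nil)
    embeds-ax {X} {n} {a} {b} Xn only tail-a tail-b a≢b cover type-b = record
      { onC = λ { _ refl → n }
      ; injectiveC = λ { {_} {refl} {refl} _ → refl }
      ; inX = λ { refl → Xn }
      ; surjectiveC = λ c Xc → case only Xc of λ { refl → refl , refl }
      ; onA = λ { left → a ; right → b }
      ; injectiveA = λ { {left} {left} _ → refl ; {left} {right} e → contradiction e a≢b
                       ; {right} {left} e → contradiction (sym e) a≢b ; {right} {right} _ → refl }
      ; surjectiveA = λ d Xd → case cover (only Xd) of λ { (inj₁ e) → left , sym e ; (inj₂ e) → right , sym e }
      ; type-onA = λ { left → refl ; right → type-b }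
      ; tail-onA = λ { left → tail-a ; right → tail-b }
      ; head-onA = λ { left → refl ; right → refl } }

    embeds-𝟏 : ∀ {X n a} → X (one , n) ≡ true → (∀ {c} → X c ≡ true → c ≡ (one , n)) →
               tail a ≡ (one , n) → (∀ {d} → tail d ≡ (one , n) → d ≡ a) → type a ≡ 𝟏 →
               Embeds 𝟏ˢ X (a ◂ nil)
    embeds-𝟏 {X} {n} {a} Xn only tail-a unique-a type-a = record
      { onC = λ { _ refl → n }
      ; injectiveC = λ { {_} {refl} {refl} _ → refl }
      ; inX = λ { refl → Xn }
      ; surjectiveC = λ c Xc → case only Xc of λ { refl → refl , refl }
      ; onA = λ _ → a
      ; injectiveA = λ _ → refl
      ; surjectiveA = λ d Xd → tt , sym (unique-a (only Xd))
      ; type-onA = λ _ → type-a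
      ; tail-onA = λ _ → tail-a
      ; head-onA = λ _ → refl }

    module _ (_≟_ : DecidableEquality (∃ Cell)) where

      _∖_ : (∃ Cell → Bool) → ∃ Cell → ∃ Cell → Bool
      (X ∖ c) d = X d ∧ not (does (d ≟ c))

      ∖⁺ : ∀ X {c d} → X d ≡ true → d ≢ c → (X ∖ c) d ≡ true
      ∖⁺ X {c} {d} Xd d≢ = cong₂ _∧_ Xd (cong not (dec-false (d ≟ c) d≢))

      ∖⁻ : ∀ X {c d} → (X ∖ c) d ≡ true → X d ≡ true × d ≢ c
      ∖⁻ X {c} {d} e = ∧-conicalˡ _ _ e , dec-false⁻ (d ≟ c) (not-true⁻ (∧-conicalʳ (X d) _ e))

      private
        -- What the ⊥ and ⅋ rules have in common: one new cell with a single conclusion.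
        module Extension {Γ} {P : Structure Γ} {X l₀ n d} {g : Pos Γ → Arc}
          (Xn : X (l₀ , n) ≡ true) (tail-d : tail d ≡ (l₀ , n))
          (unique-d : ∀ {a} → tail a ≡ (l₀ , n) → a ≡ d)
          (E : Embeds P (X ∖ (l₀ , n)) g) where
          module E = Embeds E
          module P = Structure P

          onC : ∀ l → P.Cell l ⊎ l ≡ l₀ → Cell l
          onC l (inj₁ c)    = E.onC l c
          onC l (inj₂ refl) = n

          new≢ : ∀ {c} → E.onC l₀ c ≢ n
          new≢ {c} e = proj₂ (∖⁻ X (E.inX c)) (cong (l₀ ,_) e)

          injectiveC : ∀ {l c d} → onC l c ≡ onC l d → c ≡ d
          injectiveC {l} {inj₁ _}    {inj₁ _}    e = cong inj₁ (E.injectiveC e)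
          injectiveC {l} {inj₁ _}    {inj₂ refl} e = contradiction e new≢
          injectiveC {l} {inj₂ refl} {inj₁ _}    e = contradiction (sym e) new≢
          injectiveC {l} {inj₂ refl} {inj₂ refl} _ = refl

          inX : ∀ {l} c → X (l , onC l c) ≡ true
          inX (inj₁ c)    = proj₁ (∖⁻ X (E.inX c))
          inX (inj₂ refl) = Xn

          surjectiveC : ∀ {l} c → X (l , c) ≡ true → ∃ λ d → onC l d ≡ c
          surjectiveC {l} c Xc with (l , c) ≟ (l₀ , n)
          ... | yes refl = inj₂ refl , refl
          ... | no ne    = let (c′ , e) = E.surjectiveC c (∖⁺ X Xc ne) in inj₁ c′ , e

          onA : P.Arc ⊎ ⊤ → Arc
          onA (inj₁ a)  = E.onA a
          onA (inj₂ tt) = d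

          newA≢ : ∀ {a} → E.onA a ≢ d
          newA≢ {a} e = proj₂ (∖⁻ X (E.inX-tail a)) (trans (cong tail e) tail-d)

          injectiveA : ∀ {a a′} → onA a ≡ onA a′ → a ≡ a′
          injectiveA {inj₁ _} {inj₁ _} e = cong inj₁ (E.injectiveA e)
          injectiveA {inj₁ _} {inj₂ _} e = contradiction e newA≢
          injectiveA {inj₂ _} {inj₁ _} e = contradiction (sym e) newA≢
          injectiveA {inj₂ _} {inj₂ _} _ = refl

          surjectiveA : ∀ a → X (tail a) ≡ true → ∃ λ a′ → onA a′ ≡ a
          surjectiveA a Xa with tail a ≟ (l₀ , n)
          ... | yes e = inj₂ tt , sym (unique-d e)
          ... | no ne = let (a′ , e) = E.surjectiveA a (∖⁺ X Xa ne) in inj₁ a′ , e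

      embeds-⊥ : ∀ {Γ P X b d} {g : Pos Γ → Arc} →
                 X (bot , b) ≡ true → tail d ≡ (bot , b) → (∀ {a} → tail a ≡ (bot , b) → a ≡ d) →
                 type d ≡ ⊥ →
                 Embeds P (X ∖ (bot , b)) g → Embeds (⊥ˢ Γ P) X (g ⊕ (d ◂ nil))
      embeds-⊥ {Γ} {P} {X} {b} {d} {g} Xb tail-d unique-d type-d E = record
        { onC = onC ; injectiveC = injectiveC ; inX = inX ; surjectiveC = surjectiveC
        ; onA = onA ; injectiveA = injectiveA ; surjectiveA = surjectiveA
        ; type-onA = λ { (inj₁ a) → E.type-onA a ; (inj₂ tt) → type-d }
        ; tail-onA = λ { (inj₁ a) → E.tail-onA a ; (inj₂ tt) → tail-d }
        ; head-onA = λ { (inj₁ a) → head-onA a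
                       ; (inj₂ tt) → sym (⊕-ʳ g (d ◂ nil) (here refl)) } }
        where
        open Extension Xb tail-d unique-d E
        head-onA : ∀ a → Matches onC (g ⊕ (d ◂ nil)) (Structure.head (⊥ˢ Γ P) (inj₁ a)) (E.onA a)
        head-onA a with P.head a | E.head-onA a
        ... | into c s | m = m
        ... | • i      | m = trans m (sym (⊕-ˡ g (d ◂ nil) i))

      embeds-⅋ : ∀ {Γ A B P X n d l r} {g : Pos Γ → Arc} →
                 X (par , n) ≡ true → tail d ≡ (par , n) → (∀ {a} → tail a ≡ (par , n) → a ≡ d) →
                 type d ≡ A ⅋ B → head l ≡ into n (⅋-in left) → head r ≡ into n (⅋-in right) →
                 Embeds P (X ∖ (par , n)) (g ⊕ (l ◂ r ◂ nil)) →
                 Embeds (⅋ˢ Γ A B P) X (g ⊕ (d ◂ nil))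
      embeds-⅋ {Γ} {A} {B} {P} {X} {n} {d} {l} {r} {g} Xn tail-d unique-d type-d head-l head-r E = record
        { onC = onC ; injectiveC = injectiveC ; inX = inX ; surjectiveC = surjectiveC
        ; onA = onA ; injectiveA = injectiveA ; surjectiveA = surjectiveA
        ; type-onA = λ { (inj₁ a) → E.type-onA a ; (inj₂ tt) → type-d }
        ; tail-onA = λ { (inj₁ a) → E.tail-onA a ; (inj₂ tt) → tail-d }
        ; head-onA = λ { (inj₁ a) → head-onA a
                       ; (inj₂ tt) → sym (⊕-ʳ g (d ◂ nil) (here refl)) } }
        where
        open Extension Xn tail-d unique-d E
        head-onA : ∀ a → Matches onC (g ⊕ (d ◂ nil)) (Structure.head (⅋ˢ Γ A B P) (inj₁ a)) (E.onA a)
        head-onA a with P.head a | E.head-onA a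
        ... | into c s | m = m
        ... | • i      | m with ∈-++⁻ Γ i
        ...   | inj₁ j                   = trans m (sym (⊕-ˡ g (d ◂ nil) j))
        ...   | inj₂ (here refl)         = trans (cong head m) head-l
        ...   | inj₂ (there (here refl)) = trans (cong head m) head-r

      embeds-⊗ : ∀ {Γ Δ A B P Q X Y Z n d l r} {g : Pos Γ → Arc} {h : Pos Δ → Arc} →
                 X (tensor , n) ≡ true → tail d ≡ (tensor , n) →
                 (∀ {a} → tail a ≡ (tensor , n) → a ≡ d) →
                 type d ≡ A ⊗ B → head l ≡ into n (⊗-in left) → head r ≡ into n (⊗-in right) →
                 (∀ {c} → Y c ≡ true → X c ≡ true × c ≢ (tensor , n)) →
                 (∀ {c} → Z c ≡ true → X c ≡ true × c ≢ (tensor , n)) →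
                 (∀ {c} → Y c ≡ true → Z c ≢ true) →
                 (∀ {c} → X c ≡ true → c ≢ (tensor , n) → Y c ≡ true ⊎ Z c ≡ true) →
                 Embeds P Y (g ⊕ (l ◂ nil)) → Embeds Q Z (r ◂ h) →
                 Embeds (⊗ˢ Γ A B {Δ} P Q) X (g ⊕ (d ◂ h))
      embeds-⊗ {Γ} {Δ} {A} {B} {P} {Q} {X} {Y} {Z} {n} {d} {l} {r} {g} {h}
               Xn tail-d unique-d type-d head-l head-r Y⊆ Z⊆ disjoint cover E F = record
        { onC = onC ; injectiveC = injectiveC ; inX = inX ; surjectiveC = surjectiveC
        ; onA = onA ; injectiveA = injectiveA ; surjectiveA = surjectiveA
        ; type-onA = λ { (inj₁ (inj₁ a)) → E.type-onA a ; (inj₁ (inj₂ a)) → F.type-onA a ; (inj₂ tt) → type-d }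
        ; tail-onA = λ { (inj₁ (inj₁ a)) → E.tail-onA a ; (inj₁ (inj₂ a)) → F.tail-onA a ; (inj₂ tt) → tail-d }
        ; head-onA = λ { (inj₁ (inj₁ a)) → head-onAˡ a ; (inj₁ (inj₂ a)) → head-onAʳ a
                       ; (inj₂ tt) → sym (⊕-ʳ g (d ◂ h) (here refl)) } }
        where
        module E = Embeds E
        module F = Embeds F
        module P = Structure P
        module Q = Structure Q
        S = ⊗ˢ Γ A B {Δ} P Q
        module S = Structure S
        onC : ∀ l → S.Cell l → Cell l
        onC l (inj₁ (inj₁ c)) = E.onC l c
        onC l (inj₁ (inj₂ c)) = F.onC l c
        onC l (inj₂ refl)     = n
        clash : ∀ {l c d} → E.onC l c ≢ F.onC l d
        clash {l} {c} {d} e = disjoint (E.inX c) (subst (λ x → Z (l , x) ≡ true) (sym e) (F.inX d))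
        newˡ : ∀ {c} → E.onC tensor c ≢ n
        newˡ {c} e = proj₂ (Y⊆ (E.inX c)) (cong (tensor ,_) e)
        newʳ : ∀ {c} → F.onC tensor c ≢ n
        newʳ {c} e = proj₂ (Z⊆ (F.inX c)) (cong (tensor ,_) e)
        injectiveC : ∀ {l c d} → onC l c ≡ onC l d → c ≡ d
        injectiveC {l} {inj₁ (inj₁ _)} {inj₁ (inj₁ _)} e = cong (inj₁ ∘ inj₁) (E.injectiveC e)
        injectiveC {l} {inj₁ (inj₁ _)} {inj₁ (inj₂ _)} e = contradiction e clash
        injectiveC {l} {inj₁ (inj₂ _)} {inj₁ (inj₁ _)} e = contradiction (sym e) clash
        injectiveC {l} {inj₁ (inj₂ _)} {inj₁ (inj₂ _)} e = cong (inj₁ ∘ inj₂) (F.injectiveC e)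
        injectiveC {l} {inj₁ (inj₁ _)} {inj₂ refl} e = contradiction e newˡ
        injectiveC {l} {inj₁ (inj₂ _)} {inj₂ refl} e = contradiction e newʳ
        injectiveC {l} {inj₂ refl} {inj₁ (inj₁ _)} e = contradiction (sym e) newˡ
        injectiveC {l} {inj₂ refl} {inj₁ (inj₂ _)} e = contradiction (sym e) newʳ
        injectiveC {l} {inj₂ refl} {inj₂ refl} _ = refl
        inX : ∀ {l} c → X (l , onC l c) ≡ true
        inX (inj₁ (inj₁ c)) = proj₁ (Y⊆ (E.inX c))
        inX (inj₁ (inj₂ c)) = proj₁ (Z⊆ (F.inX c))
        inX (inj₂ refl)     = Xn
        surjectiveC : ∀ {l} c → X (l , c) ≡ true → ∃ λ d → onC l d ≡ c
        surjectiveC {l} c Xc with (l , c) ≟ (tensor , n)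
        ... | yes refl = inj₂ refl , refl
        ... | no ne with cover Xc ne
        ...   | inj₁ Yc = let (c′ , e) = E.surjectiveC c Yc in inj₁ (inj₁ c′) , e
        ...   | inj₂ Zc = let (c′ , e) = F.surjectiveC c Zc in inj₁ (inj₂ c′) , e
        onA : S.Arc → Arc
        onA (inj₁ (inj₁ a)) = E.onA a
        onA (inj₁ (inj₂ a)) = F.onA a
        onA (inj₂ tt)       = d
        clashA : ∀ {a b} → E.onA a ≢ F.onA b
        clashA {a} {b} e = disjoint (E.inX-tail a) (subst (λ x → Z (tail x) ≡ true) (sym e) (F.inX-tail b))
        newAˡ : ∀ {a} → E.onA a ≢ d
        newAˡ {a} e = proj₂ (Y⊆ (E.inX-tail a)) (trans (cong tail e) tail-d)
        newAʳ : ∀ {a} → F.onA a ≢ d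
        newAʳ {a} e = proj₂ (Z⊆ (F.inX-tail a)) (trans (cong tail e) tail-d)
        injectiveA : ∀ {a b} → onA a ≡ onA b → a ≡ b
        injectiveA {inj₁ (inj₁ _)} {inj₁ (inj₁ _)} e = cong (inj₁ ∘ inj₁) (E.injectiveA e)
        injectiveA {inj₁ (inj₁ _)} {inj₁ (inj₂ _)} e = contradiction e clashA
        injectiveA {inj₁ (inj₂ _)} {inj₁ (inj₁ _)} e = contradiction (sym e) clashA
        injectiveA {inj₁ (inj₂ _)} {inj₁ (inj₂ _)} e = cong (inj₁ ∘ inj₂) (F.injectiveA e)
        injectiveA {inj₁ (inj₁ _)} {inj₂ _} e = contradiction e newAˡ
        injectiveA {inj₁ (inj₂ _)} {inj₂ _} e = contradiction e newAʳ
        injectiveA {inj₂ _} {inj₁ (inj₁ _)} e = contradiction (sym e) newAˡ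
        injectiveA {inj₂ _} {inj₁ (inj₂ _)} e = contradiction (sym e) newAʳ
        injectiveA {inj₂ _} {inj₂ _} _ = refl
        surjectiveA : ∀ a → X (tail a) ≡ true → ∃ λ b → onA b ≡ a
        surjectiveA a Xa with tail a ≟ (tensor , n)
        ... | yes e = inj₂ tt , sym (unique-d e)
        ... | no ne with cover Xa ne
        ...   | inj₁ Ya = let (b , e) = E.surjectiveA a Ya in inj₁ (inj₁ b) , e
        ...   | inj₂ Za = let (b , e) = F.surjectiveA a Za in inj₁ (inj₂ b) , e
        head-onAˡ : ∀ a → Matches onC (g ⊕ (d ◂ h)) (S.head (inj₁ (inj₁ a))) (E.onA a)
        head-onAˡ a with P.head a | E.head-onA a
        ... | into c s | m = m
        ... | • i      | m with ∈-++⁻ Γ i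
        ...   | inj₁ j           = trans m (sym (⊕-ˡ g (d ◂ h) j))
        ...   | inj₂ (here refl) = trans (cong head m) head-l
        head-onAʳ : ∀ a → Matches onC (g ⊕ (d ◂ h)) (S.head (inj₁ (inj₂ a))) (F.onA a)
        head-onAʳ a with Q.head a | F.head-onA a
        ... | into c s        | m = m
        ... | • (here refl)   | m = trans (cong head m) head-r
        ... | • (there i)     | m = trans m (sym (⊕-ʳ g (d ◂ h) (there i)))

    -- When the part is the whole net, the listed arcs do end at the • nodes of their positions,
    -- which supplies the heads that an embedding leaves open.
    embeds-all : ∀ {P : Structure Γ₀} {g} → (∀ {A} (i : A ∈ Γ₀) → head (g (A , i)) ≡ • i) →
                 Embeds P (const true) g → R ≅ P
    embeds-all {P} {g} head-g E = record
      { cells = λ l → mk↔ₛ′ (λ c → proj₁ (surjectiveC c refl)) (onC l)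
                        (λ c → injectiveC (proj₂ (surjectiveC (onC l c) refl)))
                        (λ c → proj₂ (surjectiveC c refl))
      ; arcs = mk↔ₛ′ back onA (λ a → injectiveA (proj₂ (surjectiveA (onA a) refl))) onA-back
      ; type-preserved = λ a → trans (sym (type-onA (back a))) (cong type (onA-back a))
      ; tail-preserved = tails
      ; head-preserved = heads }
      where
      open Embeds E
      module P = Structure P
      back : Arc → P.Arc
      back a = proj₁ (surjectiveA a refl)
      onA-back : ∀ a → onA (back a) ≡ a
      onA-back a = proj₂ (surjectiveA a refl)
      backC : ∀ {l} → Cell l → P.Cell l
      backC c = proj₁ (surjectiveC c refl)
      backC-onC : ∀ {l} c → backC (onC l c) ≡ c
      backC-onC c = injectiveC (proj₂ (surjectiveC (onC _ c) refl))
      tails : ∀ a → P.tail (back a) ≡ (proj₁ (tail a) , backC (proj₂ (tail a)))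
      tails a = subst (λ c → P.tail (back a) ≡ (proj₁ c , backC (proj₂ c)))
                  (trans (sym (tail-onA (back a))) (cong tail (onA-back a)))
                  (cong (_ ,_) (sym (backC-onC _)))
      heads : ∀ a → P.head (back a) ≡ mapTarget backC • (head a)
      heads a with P.head (back a) | head-onA (back a)
      ... | into c s | m rewrite sym (cong head (onA-back a)) | m = cong (λ c → into c s) (sym (backC-onC c))
      ... | • i      | m rewrite sym (cong head (onA-back a)) | m | head-g i = refl

-- Finite sets

module _ {A : Set} where

  lookup-injective : ∀ {xs : List A} → Unique xs → ∀ {i j} → lookup xs i ≡ lookup xs j → i ≡ j
  lookup-injective (_ ∷ _)  {zero}  {zero}  _ = refl
  lookup-injective {x ∷ xs} (x∉ ∷ _) {zero}  {suc j} e =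
    contradiction (subst (_∈ xs) (sym e) (∈-lookup j)) (All¬⇒¬Any x∉)
  lookup-injective {x ∷ xs} (x∉ ∷ _) {suc i} {zero}  e =
    contradiction (subst (_∈ xs) e (∈-lookup i)) (All¬⇒¬Any x∉)
  lookup-injective (_ ∷ un) {suc i} {suc j} e = cong suc (lookup-injective un e)

  length-≤ : ∀ {xs n} → Unique xs → (f : ∀ {x} → x ∈ xs → Fin n) →
             (∀ {x y} (i : x ∈ xs) (j : y ∈ xs) → f i ≡ f j → x ≡ y) → length {A = A} xs ≤ n
  length-≤ {xs} un f inj =
    injective⇒≤ {f = λ i → f (∈-lookup {xs = xs} i)} λ e → lookup-injective un (inj _ _ e)

  length-≥ : ∀ {xs n} (g : Fin n → A) → (∀ k → g k ∈ xs) → (∀ {j k} → g j ≡ g k → j ≡ k) → n ≤ length xs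
  length-≥ g g∈ inj = injective⇒≤ {f = λ k → index (g∈ k)} λ e → inj (index-injective (setoid A) (g∈ _) (g∈ _) e)

module FiniteSet {A : Set} (finite : Finite A) where
  private
    n = proj₁ finite
    open Inverse (proj₂ finite)

    from-to : ∀ a → from (to a) ≡ a
    from-to = strictlyInverseʳ

    to-injective : ∀ {a b} → to a ≡ to b → a ≡ b
    to-injective {a} {b} e = trans (sym (from-to a)) (trans (cong from e) (from-to b))

    from-injective : ∀ {i j} → from i ≡ from j → i ≡ j
    from-injective {i} {j} e = trans (sym (strictlyInverseˡ i)) (trans (cong to e) (strictlyInverseˡ j))

  abstract
    _≟_ : DecidableEquality A
    a ≟ b = map′ to-injective (cong to) (to a Fin.≟ to b)

    elements : List A
    elements = tabulate from

    unique : Unique elements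
    unique = tabulate⁺ from-injective

    complete : ∀ a → a ∈ elements
    complete a = subst (_∈ elements) (from-to a) (∈-tabulate⁺ (to a))

  module _ {R : A → A → Set} (acyclic : ∀ a → ¬ TransClosure R a a) where
    private
      _⊏_ : Fin n → Fin n → Set
      i ⊏ j = TransClosure R (from i) (from j)

      isSPO : IsStrictPartialOrder _≡_ _⊏_
      isSPO = record
        { isEquivalence = isEquivalence
        ; irrefl = λ { refl → acyclic _ }
        ; trans = Plus._++_
        ; <-resp-≈ = (λ { refl p → p }) , (λ { refl p → p }) }

      embed : ∀ {a b} → R a b → to a ⊏ to b
      embed {a} {b} r = subst₂ (TransClosure R) (sym (from-to a)) (sym (from-to b)) [ r ]

    -- Transported to `Fin n`, the transitive closure of an acyclic relation is a strict partial
    -- order, and on a finite set such an order is well-founded in both directions.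
    well-founded : WellFounded R
    well-founded = Subrelation.wellFounded embed (On.wellFounded to (spo-wellFounded isSPO))

    noetherian : WellFounded (flip R)
    noetherian = Subrelation.wellFounded embed (On.wellFounded to (spo-noetherian isSPO))

Fin1-unique : ∀ {A : Set} → A ↔ Fin 1 → (x y : A) → x ≡ y
Fin1-unique inv x y = trans (sym (strictlyInverseʳ x)) (trans (cong from (Fin1 (to x) (to y))) (strictlyInverseʳ y))
  where
  open Inverse inv
  Fin1 : (i j : Fin 1) → i ≡ j
  Fin1 zero zero = refl

-- Sequentialization

module Sequentialization (atoms : AtomicFormulae) {Γ₀ : MLL.Sequent atoms} (R : MLL.Structure atoms Γ₀)
  (isPS : MLL.IsProofStructure atoms R) (typed : MLL.HasTypesIn atoms R (MLL.[¬⊥⊗]LL atoms))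
  (cutFree : MLL.CutFree atoms R)
  (acyclicᴳ : ∀ φ → Graph.UndirectedAcyclic (MLL.switchingGraph atoms R φ)) where

  open MLL atoms
  open Structure R
  open IsProofStructure isPS
  open HasTypesIn typed
  open Positions {Formula}

  C : Set
  C = ∃ Cell

  open FiniteSet finiteCells public
  module A = FiniteSet finiteArcs

  label : C → Label
  label = proj₁

  premise : ∀ t → #premises t ≡ 1 → ∃ λ a → head a ≡ t
  premise t e = Inverse.from (premises t) (subst Fin (sym e) zero)

  premise-unique : ∀ t → #premises t ≡ 1 → ∀ {a b} → head a ≡ t → head b ≡ t → a ≡ b
  premise-unique t e p q =
    cong proj₁ (Fin1-unique (subst (λ n → (∃ λ a → head a ≡ t) ↔ Fin n) e (premises t)) (_ , p) (_ , q))

  out : ∀ {l} (c : Cell l) → #conclusions l ≡ 1 → ∃ λ a → tail a ≡ (l , c)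
  out c e = Inverse.from (conclusions c) (subst Fin (sym e) zero)

  out-unique : ∀ {l} (c : Cell l) → #conclusions l ≡ 1 → ∀ {a b} → tail a ≡ (l , c) → tail b ≡ (l , c) → a ≡ b
  out-unique {l} c e p q =
    cong proj₁ (Fin1-unique (subst (λ n → (∃ λ a → tail a ≡ (l , c)) ↔ Fin n) e (conclusions c)) (_ , p) (_ , q))

  in⊗ : Cell tensor → Side → Arc
  in⊗ c s = proj₁ (premise (into c (⊗-in s)) refl)

  head-in⊗ : ∀ c s → head (in⊗ c s) ≡ into c (⊗-in s)
  head-in⊗ c s = proj₂ (premise (into c (⊗-in s)) refl)

  in⊗-unique : ∀ {c s a} → head a ≡ into c (⊗-in s) → a ≡ in⊗ c s
  in⊗-unique e = premise-unique _ refl e (head-in⊗ _ _)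

  in⅋ : Cell par → Side → Arc
  in⅋ c s = proj₁ (premise (into c (⅋-in s)) refl)

  head-in⅋ : ∀ c s → head (in⅋ c s) ≡ into c (⅋-in s)
  head-in⅋ c s = proj₂ (premise (into c (⅋-in s)) refl)

  in⅋-unique : ∀ {c s a} → head a ≡ into c (⅋-in s) → a ≡ in⅋ c s
  in⅋-unique e = premise-unique _ refl e (head-in⅋ _ _)

  in• : Pos Γ₀ → Arc
  in• (_ , i) = proj₁ (premise (• i) refl)

  head-in• : ∀ {B} (i : B ∈ Γ₀) → head (in• (B , i)) ≡ • i
  head-in• i = proj₂ (premise (• i) refl)

  in•-unique : ∀ {B} {i : B ∈ Γ₀} {a} → head a ≡ • i → a ≡ in• (B , i)
  in•-unique {i = i} e = premise-unique _ refl e (head-in• i)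

  pre : C → Side → C
  pre (tensor , c) s = tail (in⊗ c s)
  pre (par , c)    s = tail (in⅋ c s)
  -- A default for cells of kind `source`; `_⇓_` and `Active` exclude them.
  pre c            s = c

  kind : C → Kind
  kind = kindOf ∘ label

  _⇓_ : C → C → Set
  p ⇓ c = kind c ≢ source × ∃ λ s → pre c s ≡ p

  head-⇓ : ∀ {a l} {c : Cell l} {s} → head a ≡ into c s → tail a ⇓ (l , c)
  head-⇓ {c = c} {cut-in} e = contradiction c cutFree
  head-⇓ {s = ⊗-in s}     e = (λ ()) , s , cong tail (sym (in⊗-unique e))
  head-⇓ {s = ⅋-in s}     e = (λ ()) , s , cong tail (sym (in⅋-unique e))

  ⇓-arc : ∀ {p c} → p ⇓ c → ∃ λ a → tail a ≡ p × Σ (Slot (label c)) λ s → head a ≡ into (proj₂ c) s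
  ⇓-arc {c = tensor , c} (_ , s , e) = in⊗ c s , e , ⊗-in s , head-in⊗ c s
  ⇓-arc {c = par , c}    (_ , s , e) = in⅋ c s , e , ⅋-in s , head-in⅋ c s
  ⇓-arc {c = ax , _}     (k , _)     = contradiction refl k
  ⇓-arc {c = cut , _}    (k , _)     = contradiction refl k
  ⇓-arc {c = one , _}    (k , _)     = contradiction refl k
  ⇓-arc {c = bot , _}    (k , _)     = contradiction refl k

  private
    open Graph graph using (Arrow)

    ⇓⇒Arrow : ∀ {p c} → p ⇓ c → Arrow (cell p) (cell c)
    ⇓⇒Arrow h with ⇓-arc h
    ... | a , refl , s , e = a , refl , cong targetNode e

    ⇓-acyclic : ∀ c → ¬ TransClosure _⇓_ c c
    ⇓-acyclic c w = acyclic (cell c) (go w)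
      where
      go : ∀ {p c} → TransClosure _⇓_ p c → TransClosure Arrow (cell p) (cell c)
      go [ h ]   = [ ⇓⇒Arrow h ]
      go (h ∷ w) = ⇓⇒Arrow h ∷ go w

  ⇓-wf : WellFounded _⇓_
  ⇓-wf = well-founded ⇓-acyclic

  ⇓-noetherian : WellFounded (λ d c → c ⇓ d)
  ⇓-noetherian = noetherian ⇓-acyclic

  private
    -- Through its ⅋, a formula of kind A always reaches an atom, a 𝟏 or a ⊗, whereas a formula of
    -- kind E reaches only ⊥.
    KindA∩KindE : ∀ {B} → KindA B → ¬ KindE B
    KindA∩KindE (a ⅋ _)   (e ⅋ _) = KindA∩KindE a e
    KindA∩KindE (a ⅋ᴱ _)  (e ⅋ _) = KindA∩KindE a e
    KindA∩KindE (_ ᴱ⅋ a)  (_ ⅋ e) = KindA∩KindE a e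

    tensor-¬KindE : ∀ c s → ¬ KindE (type (in⊗ c s))
    tensor-¬KindE c s with out c refl
    ... | d , e with type d | inFragment d | ⊗-type (head-in⊗ c left) (head-in⊗ c right) e
    tensor-¬KindE c left  | d , e | _ | inj₁ (A ⊗ _) | refl = KindA∩KindE A
    tensor-¬KindE c right | d , e | _ | inj₁ (_ ⊗ B) | refl = KindA∩KindE B

  module Switched (φ : Switching R) where

    G : Graph
    G = switchingGraph R φ

    private
      -- Comparing • nodes by the number of their position spares comparing formulae and membership
      -- proofs.
      encode : Node → C ⊎ ℕ
      encode (cell c) = inj₁ c
      encode (• i)    = inj₂ (Fin.toℕ (index i))

      position : ∀ {Δ : Sequent} {A B} (i : A ∈ Δ) (j : B ∈ Δ) → Fin.toℕ (index i) ≡ Fin.toℕ (index j) →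
                 _≡_ {A = Pos Δ} (A , i) (B , j)
      position (here refl) (here refl) _ = refl
      position (there i)   (there j)   e = cong shift (position i j (ℕ.suc-injective e))

      encode-injective : ∀ {u v} → encode u ≡ encode v → u ≡ v
      encode-injective {cell _} {cell _} refl = refl
      encode-injective {• i}    {• j}    e with position i j (inj₂-injective e)
      ... | refl = refl

      _≟ᴺ_ : DecidableEquality Node
      u ≟ᴺ v = map′ encode-injective (cong encode) (⊎-≡-dec _≟_ ℕ._≟_ (encode u) (encode v))

      _≟ᵖ_ : DecidableEquality (Cell par)
      c ≟ᵖ d = map′ (λ { refl → refl }) (cong (par ,_)) ((par , c) ≟ (par , d))

    bridge : Graph.UndirectedAcyclic G → ∀ a →
             ¬ EqClosure (Bridges.Avoiding G (⊎-≡-dec _≟ᴺ_ _≟ᵖ_) a) (Graph.tail G a) (Graph.head G a)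
    bridge = Bridges.bridge G (⊎-≡-dec _≟ᴺ_ _≟ᵖ_)

  open Edges kind pre

  private
    arc : ∀ {φ e} → Active φ e → Arc
    arc {e = (tensor , c) , s} (tensA _) = in⊗ c s
    arc {φ} {(par , c) , _}    (parA _)  = in⅋ c (φ (par , c))

    restrict : (C → Side) → Switching R
    restrict φ c = φ (par , c)

    arc-tail : ∀ {φ e} (a : Active φ e) → tail (arc a) ≡ source-end e
    arc-tail {e = (tensor , c) , s} (tensA _) = refl
    arc-tail {e = (par , c) , _}    (parA _)  = refl

    redirect-chosen : ∀ c s → redirect R c s s ≡ inj₁ (cell (par , c))
    redirect-chosen c left  = refl
    redirect-chosen c right = refl

    arc-head : ∀ {φ e} (a : Active φ e) →
               switchTarget R (restrict φ) (head (arc a)) ≡ inj₁ (cell (proj₁ e))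
    arc-head {e = (tensor , c) , s} (tensA _) rewrite head-in⊗ c s = refl
    arc-head {φ} {(par , c) , _}    (parA _)  rewrite head-in⅋ c (φ (par , c)) = redirect-chosen c _

    into-⅋-injective : ∀ {c d s t} → _≡_ {A = Target Cell Γ₀} (into {l = par} c (⅋-in s)) (into d (⅋-in t)) → c ≡ d
    into-⅋-injective refl = refl

    arc-injective : ∀ {φ e e′} (a : Active φ e) (a′ : Active φ e′) → arc a ≡ arc a′ → e ≡ e′
    arc-injective {e = (tensor , c) , s} {(tensor , c′) , s′} (tensA _) (tensA _) eq
      with refl ← trans (sym (head-in⊗ c s)) (trans (cong head eq) (head-in⊗ c′ s′)) = refl
    arc-injective {φ} {(tensor , c) , s} {(par , c′) , _} (tensA _) (parA _) eq
      with () ← trans (sym (head-in⊗ c s)) (trans (cong head eq) (head-in⅋ c′ (φ (par , c′))))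
    arc-injective {φ} {(par , c) , _} {(tensor , c′) , s′} (parA _) (tensA _) eq
      with () ← trans (sym (head-in⅋ c (φ (par , c)))) (trans (cong head eq) (head-in⊗ c′ s′))
    arc-injective {φ} {(par , c) , _} {(par , c′) , _} (parA _) (parA _) eq
      with refl ← into-⅋-injective {c = c} {c′}
                    (trans (sym (head-in⅋ c (φ (par , c)))) (trans (cong head eq) (head-in⅋ c′ (φ (par , c′))))) = refl

    node : C → SwitchingNode R
    node c = inj₁ (cell c)

  -- Distinct active edges are distinct arcs of the switching graph, so a walk around an edge would
  -- be a walk around an arc, against `bridge`.
  edges-acyclic : Acyclic
  edges-acyclic φ e a w = Switched.bridge (restrict φ) (acyclicᴳ (restrict φ)) (arc a)
    (subst₂ (EqClosure _) (cong node (sym (arc-tail a))) (sym (arc-head a)) (Eq.gmap node link w))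
    where
    link : ∀ {u v} → Link (λ e′ → Active φ e′ × e′ ≢ e) u v → _
    link (e′ , (a′ , ne) , refl , refl) =
      arc a′ , (λ eq → ne (arc-injective a′ a eq)) , cong node (arc-tail a′) , arc-head a′

  no-cut : ∀ c → label c ≢ cut
  no-cut (cut , c) refl = cutFree c

  module Wk = Weakening _≟_ label pre edges-acyclic elements unique complete no-cut
  open Wk public using (W; w-bot; w-par)

  W-type : ∀ {c} → W c → ∀ {a} → tail a ≡ c → KindE (type a)
  W-type {bot , _} (w-bot refl) e = subst KindE (sym (bot-type e)) ⊥
  W-type {par , c} (w-par refl h) e =
    subst KindE (sym (⅋-type (head-in⅋ c left) (head-in⅋ c right) e))
      (W-type (h left) refl ⅋ W-type (h right) refl)

  tensor-¬W : ∀ {c} → label c ≡ tensor → ∀ s → ¬ W (pre c s)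
  tensor-¬W {tensor , c} refl s w = tensor-¬KindE c s (W-type w refl)

  W-head : ∀ {p c d} → W p → p ⇓ c → p ⇓ d → c ≡ d
  W-head w h h′ with ⇓-arc h | ⇓-arc h′
  ... | a , refl , s , e | b , e′ , s′ , e″ with single w refl e′
    where
    single : ∀ {p} → W p → ∀ {a b} → tail a ≡ p → tail b ≡ p → a ≡ b
    single {bot , c} (w-bot refl)   = out-unique c refl
    single {par , c} (w-par refl _) = out-unique c refl
  ... | refl = target-injective (trans (sym e) e″)
    where
    target-injective : ∀ {c d : C} {s t} → into {Γ = Γ₀} (proj₂ c) s ≡ into (proj₂ d) t → c ≡ d
    target-injective refl = refl

  module S = Wk.Solid ⇓-wf ⇓-noetherian tensor-¬W W-head

  full : C → Bool
  full = const true

  -- Components are counted in two ways. The forest of cells has as many as sources minus tensors;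
  -- the switching graph, which only adds pendant nodes, has w + 1. Since w of the sources are ⊥
  -- cells, w cancels and the leaves exceed the tensors by one.
  full-balanced : ∀ {w} → HasCardinality (setoid (Cell bot)) w →
                  HasCardinality (Graph.Components (switchingGraph R (const left))) (suc w) →
                  S.Balanced full
  full-balanced {w} bots comps = ℕ.+-cancelʳ-≡ w _ _ (begin
    leaves + w                            ≡⟨ cong (leaves +_) (sym #bots) ⟩
    leaves + length botList               ≡⟨ cong (leaves +_) (sym (count-all botList)) ⟩
    leaves + count (const true) botList   ≡⟨ cong (leaves +_) (count-filter (const true) isBot elements) ⟩
    leaves + count (λ c → isBot c ∧ true) elements
                                          ≡⟨ sym (count-split (isSource ∘ kind) _ _ elements λ c _ → lem c) ⟩
    F.#source elements                    ≡⟨ proj₂ result ⟩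
    F.#tens elements + length reps        ≡⟨ cong (F.#tens elements +_) #reps ⟩
    F.#tens elements + suc w              ≡⟨ +-suc (F.#tens elements) w ⟩
    suc (F.#tens elements) + w            ∎)
    where
    open ≡-Reasoning
    φ : C → Side
    φ = const left
    module F = UnionFind _≟_ kind pre
    leaves = count (isLeaf ∘ label) elements
    isBot : C → Bool
    isBot (bot , _) = true
    isBot _         = false
    lem : ∀ c → toℕᵇ (isSource (kind c)) ≡ toℕᵇ (isLeaf (label c)) + toℕᵇ (isBot c ∧ true)
    lem (ax , _)     = refl
    lem (cut , c)    = contradiction c cutFree
    lem (one , _)    = refl
    lem (bot , _)    = refl
    lem (tensor , _) = refl
    lem (par , _)    = refl
    botList = filterᵇ isBot elements
    isBot⁻ : ∀ c → isBot c ≡ true → ∃ λ b → c ≡ (bot , b)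
    isBot⁻ (bot , b) _ = b , refl
    unbot : ∀ {c} → c ∈ botList → ∃ λ b → c ≡ (bot , b)
    unbot {c} c∈ = isBot⁻ c (proj₂ (∈-filterᵇ⁻ isBot elements c∈))
    unbot-injective : ∀ {c d} (i : c ∈ botList) (j : d ∈ botList) → proj₁ (unbot i) ≡ proj₁ (unbot j) → c ≡ d
    unbot-injective i j e = trans (proj₂ (unbot i)) (trans (cong (bot ,_) e) (sym (proj₂ (unbot j))))
    module B = Inverse bots
    #bots : length botList ≡ w
    #bots = ℕ.≤-antisym
      (length-≤ (filterᵇ-unique isBot unique) (B.to ∘ proj₁ ∘ unbot) λ i j e → unbot-injective i j
        (trans (sym (B.strictlyInverseʳ _)) (trans (cong B.from e) (B.strictlyInverseʳ _))))
      (length-≥ (λ k → bot , B.from k) (λ k → ∈-filterᵇ⁺ isBot (complete _) refl) λ e →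
        trans (sym (B.strictlyInverseˡ _)) (trans (cong B.to (bot-injective e)) (B.strictlyInverseˡ _)))
      where
      bot-injective : ∀ {b b′ : Cell bot} → _≡_ {A = C} (bot , b) (bot , b′) → b ≡ b′
      bot-injective refl = refl
    result = F.componentsOf edges-acyclic φ unique [] unique λ _ _ → complete _
    open F.Components (proj₁ result)
    module K = Inverse comps
    Gr = switchingGraph R (const left)
    -- Every node of the switching graph that is not a cell is pendant.
    anchor : SwitchingNode R → C
    anchor (inj₁ (cell c)) = c
    anchor (inj₁ (• i))    = tail (in• (_ , i))
    -- The switching is constantly `left`, so it is the right premise that is redirected to the
    -- fresh • node.
    anchor (inj₂ c)        = tail (in⅋ c right)
    anchored : ∀ a t → head a ≡ t → Conn (Active φ) (tail a) (anchor (switchTarget R (const left) t))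
    anchored a (into c cut-in)         e = contradiction c cutFree
    anchored a (into c (⊗-in s))       e rewrite in⊗-unique e = down (tensA refl)
    anchored a (into c (⅋-in left))    e rewrite in⅋-unique e = down (parA refl)
    anchored a (into c (⅋-in right))   e rewrite in⅋-unique e = ε
    anchored a (• i)                   e rewrite in•-unique e = ε
    project : ∀ {u v} → EqClosure (Graph.Arrow Gr) u v → Conn (Active φ) (anchor u) (anchor v)
    project = Eq.gfold (Eq.isEquivalence _) anchor λ { (a , refl , refl) → anchored a (head a) refl }
    anchor-conn : ∀ u → EqClosure (Graph.Arrow Gr) u (node (anchor u))
    anchor-conn (inj₁ (cell c)) = ε
    anchor-conn (inj₁ (• i)) =
        Eq.symmetric _ (Eq.return (_ , refl , cong (switchTarget R (const left)) (head-in• i)))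
    anchor-conn (inj₂ c) = Eq.symmetric _ (Eq.return (_ , refl , cong (switchTarget R (const left)) (head-in⅋ c right)))
    inject : ∀ {c d} → Conn (Active φ) c d → EqClosure (Graph.Arrow Gr) (node c) (node d)
    inject = Eq.gmap node λ { (e , a , refl , refl) → arc a , cong node (arc-tail a) , arc-head a }
    respects-conn : ∀ {u v} → Conn (Active φ) u v → find-rep u ≡ find-rep v
    respects-conn = Eq.gfold isEquivalence find-rep λ { (e , a , refl , refl) → respects (∈edges a) }
      where
      ∈edges : ∀ {c s} → Active φ (c , s) → (c , s) ∈ F.edges φ elements
      ∈edges {c} a = go elements (complete c) a
        where
        edgesOf∋ : ∀ {c s} → Active φ (c , s) → (c , s) ∈ F.edgesOf φ c (kind c)
        edgesOf∋ {c} {left}  (tensA k) rewrite k = here refl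
        edgesOf∋ {c} {right} (tensA k) rewrite k = there (here refl)
        edgesOf∋ {c}         (parA k)  rewrite k = here refl
        go : ∀ {c s} cs → c ∈ cs → Active φ (c , s) → (c , s) ∈ F.edges φ cs
        go (c ∷ cs) (here refl) a = ∈-++⁺ˡ (edgesOf∋ a)
        go (c ∷ cs) (there i)   a = ∈-++⁺ʳ (F.edgesOf φ c (kind c)) (go cs i a)
    component-injective : ∀ {u v} → K.to u ≡ K.to v → EqClosure (Graph.Arrow Gr) u v
    component-injective {u} {v} e = Setoid.trans S (Setoid.sym S (K.strictlyInverseʳ u))
      (Setoid.trans S (Setoid.reflexive S (cong K.from e)) (K.strictlyInverseʳ v))
      where S = Graph.Components Gr
    rep-of : Fin (suc w) → C
    rep-of k = find-rep (anchor (K.from k))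
    rep-of-conn : ∀ k → EqClosure (Graph.Arrow Gr) (K.from k) (node (rep-of k))
    rep-of-conn k = Setoid.trans S (anchor-conn (K.from k))
      (inject (conn-mono (λ e∈ → proj₂ (F.∈edges⁻ φ elements e∈)) (connected _)))
      where S = Graph.Components Gr
    #reps : length reps ≡ suc w
    #reps = ℕ.≤-antisym
      (length-≤ (F.Components.unique (proj₁ result)) (λ {c} _ → K.to (node c)) λ {c} {d} i j e →
        trans (sym (fixed i)) (trans (respects-conn (project (component-injective e))) (fixed j)))
      (length-≥ rep-of (λ k → rep∈ (complete _)) λ {j} {k} e →
        trans (sym (K.strictlyInverseˡ j))
          (trans (K.to-cong (Setoid.trans S (rep-of-conn j)
            (Setoid.trans S (Setoid.reflexive S (cong node e)) (Setoid.sym S (rep-of-conn k)))))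
            (K.strictlyInverseˡ k)))
      where S = Graph.Components Gr

  open S using (UpClosed; Balanced; TerminalIn; leaves; tensors; head?)
  open Listings type
  open Embeddings atoms

  -- Parts of the net and their conclusions

  exits : (C → Bool) → Target Cell Γ₀ → Bool
  exits X (into {l} c _) = not (X (l , c))
  exits X (• _)          = true

  -- The arcs that become conclusions of the proof of this part, whether they end at a • node or at
  -- a cell outside `X`.
  border : (C → Bool) → Arc → Bool
  border X a = X (tail a) ∧ exits X (head a)

  border⁺ : ∀ X {a} → X (tail a) ≡ true →
            (∀ {l} {c : Cell l} {s} → head a ≡ into c s → X (l , c) ≡ false) → border X a ≡ true
  border⁺ X {a} Xa h = cong₂ _∧_ Xa (go (head a) h)
    where
    go : ∀ t → (∀ {l} {c : Cell l} {s} → t ≡ into c s → X (l , c) ≡ false) → exits X t ≡ true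
    go (into c s) h = not-true (h refl)
    go (• _)      _ = refl

  border-tail : ∀ X {a} → border X a ≡ true → X (tail a) ≡ true
  border-tail X e = ∧-conicalˡ _ _ e

  border-exit : ∀ X {a l} {c : Cell l} {s} → border X a ≡ true → head a ≡ into c s → X (l , c) ≡ false
  border-exit X {a} b e = not-true⁻ (subst (λ t → exits X t ≡ true) e (∧-conicalʳ (X (tail a)) _ b))

  Boundary : (C → Bool) → (Γ : Sequent) → (Pos Γ → Arc) → Set
  Boundary X Γ g = Listing Γ g (λ a → border X a ≡ true)

  Sequentializes : (C → Bool) → (Γ : Sequent) → (Pos Γ → Arc) → Set
  Sequentializes X Γ g = Σ (Proof [¬⊥⊗]LL Γ) λ π → Embeds R (π °) X g

  -- Stated for all orderings of the conclusions, so that the induction hypothesis can be used with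
  -- the active formulae where a rule expects them.
  Sequentializable : (C → Bool) → Set
  Sequentializable X = ∀ {Γ g} → Boundary X Γ g → Sequentializes X Γ g

  -- One ordering of the conclusions suffices, by the exchange rule.
  reordered : ∀ {X Γ g} → Boundary X Γ g → Sequentializes X Γ g → Sequentializable X
  reordered B (π , E) B′ with reorder B′ B
  ... | σ , e = exchange σ π , embeds-exchange R σ e E

  selected : (q : Arc → Bool) →
             Listing (map type (filterᵇ q A.elements)) (at (filterᵇ q A.elements)) (λ a → q a ≡ true)
  selected = listing-filter A.unique A.complete

  except : (C → Bool) → Arc → Arc → Bool
  except X b a = border X a ∧ not (does (a A.≟ b))

  except⁺ : ∀ X {a b} → border X a ≡ true → a ≢ b → except X b a ≡ true
  except⁺ X {a} {b} e ne = cong₂ _∧_ e (cong not (dec-false (a A.≟ b) ne))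

  except⁻ : ∀ X {a b} → except X b a ≡ true → border X a ≡ true × a ≢ b
  except⁻ X {a} {b} e = ∧-conicalˡ _ _ e , dec-false⁻ (a A.≟ b) (not-true⁻ (∧-conicalʳ (border X a) _ e))

  _─_ : (C → Bool) → C → C → Bool
  _─_ = _∖_ R _≟_

  ─⁺ : ∀ X {c d} → X d ≡ true → d ≢ c → (X ─ c) d ≡ true
  ─⁺ = ∖⁺ R _≟_

  ─⁻ : ∀ X {c d} → (X ─ c) d ≡ true → X d ≡ true × d ≢ c
  ─⁻ = ∖⁻ R _≟_

  module Removal (X : C → Bool) (closed : UpClosed X) (balanced : Balanced X)
                 {c : C} (Xc : X c ≡ true) (terminal : TerminalIn X c) where

    smaller : count (X ─ c) elements < count X elements
    smaller = count-mono-< elements (λ _ _ e → proj₁ (─⁻ X e)) (complete c)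
                (≢true⇒≡false λ e → proj₂ (─⁻ X e) refl) Xc

    ─-closed : UpClosed (X ─ c)
    ─-closed {d} k≢ e s with ─⁻ X e
    ... | Xd , d≢ = ─⁺ X (closed k≢ Xd s) λ e′ → terminal d Xd (k≢ , s , e′)

    count-─ : ∀ (p : C → Bool) → p c ≡ false →
              count (λ d → (X ─ c) d ∧ p d) elements ≡ count (λ d → X d ∧ p d) elements
    count-─ p pc = count-cong elements λ d _ → lem d
      where
      lem : ∀ d → (X ─ c) d ∧ p d ≡ X d ∧ p d
      lem d with d ≟ c
      ... | yes refl rewrite Xc | pc = refl
      ... | no _ with X d
      ...   | true  = refl
      ...   | false = refl

    ─-balanced : isLeaf (label c) ≡ false → isTens (kind c) ≡ false → Balanced (X ─ c)
    ─-balanced l t = trans (count-─ (isLeaf ∘ label) l)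
                       (trans balanced (cong suc (sym (count-─ (isTens ∘ kind) t))))

    exits-border : ∀ {a} → tail a ≡ c → border X a ≡ true
    exits-border {a} refl = border⁺ X Xc λ {l} {d} e →
      ≢true⇒≡false λ Xd → terminal (l , d) Xd (head-⇓ e)

    remains : ∀ {a} → border X a ≡ true → tail a ≢ c → border (X ─ c) a ≡ true
    remains b ne = border⁺ (X ─ c) (─⁺ X (border-tail X b) ne) λ e →
      ≢true⇒≡false λ Xd → true≢false (trans (sym (proj₁ (─⁻ X Xd))) (border-exit X b e))

    premise-border : ∀ {a s} → head a ≡ into (proj₂ c) s → border (X ─ c) a ≡ true
    premise-border {a} e = border⁺ (X ─ c) (─⁺ X Xa λ e′ → terminal c Xc (subst (_⇓ c) e′ a⇓c))
      λ { {l} {d} e′ → ≢true⇒≡false λ Xd → proj₂ (─⁻ X {c} {l , d} Xd) (target-injective (trans (sym e′) e)) }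
      where
      a⇓c = head-⇓ e
      Xa : X (tail a) ≡ true
      Xa = let (k≢ , s , e″) = a⇓c in subst (λ d → X d ≡ true) e″ (closed k≢ Xc s)
      target-injective : ∀ {d d′ : C} {s t} → into {Γ = Γ₀} (proj₂ d) s ≡ into (proj₂ d′) t → d ≡ d′
      target-injective refl = refl

    -- Removing `c` uncovers nothing but its premises. With `remains` and `premise-border` this
    -- determines the conclusions of the smaller part.
    remaining : ∀ {a} → border (X ─ c) a ≡ true →
                (border X a ≡ true × tail a ≢ c) ⊎ Σ (Slot (label c)) λ s → head a ≡ into (proj₂ c) s
    remaining {a} b with ─⁻ X (border-tail (X ─ c) b) | bool-cases (border X a)
    ... | Xa , ne | inj₁ e = inj₁ (e , ne)
    ... | Xa , ne | inj₂ e = inj₂ (go (head a) refl)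
      where
      go : ∀ t → head a ≡ t → Σ (Slot (label c)) λ s → head a ≡ into (proj₂ c) s
      go (• i) h = contradiction (trans (sym (border⁺ X Xa λ e′ → contradiction (trans (sym h) e′) λ ())) e) true≢false
      go (into {l} d s) h with (l , d) ≟ c
      ... | yes refl = s , h
      ... | no d≢ = contradiction (trans (sym (border⁺ X Xa out-d)) e) true≢false
        where
        out-d : ∀ {l} {d′ : Cell l} {s} → head a ≡ into d′ s → X (l , d′) ≡ false
        out-d h′ with refl ← trans (sym h) h′ = ≢true⇒≡false λ Xd →
          true≢false (trans (sym (─⁺ X Xd d≢)) (border-exit (X ─ c) b h))

    module Enumerated {d} (tail-d : tail d ≡ c) (unique-d : ∀ {a} → tail a ≡ c → a ≡ d) where

      Γ = map type (filterᵇ (except X d) A.elements)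
      g = at (filterᵇ (except X d) A.elements)

      tail≢ : ∀ {a} → a ≢ d → tail a ≢ c
      tail≢ ne e = ne (unique-d e)

      boundary : ∀ {B} → type d ≡ B → Boundary X (Γ ++ B ∷ []) (g ⊕ (d ◂ nil))
      boundary type-d = listing-cong
        (λ { (inj₁ e) → proj₁ (except⁻ X e) ; (inj₂ refl) → exits-border tail-d })
        to (listing-append (selected _) (listing-singleton type-d)
             λ { e refl → proj₂ (except⁻ X e) refl })
        where
        to : ∀ {a} → border X a ≡ true → except X d a ≡ true ⊎ a ≡ d
        to {a} b with a A.≟ d
        ... | yes e = inj₂ e
        ... | no ne = inj₁ (subst (λ x → x ∧ true ≡ true) (sym b) refl)

  ⊥-case : ∀ X (closed : UpClosed X) (balanced : Balanced X) {b} → X (bot , b) ≡ true →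
           TerminalIn X (bot , b) → Sequentializable (X ─ (bot , b)) → Sequentializable X
  ⊥-case X closed balanced {b} Xb terminal ih with out b refl
  ... | d , tail-d = reordered (boundary (bot-type tail-d))
        (⊥-rule Γ (inj₂ ⊥) (proj₁ sub) , embeds-⊥ R _≟_ Xb tail-d unique-d (bot-type tail-d) (proj₂ sub))
    where
    open Removal X closed balanced Xb terminal
    unique-d : ∀ {a} → tail a ≡ (bot , b) → a ≡ d
    unique-d e = out-unique b refl e tail-d
    open Enumerated tail-d unique-d
    sub : Sequentializes (X ─ (bot , b)) Γ g
    sub = ih (listing-cong (λ e → let (b , ne) = except⁻ X e in remains b (tail≢ ne)) from (selected _))
      where
      from : ∀ {a} → border (X ─ (bot , b)) a ≡ true → except X d a ≡ true
      from e with remaining e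
      ... | inj₁ (b , ne) = except⁺ X b λ { refl → ne tail-d }
      ... | inj₂ (() , _)

  ⅋-case : ∀ X (closed : UpClosed X) (balanced : Balanced X) {n} → X (par , n) ≡ true →
           TerminalIn X (par , n) → Sequentializable (X ─ (par , n)) → Sequentializable X
  ⅋-case X closed balanced {n} Xn terminal ih with out n refl
  ... | d , tail-d = reordered (boundary type-d)
        (⅋-rule Γ _ _ (subst [¬⊥⊗]LL type-d (inFragment d)) (proj₁ sub) ,
         embeds-⅋ R _≟_ {l = l} {r} Xn tail-d unique-d type-d (head-in⅋ n left) (head-in⅋ n right) (proj₂ sub))
    where
    open Removal X closed balanced Xn terminal
    l = in⅋ n left
    r = in⅋ n right
    type-d : type d ≡ type l ⅋ type r
    type-d = ⅋-type (head-in⅋ n left) (head-in⅋ n right) tail-d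
    unique-d : ∀ {a} → tail a ≡ (par , n) → a ≡ d
    unique-d e = out-unique n refl e tail-d
    open Enumerated tail-d unique-d
    l≢r : l ≢ r
    l≢r e with () ← trans (sym (head-in⅋ n left)) (trans (cong head e) (head-in⅋ n right))
    inside : ∀ s → ¬ except X d (in⅋ n s) ≡ true
    inside s e = true≢false (trans (sym Xn) (border-exit X (proj₁ (except⁻ X e)) (head-in⅋ n s)))
    sub : Sequentializes (X ─ (par , n)) (Γ ++ type l ∷ type r ∷ []) (g ⊕ (l ◂ r ◂ nil))
    sub = ih (listing-cong
        (λ { (inj₁ e) → let (b , ne) = except⁻ X e in remains b (tail≢ ne)
           ; (inj₂ (inj₁ refl)) → premise-border (head-in⅋ n left)
           ; (inj₂ (inj₂ refl)) → premise-border (head-in⅋ n right) })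
        from
        (listing-append (selected _)
          (listing-cons refl l≢r (listing-singleton refl))
          λ { e (inj₁ refl) → inside left e ; e (inj₂ refl) → inside right e }))
      where
      from : ∀ {a} → border (X ─ (par , n)) a ≡ true → except X d a ≡ true ⊎ (a ≡ l ⊎ a ≡ r)
      from e with remaining e
      ... | inj₁ (b , ne) = inj₁ (except⁺ X b λ { refl → ne tail-d })
      ... | inj₂ (⅋-in left , h) = inj₂ (inj₁ (in⅋-unique h))
      ... | inj₂ (⅋-in right , h) = inj₂ (inj₂ (in⅋-unique h))

  module TensorCase (X : C → Bool) (closed : UpClosed X) (balanced : Balanced X) (split : S.Split X)
                    (ih : ∀ b → Sequentializable (S.Halves.half closed balanced split b)) where

    open S.Split split
    open S.Halves closed balanced split

    result : ∀ n → t ≡ (tensor , n) → Sequentializable X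
    result n refl with out n refl
    ... | d , tail-d = reordered boundary
        (⊗-rule Γ _ _ (subst [¬⊥⊗]LL type-d (inFragment d)) (proj₁ subˡ) (proj₁ subʳ) ,
         embeds-⊗ R _≟_ {l = l} {r} t∈ tail-d unique-d type-d (head-in⊗ n left) (head-in⊗ n right)
           (λ h → let (Xc , ne , _) = half⁻ h in Xc , ne) (λ h → let (Xc , ne , _) = half⁻ h in Xc , ne)
           (λ h h′ → contradiction (trans (sym (proj₂ (proj₂ (half⁻ h)))) (proj₂ (proj₂ (half⁻ h′)))) true≢false)
           (λ {c} Xc ne → cover Xc ne (bool-cases (τ c)))
           (proj₂ subˡ) (proj₂ subʳ))
      where
      l = in⊗ n left
      r = in⊗ n right
      cover : ∀ {c} → X c ≡ true → c ≢ t → τ c ≡ true ⊎ τ c ≡ false → half true c ≡ true ⊎ half false c ≡ true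
      cover Xc ne (inj₁ e) = inj₁ (half⁺ Xc ne e)
      cover Xc ne (inj₂ e) = inj₂ (half⁺ Xc ne e)
      type-d : type d ≡ type l ⊗ type r
      type-d = ⊗-type (head-in⊗ n left) (head-in⊗ n right) tail-d
      unique-d : ∀ {a} → tail a ≡ (tensor , n) → a ≡ d
      unique-d e = out-unique n refl e tail-d
      Γ = map type (filterᵇ (except (half true) l) A.elements)
      g = at (filterᵇ (except (half true) l) A.elements)
      Δ = map type (filterᵇ (except (half false) r) A.elements)
      h = at (filterᵇ (except (half false) r) A.elements)
      t∉half : ∀ {b} → half b t ≡ false
      t∉half = ≢true⇒≡false λ e → proj₁ (proj₂ (half⁻ e)) refl
      premise-border : ∀ {b} s → τ (pre t s) ≡ b → border (half b) (in⊗ n s) ≡ true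
      premise-border {b} s e = border⁺ (half b) (premise∈ s e) λ h → exit (trans (sym h) (head-in⊗ n s))
        where
        exit : ∀ {l} {c : Cell l} {s s′} → into {Γ = Γ₀} c s ≡ into n (⊗-in s′) → half b (l , c) ≡ false
        exit refl = t∉half
      -- By `uniform`, an arc from a half to a cell of `X` other than `t` stays in that half. So
      -- only a premise of `t` can leave the half without leaving `X`.
      leaves-X : ∀ {b a} → border (half b) a ≡ true → (∀ s → τ (pre t s) ≡ b → a ≢ in⊗ n s) → border X a ≡ true
      leaves-X {b} {a} e ne with half⁻ (border-tail (half b) e)
      ... | Xa , _ , τa = border⁺ X Xa λ h → ≢true⇒≡false (stays h)
        where
        stays : ∀ {l} {c : Cell l} {s} → head a ≡ into c s → X (l , c) ≢ true
        stays {l} {c} {⊗-in s} h Xc with (l , c) ≟ t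
        ... | yes refl = ne s (trans (cong τ (cong tail (sym (in⊗-unique h)))) τa) (in⊗-unique h)
        ... | no c≢ = true≢false (trans (sym (half⁺ Xc c≢ (trans (sym (uniform Xc (λ ()) c≢ s))
                        (trans (cong τ (cong tail (sym (in⊗-unique h)))) τa)))) (border-exit (half b) e h))
        stays {l} {c} {⅋-in s} h Xc =
          true≢false (trans (sym (half⁺ Xc (λ ()) (trans (sym (uniform Xc (λ ()) (λ ()) s))
            (trans (cong τ (cong tail (sym (in⅋-unique h)))) τa)))) (border-exit (half b) e h))
        stays {c = c} {cut-in} h Xc = cutFree c
      border-half : ∀ {b a} → border X a ≡ true → tail a ≢ t → τ (tail a) ≡ b → border (half b) a ≡ true
      border-half {b} e ne τa = border⁺ (half b) (half⁺ (border-tail X e) ne τa) λ h →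
        ≢true⇒≡false λ e′ → true≢false (trans (sym (proj₁ (half⁻ e′))) (border-exit X e h))
      d-border : border X d ≡ true
      d-border = border⁺ X (trans (cong X tail-d) t∈) λ {l} {c} e →
        ≢true⇒≡false λ Xc → terminal (l , c) Xc (subst (_⇓ (l , c)) tail-d (head-⇓ e))
      not-premise : ∀ {a} s → border X a ≡ true → a ≢ in⊗ n s
      not-premise s e refl = true≢false (trans (sym t∈) (border-exit X e (head-in⊗ n s)))
      ≢-by-side : ∀ {a b} {s : Side} → except (half b) (in⊗ n s) a ≡ true → (∀ s′ → τ (pre t s′) ≡ b → s′ ≡ s) →
                  border X a ≡ true
      ≢-by-side {a} {b} {s} e only = let (be , ne) = except⁻ (half b) e in
        leaves-X be λ s′ τs′ → subst (λ x → a ≢ in⊗ n x) (sym (only s′ τs′)) ne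
      only-left : ∀ s → τ (pre t s) ≡ true → s ≡ left
      only-left left  _ = refl
      only-left right e = contradiction (trans (sym e) τ-right) true≢false
      only-right : ∀ s → τ (pre t s) ≡ false → s ≡ right
      only-right left  e = contradiction (trans (sym τ-left) e) true≢false
      only-right right _ = refl
      subˡ : Sequentializes (half true) (Γ ++ type l ∷ []) (g ⊕ (l ◂ nil))
      subˡ = ih true (listing-cong
          (λ { (inj₁ e) → proj₁ (except⁻ (half true) e) ; (inj₂ refl) → premise-border left τ-left })
          from
          (listing-append (selected _) (listing-singleton refl)
            λ { e refl → proj₂ (except⁻ (half true) e) refl }))
        where
        from : ∀ {a} → border (half true) a ≡ true → except (half true) l a ≡ true ⊎ a ≡ l
        from {a} e with a A.≟ l
        ... | yes p = inj₂ p
        ... | no ne = inj₁ (subst (λ x → x ∧ true ≡ true) (sym e) refl)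
      subʳ : Sequentializes (half false) (type r ∷ Δ) (r ◂ h)
      subʳ = ih false (listing-cong
          (λ { (inj₁ refl) → premise-border right τ-right ; (inj₂ e) → proj₁ (except⁻ (half false) e) })
          from
          (listing-cons refl (λ e → proj₂ (except⁻ (half false) e) refl) (selected _)))
        where
        from : ∀ {a} → border (half false) a ≡ true → a ≡ r ⊎ except (half false) r a ≡ true
        from {a} e with a A.≟ r
        ... | yes p = inj₁ p
        ... | no ne = inj₂ (subst (λ x → x ∧ true ≡ true) (sym e) refl)
      boundary : Boundary X (Γ ++ type l ⊗ type r ∷ Δ) (g ⊕ (d ◂ h))
      boundary = listing-cong
          (λ { (inj₁ e) → ≢-by-side e only-left ; (inj₂ (inj₁ refl)) → d-border
             ; (inj₂ (inj₂ e)) → ≢-by-side e only-right })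
          to
          (listing-append (selected _)
            (listing-cons type-d (d∉ {s = right}) (selected _))
            λ { e (inj₁ refl) → d∉ {s = left} e ; e (inj₂ e′) → true≢false (trans
                  (sym (proj₂ (proj₂ (half⁻ (border-tail (half true) (proj₁ (except⁻ (half true) e)))))))
                  (proj₂ (proj₂ (half⁻ (border-tail (half false) (proj₁ (except⁻ (half false) e′))))))) })
        where
        d∉ : ∀ {b s} → ¬ except (half b) (in⊗ n s) d ≡ true
        d∉ {b} e = proj₁ (proj₂ (half⁻ (border-tail (half b) (proj₁ (except⁻ (half b) e))))) tail-d
        to : ∀ {a} → border X a ≡ true →
             except (half true) l a ≡ true ⊎ (a ≡ d ⊎ except (half false) r a ≡ true)
        to {a} e = go (tail a ≟ t) (bool-cases (τ (tail a)))
          where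
          go : Dec (tail a ≡ t) → τ (tail a) ≡ true ⊎ τ (tail a) ≡ false →
               except (half true) l a ≡ true ⊎ (a ≡ d ⊎ except (half false) r a ≡ true)
          go (yes p) _        = inj₂ (inj₁ (unique-d p))
          go (no ne) (inj₁ p) = inj₁ (except⁺ (half true) (border-half e ne p) (not-premise left e))
          go (no ne) (inj₂ p) = inj₂ (inj₂ (except⁺ (half false) (border-half e ne p) (not-premise right e)))

  -- In the absence of ⊗ cells, `Balanced` says that there is exactly one leaf, so the part is a
  -- single axiom or 𝟏.
  leaf-case : ∀ X → Balanced X → (∀ {c} → X c ≡ true → isLeaf (label c) ≡ true) → Sequentializable X
  leaf-case X balanced all-leaves with any? (λ c → X c ≟ᵇ true) elements
  ... | no none = contradiction
        (trans (sym (count-zero _ elements λ c c∈ → cong (_∧ isLeaf (label c)) (≢true⇒≡false λ e → none (lose c∈ e))))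
               balanced) λ ()
  ... | yes some with find some
  ...   | c , _ , Xc = single c Xc only
    where
    no-tensors : tensors X ≡ 0
    no-tensors = count-zero _ elements λ d _ → lem d
      where
      leaf-not-tens : ∀ l → isLeaf l ≡ true → isTens (kindOf l) ≡ false
      leaf-not-tens ax  _ = refl
      leaf-not-tens one _ = refl
      lem : ∀ d → X d ∧ isTens (kind d) ≡ false
      lem d with X d in Xd
      ... | true  = leaf-not-tens (label d) (all-leaves Xd)
      ... | false = refl
    one-leaf : leaves X ≡ 1
    one-leaf = trans balanced (cong suc no-tensors)
    only : ∀ {d} → X d ≡ true → d ≡ c
    only {d} Xd with d ≟ c
    ... | yes e = e
    ... | no ne = contradiction (begin-strict
        1                                                  ≤⟨ count-pos elements (complete c)
                                                                (cong₂ _∧_ (─⁺ X Xc (ne ∘ sym)) (all-leaves Xc)) ⟩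
        count (λ e → (X ─ d) e ∧ isLeaf (label e)) elements <⟨ count-mono-< elements
                                                                (λ e _ h → cong₂ _∧_ (proj₁ (─⁻ X (∧-conicalˡ _ _ h)))
                                                                                     (∧-conicalʳ ((X ─ d) e) _ h))
                                                                (complete d)
                                                                (≢true⇒≡false λ h → proj₂ (─⁻ X (∧-conicalˡ _ _ h)) refl)
                                                                (cong₂ _∧_ Xd (all-leaves Xd)) ⟩
        leaves X                                           ≡⟨ one-leaf ⟩
        1                                                  ∎) (<-irrefl refl)
      where open ≤-Reasoning
    single : ∀ c → X c ≡ true → (∀ {d} → X d ≡ true → d ≡ c) → Sequentializable X
    single (one , n) Xn only with out n refl
    ... | a , tail-a = reordered
          (listing-cong (λ { refl → border⁺ X (trans (cong X tail-a) Xn) exit })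
            (λ e → (out-unique n refl (only (border-tail X e)) tail-a))
            (listing-singleton (one-type tail-a)))
          (𝟏-rule (inj₁ 𝟏) , embeds-𝟏 R Xn only tail-a (λ e → out-unique n refl e tail-a) (one-type tail-a))
      where
      exit : ∀ {l} {c : Cell l} {s} → head a ≡ into c s → X (l , c) ≡ false
      exit {s = s} _ = ≢true⇒≡false λ Xd → case (only Xd) s
        where
        case : ∀ {l} {c : Cell l} → _≡_ {A = C} (l , c) (one , n) → ¬ Slot l
        case refl ()
    single (ax , n) Xn only = reordered
        (listing-cong
          (λ { (inj₁ refl) → border⁺ X (trans (cong X (proj₂ (end zero))) Xn) exit
             ; (inj₂ refl) → border⁺ X (trans (cong X (proj₂ (end (suc zero)))) Xn) exit })
          (λ e → cover (only (border-tail X e)))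
          (listing-cons refl a≢b (listing-singleton type-b)))
        (ax-rule (type a) (inFragment a) (subst [¬⊥⊗]LL type-b (inFragment b)) ,
         embeds-ax R {X = X} Xn only (proj₂ (end zero)) (proj₂ (end (suc zero))) a≢b cover type-b)
      where
      module K = Inverse (conclusions n)
      end : Fin 2 → ∃ λ a → tail a ≡ (ax , n)
      end = K.from
      a = proj₁ (end zero)
      b = proj₁ (end (suc zero))
      conclusion-≡ : ∀ {x y : ∃ λ a → tail a ≡ (ax , n)} → proj₁ x ≡ proj₁ y → x ≡ y
      conclusion-≡ {_ , p} {_ , q} refl = cong (_ ,_) (uip p q)
      a≢b : a ≢ b
      a≢b e with () ← trans (sym (K.strictlyInverseˡ zero))
                        (trans (cong K.to (conclusion-≡ e)) (K.strictlyInverseˡ (suc zero)))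
      cover : ∀ {d} → tail d ≡ (ax , n) → d ≡ a ⊎ d ≡ b
      cover {d} e = go (K.to (d , e)) (cong proj₁ (K.strictlyInverseʳ (d , e)))
        where
        go : ∀ k → proj₁ (end k) ≡ d → d ≡ a ⊎ d ≡ b
        go zero       p = inj₁ (sym p)
        go (suc zero) p = inj₂ (sym p)
      type-b : type b ≡ type a ^⊥
      type-b = ax-type (proj₂ (end zero)) (proj₂ (end (suc zero))) a≢b
      exit : ∀ {d l} {c : Cell l} {s} → head d ≡ into c s → X (l , c) ≡ false
      exit {s = s} _ = ≢true⇒≡false λ Xd → case (only Xd) s
        where
        case : ∀ {l} {c : Cell l} → _≡_ {A = C} (l , c) (ax , n) → ¬ Slot l
        case refl ()
    single (cut , n)    _  _ = contradiction n cutFree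
    single (bot , _)    Xn _ = contradiction (all-leaves Xn) λ ()
    single (tensor , _) Xn _ = contradiction (all-leaves Xn) λ ()
    single (par , _)    Xn _ = contradiction (all-leaves Xn) λ ()

  terminal? : (q : Label → Bool) (X : C → Bool) →
              Dec (∃ λ c → q (label c) ≡ true × X c ≡ true × TerminalIn X c)
  terminal? q X = map′ (λ (c , _ , p , Xc , t) → c , p , Xc , λ d Xd h → t (d , Xd , h))
    (λ (c , p , Xc , t) → c , complete c , p , Xc , λ (d , Xd , h) → t d Xd h)
    (some? elements λ c → q (label c) ≟ᵇ true ×-dec X c ≟ᵇ true ×-dec ¬? (head? X c))

  isBotOrPar : Label → Bool
  isBotOrPar bot = true
  isBotOrPar par = true
  isBotOrPar _   = false

  -- Terminal ⊥ and ⅋ cells are treated first because splitting presupposes that none is left: only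
  -- then does every cell of `W` have a cell outside `W` below it, and every descent from a ⅋ end at
  -- a ⊗.
  sequentialize : ∀ n X → count X elements < n → UpClosed X → Balanced X → Sequentializable X
  sequentialize (suc n) X bound closed balanced with terminal? isBotOrPar X
  ... | yes ((bot , b) , _ , Xb , terminal) =
        ⊥-case X closed balanced Xb terminal
          (sequentialize n _ (<-≤-trans smaller (≤-pred bound)) ─-closed (─-balanced refl refl))
    where open Removal X closed balanced Xb terminal
  ... | yes ((par , b) , _ , Xb , terminal) =
        ⅋-case X closed balanced Xb terminal
          (sequentialize n _ (<-≤-trans smaller (≤-pred bound)) ─-closed (─-balanced refl refl))
    where open Removal X closed balanced Xb terminal
  ... | no ¬bot/par with terminal? (isTens ∘ kindOf) X
  ...   | yes ((tensor , t) , _ , Xt , terminal) =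
          divide (S.splitting X closed balanced ¬terminal Xt refl terminal)
    where
    ¬terminal : ∀ {c} → X c ≡ true → label c ≡ bot ⊎ label c ≡ par → ¬ TerminalIn X c
    ¬terminal {bot , _} Xc (inj₁ refl) t = ¬bot/par (_ , refl , Xc , t)
    ¬terminal {par , _} Xc (inj₂ refl) t = ¬bot/par (_ , refl , Xc , t)
    divide : S.Split X → Sequentializable X
    divide split = go _ t⊗ refl
      where
      open S.Split split using (t⊗; t∈)
      open S.Halves closed balanced split
      smaller : ∀ b → count (half b) elements < n
      smaller b = <-≤-trans (count-mono-< elements (λ _ _ e → proj₁ (half⁻ e)) (complete (S.Split.t split))
        (≢true⇒≡false λ e → proj₁ (proj₂ (half⁻ e)) refl) t∈) (≤-pred bound)
      go : ∀ c → label c ≡ tensor → S.Split.t split ≡ c → Sequentializable X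
      go (tensor , m) refl e = TensorCase.result X closed balanced split
        (λ b → sequentialize n (half b) (smaller b) (half-upClosed b) (half-balanced b)) m e
  ...   | no ¬tensor = leaf-case X balanced λ {c} Xc → leaf c Xc (⇓-noetherian c)
    where
    classify : ∀ l → l ≢ cut → isLeaf l ≡ true ⊎ (isBotOrPar l ≡ true ⊎ isTens (kindOf l) ≡ true)
    classify ax     _ = inj₁ refl
    classify one    _ = inj₁ refl
    classify cut    h = contradiction refl h
    classify bot    _ = inj₂ (inj₁ refl)
    classify par    _ = inj₂ (inj₁ refl)
    classify tensor _ = inj₂ (inj₂ refl)
    leaf⇒source : ∀ l → isLeaf l ≡ true → kindOf l ≡ source
    leaf⇒source ax  _ = refl
    leaf⇒source one _ = refl
    leaf : ∀ c → X c ≡ true → Acc (λ d c → c ⇓ d) c → isLeaf (label c) ≡ true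
    leaf c Xc (acc rec) with head? X c | classify (label c) (no-cut c)
    ... | _ | inj₁ e = e
    -- By induction the cell below would be a leaf, yet leaves have no premise. Hence every cell is
    -- terminal, and being neither ⊥, ⅋ nor ⊗ it is a leaf.
    ... | yes (d , Xd , c⇓d) | _ =
          contradiction (leaf⇒source (label d) (leaf d Xd (rec c⇓d))) (proj₁ c⇓d)
    ... | no none | inj₂ (inj₁ e) = contradiction (c , e , Xc , λ d Xd h → none (d , Xd , h)) ¬bot/par
    ... | no none | inj₂ (inj₂ e) = contradiction (c , e , Xc , λ d Xd h → none (d , Xd , h)) ¬tensor

  whole : Balanced full → SequentializableIn [¬⊥⊗]LL R
  whole balanced with sequentialize _ full ≤-refl (λ _ _ _ → refl) balanced conclusions-listing
    where
    conclusions-listing : Boundary full Γ₀ in•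
    conclusions-listing = record
      { types = λ (_ , i) → •-type (head-in• i)
      ; injective = λ { {_ , i} {_ , j} e → •-injective
          (trans (sym (head-in• i)) (trans (cong head e) (head-in• j))) }
      ; sound = λ (_ , i) → border⁺ full refl λ e → contradiction (trans (sym (head-in• i)) e) λ ()
      ; complete = λ {a} e → go (head a) refl (∧-conicalʳ true _ e) }
      where
      •-injective : ∀ {A B} {i : A ∈ Γ₀} {j : B ∈ Γ₀} → _≡_ {A = Target Cell Γ₀} (• i) (• j) → (A , i) ≡ (B , j)
      •-injective refl = refl
      go : ∀ {a} t → head a ≡ t → exits full t ≡ true → ∃ λ p → in• p ≡ a
      go (• i) h _ = (_ , i) , sym (in•-unique h)
  ... | π , E = π , embeds-all R head-in• E

-- Soundness

-- colour a changes along the arc a and along no other arc, so that no cycle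
-- goes through a.
record Forest (G : Graph) (K : Set) : Set where
  open Graph G
  field
    comp       : Node → K
    base       : K → Node
    comp-base  : ∀ k → comp (base k) ≡ k
    respects   : ∀ a → comp (tail a) ≡ comp (head a)
    connected  : ∀ v → EqClosure Arrow v (base (comp v))
    colour        : Arc → Node → Bool
    colour-others : ∀ {a b} → b ≢ a → colour a (tail b) ≡ colour a (head b)
    colour-self   : ∀ a → colour a (tail a) ≢ colour a (head a)

  -- The colour belonging to the first arc of a cycle changes along this arc, and cannot change back
  -- along the others.
  undirectedAcyclic : UndirectedAcyclic
  undirectedAcyclic c with UndirectedCycle.distinctArcs c
  ... | a∉ ∷ _ = crossing (UndirectedCycle.step c) (along (UndirectedCycle.walk c) (All¬⇒¬Any a∉))
    where
    along : ∀ {a u v} (w : EqClosure Arrow u v) → a ∉ arcs w → colour a u ≡ colour a v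
    along ε _ = refl
    along (fwd (b , refl , refl) ◅ w) a∉ =
      trans (colour-others λ { refl → a∉ (here refl) }) (along w (a∉ ∘ there))
    along (bwd (b , refl , refl) ◅ w) a∉ =
      trans (sym (colour-others λ { refl → a∉ (here refl) })) (along w (a∉ ∘ there))
    crossing : ∀ {u v} (s : SymClosure Arrow u v) → colour (arcOf s) v ≢ colour (arcOf s) u
    crossing (fwd (a , refl , refl)) = colour-self a ∘ sym
    crossing (bwd (a , refl , refl)) = colour-self a

  respects-walk : ∀ {u v} → EqClosure Arrow u v → comp u ≡ comp v
  respects-walk = Eq.gfold isEquivalence comp λ { (a , refl , refl) → respects a }

  components : Inverse Components (setoid K)
  components = record
    { to = comp
    ; from = base
    ; to-cong = respects-walk
    ; from-cong = λ { refl → ε }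
    ; inverse = (λ {k} w → trans (respects-walk w) (comp-base k))
              , λ { {v} refl → Eq.symmetric _ (connected v) } }

relabel : ∀ {G K L} → K ↔ L → Forest G K → Forest G L
relabel {G} i F = record
  { comp = to ∘ comp ; base = base ∘ from
  ; comp-base = λ k → trans (cong to (comp-base (from k))) (strictlyInverseˡ k)
  ; respects = cong to ∘ respects
  ; connected = λ v → subst (λ k → EqClosure (Graph.Arrow G) v (base k))
                        (sym (strictlyInverseʳ (comp v))) (connected v)
  ; colour = colour ; colour-others = colour-others ; colour-self = colour-self }
  where
  open Forest F
  open Inverse i

module Isomorphic (G H : Graph) where
  private
    module G = Graph G
    module H = Graph H

  transport : ∀ {K} (h : G.Node → H.Node) (k : H.Node → G.Node) →
              (∀ v → h (k v) ≡ v) → (∀ u → k (h u) ≡ u) → (arcs : G.Arc ↔ H.Arc) →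
              (∀ a → H.tail (Inverse.to arcs a) ≡ h (G.tail a)) →
              (∀ a → H.head (Inverse.to arcs a) ≡ h (G.head a)) →
              Forest H K → Forest G K
  transport h k hk kh arcs tails heads F = record
    { comp = comp ∘ h ; base = k ∘ base
    ; comp-base = λ x → trans (cong comp (hk (base x))) (comp-base x)
    ; respects = λ a → trans (cong comp (sym (tails a))) (trans (respects (to a)) (cong comp (heads a)))
    ; connected = λ u → subst (λ x → EqClosure G.Arrow x (k (base (comp (h u))))) (kh u)
                          (Eq.gmap k arrow (connected (h u)))
    ; colour = λ a → colour (to a) ∘ h
    ; colour-others = λ {a} {b} b≢a → trans (cong (colour (to a)) (sym (tails b)))
        (trans (colour-others λ e → b≢a (trans (sym (strictlyInverseʳ b)) (trans (cong from e) (strictlyInverseʳ a))))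
               (cong (colour (to a)) (heads b)))
    ; colour-self = λ a e → colour-self (to a)
        (trans (cong (colour (to a)) (tails a)) (trans e (cong (colour (to a)) (sym (heads a))))) }
    where
    open Forest F
    open Inverse arcs
    arrow : ∀ {u v} → H.Arrow u v → G.Arrow (k u) (k v)
    arrow (b , refl , refl) = from b , end tails , end heads
      where
      end : ∀ {e : H.Arc → H.Node} {f : G.Arc → G.Node} → (∀ a → e (to a) ≡ h (f a)) → f (from b) ≡ k (e b)
      end {e} p = trans (sym (kh _)) (cong k (trans (sym (p (from b))) (cong e (strictlyInverseˡ b))))

module Isolated (G : Graph) where
  open Graph G

  withPoint : Graph
  withPoint = record { Node = Node ⊎ ⊤ ; Arc = Arc ; tail = inj₁ ∘ tail ; head = inj₁ ∘ head }

  forest : ∀ {K} → Forest G K → Forest withPoint (Fin 1 ⊎ K)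
  forest F = record
    { comp = λ { (inj₁ v) → inj₂ (comp v) ; (inj₂ _) → inj₁ zero }
    ; base = λ { (inj₁ _) → inj₂ tt ; (inj₂ k) → inj₁ (base k) }
    ; comp-base = λ { (inj₁ zero) → refl ; (inj₂ k) → cong inj₂ (comp-base k) }
    ; respects = λ a → cong inj₂ (respects a)
    ; connected = λ { (inj₁ v) → Eq.gmap inj₁ (λ (a , p , q) → a , cong inj₁ p , cong inj₁ q) (connected v)
                    ; (inj₂ tt) → ε }
    ; colour = λ a → [ colour a , const true ]′
    ; colour-others = colour-others
    ; colour-self = colour-self }
    where open Forest F

-- A new node attached to the node p by a new arc.
module Pendant (G : Graph) (p : Graph.Node G)
  (N : Set) (t h : Graph.Arc G ⊎ ⊤ → N) (ι : Graph.Node G → N) (new : N)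
  -- The node set is presented by an inclusion, a new node and a case analysis, since the actual
  -- nodes of a switching graph are not literally a sum with one point.
  (elim : ∀ {T : Set} → (Graph.Node G → T) → T → N → T)
  (elim-ι : ∀ {T : Set} (f : Graph.Node G → T) x v → elim f x (ι v) ≡ f v)
  (elim-new : ∀ {T : Set} (f : Graph.Node G → T) x → elim f x new ≡ x)
  (cover : ∀ u → (∃ λ v → u ≡ ι v) ⊎ u ≡ new)
  (tails : ∀ a → t (inj₁ a) ≡ ι (Graph.tail G a)) (heads : ∀ a → h (inj₁ a) ≡ ι (Graph.head G a))
  (tail-new : t (inj₂ tt) ≡ ι p) (head-new : h (inj₂ tt) ≡ new)
  where

  private
    module G = Graph G

  graph : Graph
  graph = record { Node = N ; Arc = G.Arc ⊎ ⊤ ; tail = t ; head = h }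

  forest : ∀ {K} → Forest G K → Forest graph K
  forest {K} F = record
    { comp = comp′ ; base = ι ∘ base
    ; comp-base = λ k → trans (elim-ι _ _ _) (comp-base k)
    ; respects = λ { (inj₁ a) → same comp (comp p) a (respects a)
                   ; (inj₂ tt) → trans (cong comp′ tail-new) (trans (elim-ι _ _ _)
                                   (trans (sym (elim-new comp (comp p))) (cong comp′ (sym head-new)))) }
    ; connected = λ u → conn u (cover u)
    ; colour = colour′
    ; colour-others = λ { {inj₁ a} {inj₁ b} b≢a → same (colour a) (colour a p) b (colour-others (b≢a ∘ cong inj₁))
                     ; {inj₁ a} {inj₂ tt} _ → trans (cong (colour′ (inj₁ a)) tail-new) (trans (elim-ι (colour a) _ _)
                                   (trans (sym (elim-new (colour a) (colour a p))) (cong (colour′ (inj₁ a)) (sym head-new))))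
                     ; {inj₂ tt} {inj₁ b} _ → same (const false) true b refl
                     ; {inj₂ tt} {inj₂ tt} ne → contradiction refl ne }
    ; colour-self = λ { (inj₁ a) e → colour-self a (trans (sym (elim-ι _ _ _))
                                    (trans (cong (colour′ (inj₁ a)) (sym (tails a)))
                                    (trans e (trans (cong (colour′ (inj₁ a)) (heads a)) (elim-ι _ _ _)))))
                   ; (inj₂ tt) e → true≢false (trans (sym (elim-new (const false) true))
                                    (trans (cong (colour′ (inj₂ tt)) (sym head-new))
                                    (trans (sym e) (trans (cong (colour′ (inj₂ tt)) tail-new)
                                      (elim-ι (const false) true p))))) } }
    where
    open Forest F
    module G′ = Graph graph
    comp′ : N → K
    comp′ = elim comp (comp p)
    -- Giving the new node the colour of `p` keeps old colourings constant along the new arc. The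
    -- new arc itself is detected by colouring the new node alone.
    colour′ : G.Arc ⊎ ⊤ → N → Bool
    colour′ (inj₁ a)  = elim (colour a) (colour a p)
    colour′ (inj₂ tt) = elim (const false) true
    same : ∀ {T : Set} (f : G.Node → T) x a → f (G.tail a) ≡ f (G.head a) →
           elim f x (t (inj₁ a)) ≡ elim f x (h (inj₁ a))
    same f x a e = trans (cong (elim f x) (tails a)) (trans (elim-ι f x _) (trans e
                     (trans (sym (elim-ι f x _)) (cong (elim f x) (sym (heads a))))))
    old : ∀ v → EqClosure G′.Arrow (ι v) (ι (base (comp v)))
    old v = Eq.gmap ι (λ { (a , refl , refl) → inj₁ a , tails a , heads a }) (connected v)
    conn : ∀ u → (∃ λ v → u ≡ ι v) ⊎ u ≡ new → EqClosure G′.Arrow u (ι (base (comp′ u)))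
    conn _ (inj₁ (v , refl)) rewrite elim-ι comp (comp p) v = old v
    conn _ (inj₂ refl) rewrite elim-new comp (comp p) =
      bwd (inj₂ tt , tail-new , head-new) ◅ old p

-- The node v of G is identified with the node w of H, and a new node is attached
-- to it by a new arc.
module Joined (G H : Graph) (v : Graph.Node G) (w : Graph.Node H)
  (N : Set) (t h : (Graph.Arc G ⊎ Graph.Arc H) ⊎ ⊤ → N)
  (ι : Graph.Node G → N) (κ : Graph.Node H → N) (new : N)
  (glue : ι v ≡ κ w)
  (elim : ∀ {T : Set} → (Graph.Node G → T) → (Graph.Node H → T) → T → N → T)
  (elim-ι : ∀ {T : Set} (f : Graph.Node G → T) (g : Graph.Node H → T) x →
            f v ≡ g w → ∀ u → elim f g x (ι u) ≡ f u)
  (elim-κ : ∀ {T : Set} (f : Graph.Node G → T) (g : Graph.Node H → T) x →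
            f v ≡ g w → ∀ u → elim f g x (κ u) ≡ g u)
  (elim-new : ∀ {T : Set} (f : Graph.Node G → T) (g : Graph.Node H → T) x → elim f g x new ≡ x)
  (cover : ∀ u → (∃ λ x → u ≡ ι x) ⊎ (∃ λ x → u ≡ κ x) ⊎ u ≡ new)
  (tailsˡ : ∀ a → t (inj₁ (inj₁ a)) ≡ ι (Graph.tail G a))
  (headsˡ : ∀ a → h (inj₁ (inj₁ a)) ≡ ι (Graph.head G a))
  (tailsʳ : ∀ a → t (inj₁ (inj₂ a)) ≡ κ (Graph.tail H a))
  (headsʳ : ∀ a → h (inj₁ (inj₂ a)) ≡ κ (Graph.head H a))
  (tail-new : t (inj₂ tt) ≡ ι v) (head-new : h (inj₂ tt) ≡ new)
  where

  private
    module G = Graph G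
    module H = Graph H

  graph : Graph
  graph = record { Node = N ; Arc = (G.Arc ⊎ H.Arc) ⊎ ⊤ ; tail = t ; head = h }

  -- The component of `w` is absorbed by that of `v`; `punchOut` removes its index from
  -- `Fin (suc n)` and leaves `Fin n` for the others.
  forest : ∀ {K n} → Forest G K → Forest H (Fin (suc n)) → Forest graph (K ⊎ Fin n)
  forest {K} {n} E F = record
    { comp = comp′ ; base = base′ ; comp-base = comp-base′
    ; respects = λ { (inj₁ (inj₁ a)) → sameˡ (inj₁ ∘ E.comp) (shift ∘ F.comp) _ glued a (cong inj₁ (E.respects a))
                   ; (inj₁ (inj₂ a)) → sameʳ (inj₁ ∘ E.comp) (shift ∘ F.comp) _ glued a (cong shift (F.respects a))
                   ; (inj₂ tt) → same-new (inj₁ ∘ E.comp) (shift ∘ F.comp) glued }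
    ; connected = λ u → conn u (cover u)
    ; colour = colour′
    ; colour-others = others
    ; colour-self = self }
    where
    module E = Forest E
    module F = Forest F
    module G′ = Graph graph
    k = F.comp w
    shift : Fin (suc n) → K ⊎ Fin n
    shift i with k Fin.≟ i
    ... | yes _  = inj₁ (E.comp v)
    ... | no k≢i = inj₂ (punchOut k≢i)
    shift-k : shift k ≡ inj₁ (E.comp v)
    shift-k with k Fin.≟ k
    ... | yes _ = refl
    ... | no ne = contradiction refl ne
    shift-punchIn : ∀ j → shift (punchIn k j) ≡ inj₂ j
    shift-punchIn j with k Fin.≟ punchIn k j
    ... | yes e = contradiction (sym e) (punchInᵢ≢i k j)
    ... | no ne = cong inj₂ (trans (Fin.punchOut-cong k refl) (punchOut-punchIn k))
    glued : inj₁ (E.comp v) ≡ shift (F.comp w)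
    glued = sym shift-k
    comp′ : N → K ⊎ Fin n
    comp′ = elim (inj₁ ∘ E.comp) (shift ∘ F.comp) (inj₁ (E.comp v))
    base′ : K ⊎ Fin n → N
    base′ (inj₁ i) = ι (E.base i)
    base′ (inj₂ j) = κ (F.base (punchIn k j))
    comp-base′ : ∀ x → comp′ (base′ x) ≡ x
    comp-base′ (inj₁ i) = trans (elim-ι _ _ _ glued _) (cong inj₁ (E.comp-base i))
    comp-base′ (inj₂ j) = trans (elim-κ _ _ _ glued _)
      (trans (cong shift (F.comp-base (punchIn k j))) (shift-punchIn j))
    sameˡ : ∀ {T : Set} (f : G.Node → T) g x → f v ≡ g w → ∀ a → f (G.tail a) ≡ f (G.head a) →
            elim f g x (t (inj₁ (inj₁ a))) ≡ elim f g x (h (inj₁ (inj₁ a)))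
    sameˡ f g x e a p = trans (cong (elim f g x) (tailsˡ a)) (trans (elim-ι f g x e _) (trans p
                        (trans (sym (elim-ι f g x e _)) (cong (elim f g x) (sym (headsˡ a))))))
    sameʳ : ∀ {T : Set} (f : G.Node → T) g x → f v ≡ g w → ∀ a → g (H.tail a) ≡ g (H.head a) →
            elim f g x (t (inj₁ (inj₂ a))) ≡ elim f g x (h (inj₁ (inj₂ a)))
    sameʳ f g x e a p = trans (cong (elim f g x) (tailsʳ a)) (trans (elim-κ f g x e _) (trans p
                        (trans (sym (elim-κ f g x e _)) (cong (elim f g x) (sym (headsʳ a))))))
    same-new : ∀ {T : Set} (f : G.Node → T) g → f v ≡ g w →
               elim f g (f v) (t (inj₂ tt)) ≡ elim f g (f v) (h (inj₂ tt))
    same-new f g e = trans (cong (elim f g (f v)) tail-new) (trans (elim-ι f g (f v) e _)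
                       (trans (sym (elim-new f g (f v))) (cong (elim f g (f v)) (sym head-new))))
    -- A colouring of one graph is extended to the other by its value at the glued node, so that no
    -- arc of the other graph changes colour.
    colour′ : (G.Arc ⊎ H.Arc) ⊎ ⊤ → N → Bool
    colour′ (inj₁ (inj₁ a)) = elim (E.colour a) (const (E.colour a v)) (E.colour a v)
    colour′ (inj₁ (inj₂ a)) = elim (const (F.colour a w)) (F.colour a) (F.colour a w)
    colour′ (inj₂ tt)       = elim (const false) (const false) true
    others : ∀ {a b} → b ≢ a → colour′ a (t b) ≡ colour′ a (h b)
    others {inj₁ (inj₁ a)} {inj₁ (inj₁ b)} ne = sameˡ _ _ _ refl b (E.colour-others (ne ∘ cong (inj₁ ∘ inj₁)))
    others {inj₁ (inj₁ a)} {inj₁ (inj₂ b)} ne = sameʳ (E.colour a) (const (E.colour a v)) _ refl b refl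
    others {inj₁ (inj₁ a)} {inj₂ tt}       ne = same-new (E.colour a) (const (E.colour a v)) refl
    others {inj₁ (inj₂ a)} {inj₁ (inj₁ b)} ne = sameˡ (const (F.colour a w)) (F.colour a) _ refl b refl
    others {inj₁ (inj₂ a)} {inj₁ (inj₂ b)} ne = sameʳ _ _ _ refl b (F.colour-others (ne ∘ cong (inj₁ ∘ inj₂)))
    others {inj₁ (inj₂ a)} {inj₂ tt}       ne = same-new (const (F.colour a w)) (F.colour a) refl
    others {inj₂ tt}       {inj₁ (inj₁ b)} ne = sameˡ (const false) (const false) true refl b refl
    others {inj₂ tt}       {inj₁ (inj₂ b)} ne = sameʳ (const false) (const false) true refl b refl
    others {inj₂ tt}       {inj₂ tt}       ne = contradiction refl ne
    self : ∀ a → colour′ a (t a) ≢ colour′ a (h a)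
    self (inj₁ (inj₁ a)) e = E.colour-self a (trans (sym (elim-ι _ _ _ refl _))
      (trans (cong (colour′ (inj₁ (inj₁ a))) (sym (tailsˡ a)))
      (trans e (trans (cong (colour′ (inj₁ (inj₁ a))) (headsˡ a)) (elim-ι _ _ _ refl _)))))
    self (inj₁ (inj₂ a)) e = F.colour-self a (trans (sym (elim-κ _ _ _ refl _))
      (trans (cong (colour′ (inj₁ (inj₂ a))) (sym (tailsʳ a)))
      (trans e (trans (cong (colour′ (inj₁ (inj₂ a))) (headsʳ a)) (elim-κ _ _ _ refl _)))))
    self (inj₂ tt) e = true≢false (trans (sym (elim-new (const false) (const false) true))
      (trans (cong (colour′ (inj₂ tt)) (sym head-new)) (trans (sym e)
      (trans (cong (colour′ (inj₂ tt)) tail-new) (elim-ι (const false) (const false) true refl v)))))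
    liftˡ : ∀ {x y} → EqClosure G.Arrow x y → EqClosure G′.Arrow (ι x) (ι y)
    liftˡ = Eq.gmap ι λ { (a , refl , refl) → inj₁ (inj₁ a) , tailsˡ a , headsˡ a }
    liftʳ : ∀ {x y} → EqClosure H.Arrow x y → EqClosure G′.Arrow (κ x) (κ y)
    liftʳ = Eq.gmap κ λ { (a , refl , refl) → inj₁ (inj₂ a) , tailsʳ a , headsʳ a }
    conn-κ : ∀ x → EqClosure G′.Arrow (κ x) (base′ (shift (F.comp x)))
    conn-κ x with k Fin.≟ F.comp x
    ... | yes e = liftʳ (F.connected x) ◅◅
                  subst (λ z → EqClosure G′.Arrow (κ (F.base z)) (ι (E.base (E.comp v)))) e
                    (Eq.symmetric _ (liftʳ (F.connected w)) ◅◅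
                     subst (λ z → EqClosure G′.Arrow z _) glue (liftˡ (E.connected v)))
    ... | no ne = subst (λ z → EqClosure G′.Arrow (κ x) (κ (F.base z))) (sym (punchIn-punchOut ne))
                    (liftʳ (F.connected x))
    conn : ∀ u → (∃ λ x → u ≡ ι x) ⊎ (∃ λ x → u ≡ κ x) ⊎ u ≡ new → EqClosure G′.Arrow u (base′ (comp′ u))
    conn _ (inj₁ (x , refl)) =
      subst (λ z → EqClosure G′.Arrow (ι x) (base′ z)) (sym (elim-ι _ _ _ glued x)) (liftˡ (E.connected x))
    conn _ (inj₂ (inj₁ (x , refl))) =
      subst (λ z → EqClosure G′.Arrow (κ x) (base′ z)) (sym (elim-κ _ _ _ glued x)) (conn-κ x)
    conn _ (inj₂ (inj₂ refl)) = subst (λ z → EqClosure G′.Arrow new (base′ z)) (sym (elim-new _ _ _))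
      (bwd (inj₂ tt , tail-new , head-new) ◅ liftˡ (E.connected v))

-- Switching graphs of desequentialized proofs

module Soundness (atoms : AtomicFormulae) where
  open MLL atoms

  SwitchingForests : ∀ {Γ} → Structure Γ → ℕ → Set
  SwitchingForests P n = ∀ φ → Forest (switchingGraph P φ) (Fin n)

  data Split (Γ : Sequent) {Δ : Sequent} {A : Formula} : A ∈ Γ ++ Δ → Set where
    inˡ : (j : A ∈ Γ) → Split Γ (∈-++⁺ˡ j)
    inʳ : (j : A ∈ Δ) → Split Γ (∈-++⁺ʳ Γ j)

  split : ∀ (Γ : Sequent) {Δ A} (i : A ∈ Γ ++ Δ) → Split Γ i
  split Γ {Δ} i with ∈-++⁻ Γ i | ++⁺∘++⁻ Γ i
  ... | inj₁ j | refl = inˡ j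
  ... | inj₂ j | refl = inʳ j

  ++⁻-ˡ : ∀ (Γ : Sequent) {Δ A} (j : A ∈ Γ) → ∈-++⁻ Γ {Δ} (∈-++⁺ˡ j) ≡ inj₁ j
  ++⁻-ˡ Γ {Δ} j = ++⁻∘++⁺ Γ {Δ} (inj₁ j)

  ++⁻-ʳ : ∀ (Γ : Sequent) {Δ A} (j : A ∈ Δ) → ∈-++⁻ Γ (∈-++⁺ʳ Γ j) ≡ inj₂ j
  ++⁻-ʳ Γ {Δ} j = ++⁻∘++⁺ Γ {Δ} (inj₂ j)

  redirect-map : ∀ {Γ Δ} {P : Structure Γ} {Q : Structure Δ} (f : SwitchingNode P → SwitchingNode Q) {c d} →
                 f (inj₁ (Structure.cell (par , c))) ≡ inj₁ (Structure.cell (par , d)) → f (inj₂ c) ≡ inj₂ d →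
                 ∀ s t → redirect Q d s t ≡ f (redirect P c s t)
  redirect-map f e e′ left  left  = sym e
  redirect-map f e e′ left  right = sym e′
  redirect-map f e e′ right left  = sym e′
  redirect-map f e e′ right right = sym e

  module _ {Γ Δ : Sequent} (P : Structure Γ) (Q : Structure Δ)
           (cells : ∀ l → Structure.Cell P l ↔ Structure.Cell Q l) (arcs : Structure.Arc P ↔ Structure.Arc Q)
           (pos : ∀ {A} → A ∈ Γ → A ∈ Δ) (pos⁻ : ∀ {A} → A ∈ Δ → A ∈ Γ)
           (pos-pos⁻ : ∀ {A} (i : A ∈ Δ) → pos (pos⁻ i) ≡ i)
           (pos⁻-pos : ∀ {A} (i : A ∈ Γ) → pos⁻ (pos i) ≡ i)
           (tails : ∀ a → Structure.tail Q (Inverse.to arcs a) ≡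
                          (proj₁ (Structure.tail P a) , Inverse.to (cells _) (proj₂ (Structure.tail P a))))
           (heads : ∀ a → Structure.head Q (Inverse.to arcs a) ≡
                          mapTarget (λ {l} → Inverse.to (cells l)) (λ i → • (pos i)) (Structure.head P a))
           where

    -- Covers both isomorphisms, which keep the positions of the conclusions, and exchange, which
    -- moves nothing else.
    transport-forests : ∀ {n} → SwitchingForests Q n → SwitchingForests P n
    transport-forests F φ = Isomorphic.transport (switchingGraph P φ) (switchingGraph Q ψ)
      to from to-from from-to arcs (λ a → cong (inj₁ ∘ Structure.cell) (tails a))
      (λ a → trans (cong (switchTarget Q ψ) (heads a)) (target (Structure.head P a))) (F ψ)
      where
      module I {l} = Inverse (cells l)
      ψ : Switching Q
      ψ = φ ∘ I.from
      to : SwitchingNode P → SwitchingNode Q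
      to (inj₁ (Structure.cell (l , c))) = inj₁ (Structure.cell (l , I.to c))
      to (inj₁ (Structure.• i))          = inj₁ (Structure.• (pos i))
      to (inj₂ c)                        = inj₂ (I.to c)
      from : SwitchingNode Q → SwitchingNode P
      from (inj₁ (Structure.cell (l , c))) = inj₁ (Structure.cell (l , I.from c))
      from (inj₁ (Structure.• i))          = inj₁ (Structure.• (pos⁻ i))
      from (inj₂ c)                        = inj₂ (I.from c)
      to-from : ∀ u → to (from u) ≡ u
      to-from (inj₁ (Structure.cell (l , c))) = cong (λ c → inj₁ (Structure.cell (l , c))) (I.strictlyInverseˡ c)
      to-from (inj₁ (Structure.• i))          = cong (λ i → inj₁ (Structure.• i)) (pos-pos⁻ i)
      to-from (inj₂ c)                        = cong inj₂ (I.strictlyInverseˡ c)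
      from-to : ∀ u → from (to u) ≡ u
      from-to (inj₁ (Structure.cell (l , c))) = cong (λ c → inj₁ (Structure.cell (l , c))) (I.strictlyInverseʳ c)
      from-to (inj₁ (Structure.• i))          = cong (λ i → inj₁ (Structure.• i)) (pos⁻-pos i)
      from-to (inj₂ c)                        = cong inj₂ (I.strictlyInverseʳ c)
      target : ∀ t → switchTarget Q ψ (mapTarget I.to (λ i → • (pos i)) t) ≡ to (switchTarget P φ t)
      target (into c cut-in)   = refl
      target (into c (⊗-in s)) = refl
      target (into c (⅋-in s)) = trans (cong (λ d → redirect Q (I.to c) (φ d) s) (I.strictlyInverseʳ c))
                                   (redirect-map to refl refl (φ c) s)
      target (• i)             = refl

  forests-≅ : ∀ {Γ n} {P Q : Structure Γ} → P ≅ Q → SwitchingForests Q n → SwitchingForests P n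
  forests-≅ {P = P} {Q} i =
    transport-forests P Q cells arcs id id (λ _ → refl) (λ _ → refl) tail-preserved head-preserved
    where open _≅_ i

  forests-exchange : ∀ {Γ Δ n} (σ : Γ ↭ Δ) {P : Structure Γ} → SwitchingForests P n →
                     SwitchingForests (exchangeˢ σ P) n
  forests-exchange σ {P} = transport-forests (exchangeˢ σ P) P (λ _ → ↔-refl) ↔-refl
    (∈-resp-↭ (↭-sym σ)) (∈-resp-↭ σ) (∈-resp-[σ⁻¹∘σ] σ) (∈-resp-[σ∘σ⁻¹] σ) (λ _ → refl)
    λ a → lem (Structure.head P a)
    where
    lem : ∀ t → t ≡ mapTarget id (λ i → • (∈-resp-↭ (↭-sym σ) i)) (mapTarget id (λ i → • (∈-resp-↭ σ i)) t)
    lem (into c s) = refl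
    lem (• i)      = cong • (sym (∈-resp-[σ⁻¹∘σ] σ i))

  forests-ax : ∀ A → SwitchingForests (axˢ A) 1
  forests-ax A φ = record
    { comp = λ _ → zero ; base = λ _ → inj₁ (cell (ax , refl)) ; comp-base = λ { zero → refl }
    ; respects = λ _ → refl
    ; connected = λ { (inj₁ (cell (_ , refl))) → ε
                    ; (inj₁ (• (here refl))) → bwd (left , refl , refl) ◅ ε
                    ; (inj₁ (• (there (here refl)))) → bwd (right , refl , refl) ◅ ε
                    ; (inj₂ ()) }
    ; colour = colour
    ; colour-others = λ { {left} {left} ne → contradiction refl ne ; {left} {right} _ → refl
                        ; {right} {left} _ → refl ; {right} {right} ne → contradiction refl ne }
    ; colour-self = λ { left () ; right () } }
    where
    open Structure (axˢ A)
    colour : Side → SwitchingNode (axˢ A) → Bool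
    colour left  (inj₁ (• (here _)))  = true
    colour right (inj₁ (• (there _))) = true
    colour _     _                    = false

  forests-𝟏 : SwitchingForests 𝟏ˢ 1
  forests-𝟏 φ = record
    { comp = λ _ → zero ; base = λ _ → inj₁ (cell (one , refl)) ; comp-base = λ { zero → refl }
    ; respects = λ _ → refl
    ; connected = λ { (inj₁ (cell (_ , refl))) → ε
                    ; (inj₁ (• (here refl))) → bwd (tt , refl , refl) ◅ ε
                    ; (inj₂ ()) }
    ; colour = λ _ → colour
    ; colour-others = λ ne → contradiction refl ne
    ; colour-self = λ { tt () } }
    where
    open Structure 𝟏ˢ
    colour : SwitchingNode 𝟏ˢ → Bool
    colour (inj₁ (• _)) = true
    colour _            = false

  module _ {Γ : Sequent} (P : Structure Γ) where
    private
      P′ = ⊥ˢ Γ P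
      module P = Structure P
      open Structure P′ using (cell; •)

    module _ (φ : Switching P′) where
      private
        ψ : Switching P
        ψ c = φ (inj₁ c)

        module Base = Isolated (switchingGraph P ψ)

        ι : SwitchingNode P ⊎ ⊤ → SwitchingNode P′
        ι (inj₁ (inj₁ (P.cell (l , c)))) = inj₁ (cell (l , inj₁ c))
        ι (inj₁ (inj₁ (P.• i)))          = inj₁ (• (∈-++⁺ˡ i))
        ι (inj₁ (inj₂ c))                = inj₂ (inj₁ c)
        ι (inj₂ tt)                      = inj₁ (cell (bot , inj₂ refl))

        elim : ∀ {T : Set} → (SwitchingNode P ⊎ ⊤ → T) → T → SwitchingNode P′ → T
        elim f x (inj₁ (cell (l , inj₁ c))) = f (inj₁ (inj₁ (P.cell (l , c))))
        elim f x (inj₁ (cell (l , inj₂ _))) = f (inj₂ tt)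
        elim f x (inj₁ (• i))               = [ (λ j → f (inj₁ (inj₁ (P.• j)))) , const x ]′ (∈-++⁻ Γ i)
        elim f x (inj₂ (inj₁ c))            = f (inj₁ (inj₂ c))
        elim f x (inj₂ (inj₂ ()))

        elim-ι : ∀ {T : Set} (f : SwitchingNode P ⊎ ⊤ → T) x v → elim f x (ι v) ≡ f v
        elim-ι f x (inj₁ (inj₁ (P.cell _))) = refl
        elim-ι f x (inj₁ (inj₁ (P.• i))) rewrite ++⁻-ˡ Γ {Formula.⊥ ∷ []} i = refl
        elim-ι f x (inj₁ (inj₂ _))          = refl
        elim-ι f x (inj₂ tt)                = refl

        new : SwitchingNode P′
        new = inj₁ (• (∈-++⁺ʳ Γ (here refl)))

        elim-new : ∀ {T : Set} (f : SwitchingNode P ⊎ ⊤ → T) x → elim f x new ≡ x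
        elim-new f x rewrite ++⁻-ʳ Γ {Formula.⊥ ∷ []} (here refl) = refl

        cover : ∀ u → (∃ λ v → u ≡ ι v) ⊎ u ≡ new
        cover (inj₁ (cell (l , inj₁ c)))    = inj₁ (inj₁ (inj₁ (P.cell (l , c))) , refl)
        cover (inj₁ (cell (_ , inj₂ refl))) = inj₁ (inj₂ tt , refl)
        cover (inj₁ (• i)) with split Γ i
        ... | inˡ j           = inj₁ (inj₁ (inj₁ (P.• j)) , refl)
        ... | inʳ (here refl) = inj₂ refl
        cover (inj₂ (inj₁ c)) = inj₁ (inj₁ (inj₂ c) , refl)
        cover (inj₂ (inj₂ ()))

        target : ∀ a → switchTarget P′ φ (Structure.head P′ (inj₁ a)) ≡ ι (inj₁ (switchTarget P ψ (P.head a)))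
        target a with P.head a
        ... | into c cut-in   = refl
        ... | into c (⊗-in s) = refl
        ... | into c (⅋-in s) = redirect-map (ι ∘ inj₁) refl refl (ψ c) s
        ... | • i             = refl

      -- The ⊥ node is first added as an isolated point, which is the additional component; its •
      -- node is then hung on it.
      forest-⊥ : ∀ {K} → Forest (switchingGraph P ψ) K → Forest (switchingGraph P′ φ) (Fin 1 ⊎ K)
      forest-⊥ F = Pendant.forest Base.withPoint (inj₂ tt) (SwitchingNode P′)
        (Graph.tail (switchingGraph P′ φ)) (Graph.head (switchingGraph P′ φ)) ι new
        elim elim-ι elim-new cover (λ _ → refl) target refl refl (Base.forest F)

  module _ (Γ : Sequent) (A B : Formula) (P : Structure (Γ ++ A ∷ B ∷ [])) where
    private
      P′ = ⅋ˢ Γ A B P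
      module P = Structure P
      open Structure P′ using (cell; •)

    module _ (φ : Switching P′) where
      private
        ψ : Switching P
        ψ c = φ (inj₁ c)

        chosen : Side
        chosen = φ (inj₂ refl)

        end : Side → SwitchingNode P
        end left  = inj₁ (P.• (∈-++⁺ʳ Γ (here refl)))
        end right = inj₁ (P.• (∈-++⁺ʳ Γ (there (here refl))))

        ι• : ∀ {C} → C ∈ Γ ⊎ C ∈ A ∷ B ∷ [] → SwitchingNode P′
        ι• (inj₁ j)                = inj₁ (• (∈-++⁺ˡ j))
        ι• (inj₂ (here _))         = redirect P′ (inj₂ refl) chosen left
        ι• (inj₂ (there (here _))) = redirect P′ (inj₂ refl) chosen right

        ι : SwitchingNode P → SwitchingNode P′
        ι (inj₁ (P.cell (l , c))) = inj₁ (cell (l , inj₁ c))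
        ι (inj₁ (P.• i))          = ι• (∈-++⁻ Γ i)
        ι (inj₂ c)                = inj₂ (inj₁ c)

        elim : ∀ {T : Set} → (SwitchingNode P → T) → T → SwitchingNode P′ → T
        elim f x (inj₁ (cell (l , inj₁ c))) = f (inj₁ (P.cell (l , c)))
        elim f x (inj₁ (cell (l , inj₂ _))) = f (end chosen)
        elim f x (inj₁ (• i))               = [ (λ j → f (inj₁ (P.• (∈-++⁺ˡ j)))) , const x ]′ (∈-++⁻ Γ i)
        elim f x (inj₂ (inj₁ c))            = f (inj₂ c)
        elim f x (inj₂ (inj₂ _))            = f (end (other chosen))

        elim-redirect : ∀ {T : Set} (f : SwitchingNode P → T) x s → elim f x (redirect P′ (inj₂ refl) chosen s) ≡ f (end s)
        elim-redirect f x s with chosen in e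
        elim-redirect f x left  | left  = cong (f ∘ end) e
        elim-redirect f x right | left  = cong (f ∘ end ∘ other) e
        elim-redirect f x left  | right = cong (f ∘ end ∘ other) e
        elim-redirect f x right | right = cong (f ∘ end) e

        elim-ι : ∀ {T : Set} (f : SwitchingNode P → T) x v → elim f x (ι v) ≡ f v
        elim-ι f x (inj₁ (P.cell _)) = refl
        elim-ι f x (inj₁ (P.• i)) with split Γ i
        ... | inˡ j rewrite ++⁻-ˡ Γ {A ∷ B ∷ []} j | ++⁻-ˡ Γ {A ⅋ B ∷ []} j = refl
        ... | inʳ (here refl) rewrite ++⁻-ʳ Γ {A ∷ B ∷ []} (here refl) = elim-redirect f x left
        ... | inʳ (there (here refl)) rewrite ++⁻-ʳ Γ {A ∷ B ∷ []} (there (here refl)) = elim-redirect f x right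
        elim-ι f x (inj₂ _)          = refl

        new : SwitchingNode P′
        new = inj₁ (• (∈-++⁺ʳ Γ (here refl)))

        elim-new : ∀ {T : Set} (f : SwitchingNode P → T) x → elim f x new ≡ x
        elim-new f x rewrite ++⁻-ʳ Γ {A ⅋ B ∷ []} (here refl) = refl

        ι-end : ∀ s → ι (end s) ≡ redirect P′ (inj₂ refl) chosen s
        ι-end left  = cong ι• (++⁻-ʳ Γ {A ∷ B ∷ []} (here refl))
        ι-end right = cong ι• (++⁻-ʳ Γ {A ∷ B ∷ []} (there (here refl)))

        redirect-chosen : ∀ s → redirect P′ (inj₂ refl) s s ≡ inj₁ (cell (par , inj₂ refl))
        redirect-chosen left  = refl
        redirect-chosen right = refl

        redirect-other : ∀ s → redirect P′ (inj₂ refl) s (other s) ≡ inj₂ (inj₂ refl)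
        redirect-other left  = refl
        redirect-other right = refl

        ι-chosen : inj₁ (cell (par , inj₂ refl)) ≡ ι (end chosen)
        ι-chosen = trans (sym (redirect-chosen chosen)) (sym (ι-end chosen))

        cover : ∀ u → (∃ λ v → u ≡ ι v) ⊎ u ≡ new
        cover (inj₁ (cell (l , inj₁ c)))    = inj₁ (inj₁ (P.cell (l , c)) , refl)
        cover (inj₁ (cell (_ , inj₂ refl))) = inj₁ (end chosen , ι-chosen)
        cover (inj₁ (• i)) with split Γ i
        ... | inˡ j           = inj₁ (inj₁ (P.• (∈-++⁺ˡ j)) , cong ι• (sym (++⁻-ˡ Γ {A ∷ B ∷ []} j)))
        ... | inʳ (here refl) = inj₂ refl
        cover (inj₂ (inj₁ c))    = inj₁ (inj₂ c , refl)
        cover (inj₂ (inj₂ refl)) = inj₁ (end (other chosen) ,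
          trans (sym (redirect-other chosen)) (sym (ι-end (other chosen))))

        target : ∀ a → switchTarget P′ φ (Structure.head P′ (inj₁ a)) ≡ ι (switchTarget P ψ (P.head a))
        target a with P.head a
        ... | into c cut-in   = refl
        ... | into c (⊗-in s) = refl
        ... | into c (⅋-in s) = redirect-map ι refl refl (ψ c) s
        ... | • i with ∈-++⁻ Γ i
        ...   | inj₁ _                = refl
        ...   | inj₂ (here _)         = refl
        ...   | inj₂ (there (here _)) = refl

      -- The • node of the selected premise turns into the ⅋ node, and that of the other premise
      -- into the fresh • node. So the old graph is kept as it is, and only the • node of the
      -- conclusion is added.
      forest-⅋ : ∀ {K} → Forest (switchingGraph P ψ) K → Forest (switchingGraph P′ φ) K
      forest-⅋ = Pendant.forest (switchingGraph P ψ) (end chosen) (SwitchingNode P′)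
        (Graph.tail (switchingGraph P′ φ)) (Graph.head (switchingGraph P′ φ)) ι new
        elim elim-ι elim-new cover (λ _ → refl) target ι-chosen refl

  module _ (Γ : Sequent) (A B : Formula) {Δ : Sequent}
           (P : Structure (Γ ++ A ∷ [])) (Q : Structure (B ∷ Δ)) where
    private
      S = ⊗ˢ Γ A B {Δ} P Q
      module P = Structure P
      module Q = Structure Q
      open Structure S using (cell; •)

    module _ (φ : Switching S) where
      private
        ψ : Switching P
        ψ c = φ (inj₁ (inj₁ c))

        χ : Switching Q
        χ c = φ (inj₁ (inj₂ c))

        v : SwitchingNode P
        v = inj₁ (P.• (∈-++⁺ʳ Γ (here refl)))

        w : SwitchingNode Q
        w = inj₁ (Q.• (here refl))

        ι• : ∀ {C} → C ∈ Γ ⊎ C ∈ A ∷ [] → SwitchingNode S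
        ι• (inj₁ j)        = inj₁ (• (∈-++⁺ˡ j))
        ι• (inj₂ (here _)) = inj₁ (cell (tensor , inj₂ refl))

        ι : SwitchingNode P → SwitchingNode S
        ι (inj₁ (P.cell (l , c))) = inj₁ (cell (l , inj₁ (inj₁ c)))
        ι (inj₁ (P.• i))          = ι• (∈-++⁻ Γ i)
        ι (inj₂ c)                = inj₂ (inj₁ (inj₁ c))

        κ : SwitchingNode Q → SwitchingNode S
        κ (inj₁ (Q.cell (l , c)))  = inj₁ (cell (l , inj₁ (inj₂ c)))
        κ (inj₁ (Q.• (here _)))    = inj₁ (cell (tensor , inj₂ refl))
        κ (inj₁ (Q.• (there j)))   = inj₁ (• (∈-++⁺ʳ Γ (there j)))
        κ (inj₂ c)                 = inj₂ (inj₁ (inj₂ c))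

        elim• : ∀ {T : Set} {C} → (SwitchingNode P → T) → (SwitchingNode Q → T) → T → C ∈ Γ ⊎ C ∈ A ⊗ B ∷ Δ → T
        elim• f g x (inj₁ j)         = f (inj₁ (P.• (∈-++⁺ˡ j)))
        elim• f g x (inj₂ (here _))  = x
        elim• f g x (inj₂ (there j)) = g (inj₁ (Q.• (there j)))

        elim : ∀ {T : Set} → (SwitchingNode P → T) → (SwitchingNode Q → T) → T → SwitchingNode S → T
        elim f g x (inj₁ (cell (l , inj₁ (inj₁ c)))) = f (inj₁ (P.cell (l , c)))
        elim f g x (inj₁ (cell (l , inj₁ (inj₂ c)))) = g (inj₁ (Q.cell (l , c)))
        elim f g x (inj₁ (cell (l , inj₂ _)))        = f v
        elim f g x (inj₁ (• i))                      = elim• f g x (∈-++⁻ Γ i)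
        elim f g x (inj₂ (inj₁ (inj₁ c)))            = f (inj₂ c)
        elim f g x (inj₂ (inj₁ (inj₂ c)))            = g (inj₂ c)
        elim f g x (inj₂ (inj₂ ()))

        elim-ι : ∀ {T : Set} (f : SwitchingNode P → T) (g : SwitchingNode Q → T) x → f v ≡ g w →
                 ∀ u → elim f g x (ι u) ≡ f u
        elim-ι f g x e (inj₁ (P.cell _)) = refl
        elim-ι f g x e (inj₁ (P.• i)) with split Γ i
        ... | inˡ j rewrite ++⁻-ˡ Γ {A ∷ []} j | ++⁻-ˡ Γ {A ⊗ B ∷ Δ} j = refl
        ... | inʳ (here refl) rewrite ++⁻-ʳ Γ {A ∷ []} (here refl) = refl
        elim-ι f g x e (inj₂ _)          = refl

        elim-κ : ∀ {T : Set} (f : SwitchingNode P → T) (g : SwitchingNode Q → T) x → f v ≡ g w →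
                 ∀ u → elim f g x (κ u) ≡ g u
        elim-κ f g x e (inj₁ (Q.cell _))         = refl
        elim-κ f g x e (inj₁ (Q.• (here refl)))  = e
        elim-κ f g x e (inj₁ (Q.• (there j)))    = cong (elim• f g x) (++⁻-ʳ Γ {A ⊗ B ∷ Δ} (there j))
        elim-κ f g x e (inj₂ _)                  = refl

        new : SwitchingNode S
        new = inj₁ (• (∈-++⁺ʳ Γ (here refl)))

        elim-new : ∀ {T : Set} (f : SwitchingNode P → T) (g : SwitchingNode Q → T) x → elim f g x new ≡ x
        elim-new f g x = cong (elim• f g x) (++⁻-ʳ Γ {A ⊗ B ∷ Δ} (here refl))

        ι-v : inj₁ (cell (tensor , inj₂ refl)) ≡ ι v
        ι-v = cong ι• (sym (++⁻-ʳ Γ {A ∷ []} (here refl)))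

        cover : ∀ u → (∃ λ x → u ≡ ι x) ⊎ (∃ λ x → u ≡ κ x) ⊎ u ≡ new
        cover (inj₁ (cell (l , inj₁ (inj₁ c)))) = inj₁ (inj₁ (P.cell (l , c)) , refl)
        cover (inj₁ (cell (l , inj₁ (inj₂ c)))) = inj₂ (inj₁ (inj₁ (Q.cell (l , c)) , refl))
        cover (inj₁ (cell (_ , inj₂ refl)))     = inj₁ (v , ι-v)
        cover (inj₁ (• i)) with split Γ i
        ... | inˡ j           = inj₁ (inj₁ (P.• (∈-++⁺ˡ j)) , cong ι• (sym (++⁻-ˡ Γ {A ∷ []} j)))
        ... | inʳ (here refl) = inj₂ (inj₂ refl)
        ... | inʳ (there j)   = inj₂ (inj₁ (inj₁ (Q.• (there j)) , refl))
        cover (inj₂ (inj₁ (inj₁ c))) = inj₁ (inj₂ c , refl)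
        cover (inj₂ (inj₁ (inj₂ c))) = inj₂ (inj₁ (inj₂ c , refl))
        cover (inj₂ (inj₂ ()))

        targetˡ : ∀ a → switchTarget S φ (Structure.head S (inj₁ (inj₁ a))) ≡ ι (switchTarget P ψ (P.head a))
        targetˡ a with P.head a
        ... | into c cut-in   = refl
        ... | into c (⊗-in s) = refl
        ... | into c (⅋-in s) = redirect-map ι refl refl (ψ c) s
        ... | • i with ∈-++⁻ Γ i
        ...   | inj₁ _        = refl
        ...   | inj₂ (here _) = refl

        targetʳ : ∀ a → switchTarget S φ (Structure.head S (inj₁ (inj₂ a))) ≡ κ (switchTarget Q χ (Q.head a))
        targetʳ a with Q.head a
        ... | into c cut-in   = refl
        ... | into c (⊗-in s) = refl
        ... | into c (⅋-in s) = redirect-map κ refl refl (χ c) s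
        ... | • (here _)      = refl
        ... | • (there _)     = refl

      -- The • nodes of the two active conclusions are identified and become the ⊗ node.
      forest-⊗ : ∀ {K n} → Forest (switchingGraph P ψ) K → Forest (switchingGraph Q χ) (Fin (suc n)) →
                 Forest (switchingGraph S φ) (K ⊎ Fin n)
      forest-⊗ = Joined.forest (switchingGraph P ψ) (switchingGraph Q χ) v w (SwitchingNode S)
        (Graph.tail (switchingGraph S φ)) (Graph.head (switchingGraph S φ)) ι κ new (sym ι-v)
        elim elim-ι elim-κ elim-new cover (λ _ → refl) targetˡ (λ _ → refl) targetʳ ι-v refl

  private
    no-bot : ∀ {l} → bot ≢ l → bot ≡ l ↔ Fin 0
    no-bot ne = mk↔ₛ′ (λ e → contradiction e ne) (λ ()) (λ ()) (λ e → contradiction e ne)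

    the-bot : (bot ≡ bot) ↔ Fin 1
    the-bot = mk↔ₛ′ (λ _ → zero) (λ _ → refl) (λ { zero → refl }) (λ { refl → refl })

    drop-empty : ∀ {X : Set} → (X ⊎ Fin 0) ↔ X
    drop-empty = mk↔ₛ′ [ id , (λ ()) ]′ inj₁ (λ _ → refl) λ { (inj₁ _) → refl ; (inj₂ ()) }

  -- ⊥ cells and components are counted together: a ⊗ rule merges one component of each premise,
  -- leaving (w + 1) + w′, and a ⊥ rule raises both numbers by one.
  sound : ∀ {𝓕 Γ} (π : Proof 𝓕 Γ) → CutFree (π °) →
          ∃ λ w → (Structure.Cell (π °) bot ↔ Fin w) × SwitchingForests (π °) (suc w)
  sound (ax-rule A _ _)    _ = 0 , no-bot (λ ()) , forests-ax A
  sound (cut-rule Γ A π ρ) cf = contradiction (inj₂ refl) cf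
  sound (exchange σ π)     cf = let (w , b , F) = sound π cf in w , b , forests-exchange σ F
  sound (𝟏-rule _)         _ = 0 , no-bot (λ ()) , forests-𝟏
  sound (⊗-rule Γ A B _ π ρ) cf with sound π (cf ∘ inj₁ ∘ inj₁) | sound ρ (cf ∘ inj₁ ∘ inj₂)
  ... | w , b , F | w′ , b′ , F′ = w + w′ ,
    ↔-trans ((b ⊎-↔ b′) ⊎-↔ no-bot (λ ())) (↔-trans drop-empty (↔-sym +↔⊎)) ,
    λ φ → relabel (↔-sym +↔⊎) (forest-⊗ Γ A B (π °) (ρ °) φ (F _) (F′ _))
  sound (⅋-rule Γ A B _ π) cf with sound π (cf ∘ inj₁)
  ... | w , b , F = w , ↔-trans (b ⊎-↔ no-bot (λ ())) drop-empty , λ φ → forest-⅋ Γ A B (π °) φ (F _)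
  sound (⊥-rule Γ _ π) cf with sound π (cf ∘ inj₁)
  ... | w , b , F = suc w , ↔-trans (b ⊎-↔ the-bot) (↔-trans (⊎-comm _ _) (↔-sym (+↔⊎ {1}))) ,
    λ φ → relabel (↔-sym (+↔⊎ {1})) (forest-⊥ (π °) φ (F _))

  sequentializable⇒ACC♯w : ∀ {𝓕 Γ} {R : Structure Γ} → CutFree R → SequentializableIn 𝓕 R → ACC♯w R
  sequentializable⇒ACC♯w cf (π , i) with sound π (λ c → cf (Inverse.from (_≅_.cells i cut) c))
  ... | w , b , F = w , ↔-trans (_≅_.cells i bot) b , λ φ →
    let G = forests-≅ i F φ in Forest.undirectedAcyclic G , Forest.components G

corollary52 : (atoms : AtomicFormulae) → let open MLL atoms in
    (R : ProofStructure [¬⊥⊗]LL) → let open ProofStructure R in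
    CutFree structure → ACC♯w structure ⇔ SequentializableIn [¬⊥⊗]LL structure
corollary52 atoms R cutFree = mk⇔ to (Soundness.sequentializable⇒ACC♯w atoms cutFree)
  where
  open MLL atoms
  open ProofStructure R
  to : ACC♯w structure → SequentializableIn [¬⊥⊗]LL structure
  to (w , bots , correct) =
    Sequentialization.whole atoms structure isProofStructure hasTypes cutFree acyclic
      (Sequentialization.full-balanced atoms structure isProofStructure hasTypes cutFree acyclic
        bots (proj₂ (correct (const left))))
    where
    acyclic : ∀ φ → Graph.UndirectedAcyclic (switchingGraph structure φ)
    acyclic φ = proj₁ (correct φ)
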